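{- For every integer $k\geq 3$, $E(k,5)=M_k$, where $$M_k=\begin{cases}2^{(k+1)/2}-1, & k\geq 3 \text{ odd},\\ \tfrac{3}{2}\,2^{k/2}-1, & k\geq 4\text{ even}.\end{cases}$$
   Context: A $k$-hole in a point set $S$ is a set of $k$ points of $S$ forming the vertices of a convex polygon whose interior contains no point of $S$. A pseudo-triangle is a simple polygon with exactly three vertices having interior angle less than $180^\circ$; an $\ell$-pseudo-triangle has $\ell$ vertices, and it is empty in $S$ if its vertices are in $S$ and its interior contains no point of $S$. $E(k,\ell)$ denotes the smallest integer such that every set of at least $E(k,\ell)$ points in the plane, no three on a line, contains a $k$-hole or an empty $\ell$-pseudo-triangle.
   Formalization: The points in the plane are taken to have rational rather than real coordinates. -}

module Defs where

open import Data.Bool using (Bool; true; false; if_then_else_; _∧_)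
open import Data.Nat as ℕ using (ℕ; _%_; _/_; _^_; _∸_)
open import Data.Integer as ℤ using (ℤ)
open import Data.Rational using (ℚ; 0ℚ; _+_; _*_; _-_; _<_; _≤_)
open import Data.Rational.Properties using (_<?_; _≤?_)
open import Data.Product using (_×_; _,_; proj₁; proj₂; ∃-syntax)
open import Data.Sum using (_⊎_)
open import Data.List using (List; []; _∷_; _++_; [_]; zip; length; filter; foldr)
open import Data.List.Membership.Propositional using (_∈_; _∉_)
open import Data.List.Relation.Unary.All using (All)
open import Data.List.Relation.Unary.Unique.Propositional using (Unique)
open import Relation.Nullary using (¬_; does)
open import Relation.Binary.PropositionalEquality using (_≡_; _≢_)

Point : Set
Point = ℚ × ℚ

x y : Point → ℚ
x = proj₁
y = proj₂

-- Orientation determinant: positive iff a, b, c make a left (counter-clockwise) turn.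
orient : Point → Point → Point → ℚ
orient a b c = ((x b - x a) * (y c - y a)) - ((y b - y a) * (x c - x a))

GeneralPosition : List Point → Set
GeneralPosition S = ∀ {a b c} → a ∈ S → b ∈ S → c ∈ S →
  a ≢ b → b ≢ c → a ≢ c → orient a b c ≢ 0ℚ

-- Polygons are given by their cyclic list of vertices v₀ v₁ … v_{m-1}.

rotate : List Point → List Point
rotate []       = []
rotate (p ∷ ps) = ps ++ [ p ]

edges : List Point → List (Point × Point)
edges P = zip P (rotate P)

corners : List Point → List (Point × Point × Point)
corners P = zip P (zip (rotate P) (rotate (rotate P)))

VerticesIn : List Point → List Point → Set
VerticesIn S P = Unique P × All (_∈ S) P

ConvexCCW : List Point → Set
ConvexCCW P = ∀ {a b v} → (a , b) ∈ edges P → v ∈ P → v ≢ a → v ≢ b →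
  0ℚ < orient a b v

InConvexInterior : List Point → Point → Set
InConvexInterior P p = ∀ {a b} → (a , b) ∈ edges P → 0ℚ < orient a b p

HasHole : ℕ → List Point → Set
HasHole k S = ∃[ P ] (length P ≡ k × VerticesIn S P × ConvexCCW P ×
  (∀ {p} → p ∈ S → ¬ InConvexInterior P p))

Cross : Point → Point → Point → Point → Set
Cross a b c d = (orient a b c * orient a b d) < 0ℚ × (orient c d a * orient c d b) < 0ℚ

-- Non-adjacent edges (edges with no common endpoint) do not cross.  For vertices
-- from a set in general position, this is exactly simplicity of the polygon
-- (adjacent edges can only meet at their common vertex).
Simple : List Point → Set
Simple P = ∀ {a b c d} → (a , b) ∈ edges P → (c , d) ∈ edges P →
  a ≢ c → a ≢ d → b ≢ c → b ≢ d → ¬ Cross a b c d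

-- twice the signed area (shoelace formula); positive iff counter-clockwise
area2 : List Point → ℚ
area2 P = foldr (λ e s → ((x (proj₁ e) * y (proj₂ e)) - (x (proj₂ e) * y (proj₁ e))) + s)
                0ℚ (edges P)

-- For a counter-clockwise simple polygon, the interior angle at v_{i+1} is
-- less than 180° iff (v_i, v_{i+1}, v_{i+2}) is a left turn.
numConvexCorners : List Point → ℕ
numConvexCorners P = length (filter (λ t → 0ℚ <? orient (proj₁ t) (proj₁ (proj₂ t)) (proj₂ (proj₂ t))) (corners P))

-- Winding number of a closed polygon around a point p not on its boundary
-- (standard exact crossing rule with half-open edges).
windContribution : Point → Point × Point → ℤ
windContribution p (a , b) =
  if does (y a ≤? y p) ∧ does (y p <? y b) ∧ does (0ℚ <? orient a b p) then ℤ.+ 1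
  else if does (y b ≤? y p) ∧ does (y p <? y a) ∧ does (orient a b p <? 0ℚ) then ℤ.-[1+ 0 ]
  else ℤ.+ 0

winding : List Point → Point → ℤ
winding P p = foldr (λ e s → windContribution p e ℤ.+ s) (ℤ.+ 0) (edges P)

InInterior : List Point → Point → Set
InInterior P p = p ∉ P × winding P p ≢ ℤ.+ 0

PseudoTriangleCCW : ℕ → List Point → Set
PseudoTriangleCCW ℓ P = length P ≡ ℓ × Simple P × 0ℚ < area2 P × numConvexCorners P ≡ 3

HasEmptyPseudoTriangle : ℕ → List Point → Set
HasEmptyPseudoTriangle ℓ S = ∃[ P ] (VerticesIn S P × PseudoTriangleCCW ℓ P ×
  (∀ {p} → p ∈ S → ¬ InInterior P p))

Forces : ℕ → ℕ → ℕ → Set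
Forces k ℓ N = ∀ (S : List Point) → Unique S → GeneralPosition S →
  N ℕ.≤ length S → HasHole k S ⊎ HasEmptyPseudoTriangle ℓ S

IsE : ℕ → ℕ → ℕ → Set
IsE k ℓ n = Forces k ℓ n × (∀ N → Forces k ℓ N → n ℕ.≤ N)

-- M_k = 2^((k+1)/2) - 1 for k odd, (3/2)·2^(k/2) - 1 = 3·2^(k/2 - 1) - 1 for k even
M : ℕ → ℕ
M k with k % 2
... | 0 = 3 ℕ.* 2 ^ (k / 2 ∸ 1) ∸ 1
... | _ = 2 ^ (k / 2 ℕ.+ 1) ∸ 1

{-# OPTIONS --safe #-}
module Submission where

-- For a set with at most one of its points inside any triangle, let P be a largest hole, with k
-- vertices. A point d outside P sees exactly two sides of P, so it lies behind one vertex t of P,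
-- and the line d t splits the other vertices into l left and r right ones. The points with the same
-- t and the same splitting contain no chain of min(l, r) + 1 points that together with t and one side
-- of P is a larger hole; a halving argument bounds their number by 2 ^ min(l, r) − 1. Lines with
-- different splittings are pairwise nested or disjoint, so at most k − 2 w of them have
-- min(l, r) ≥ w. Summing up gives |S| ≤ M (k + 1) − 1. If on the other hand some triangle contains
-- two points, then a smallest such triangle contains an empty 5-pseudo-triangle.
--
-- Conversely, start with a segment or with a triangle and its center, and repeatedly add next to every
-- hull point t two new hull points, slightly to both sides along a supporting line at t and slightly
-- outwards. All triangles still contain at most one point, and those spanned by hull points do contain
-- one, so that a hole has at most two vertices on the hull and grows by at most two in each step. In a
-- simple pentagon with three convex corners some triangle contains both other vertices.

open import Data.Bool using (Bool; true; false; not; if_then_else_; _∧_)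
open import Data.Empty using (⊥; ⊥-elim)
open import Data.List using (List; []; _∷_; _++_; length; filter; map; take; drop; zip; lookup; allFin)
open import Data.List.Membership.Propositional using (_∈_; _∉_; find; lose)
open import Data.List.Membership.Propositional.Properties
  using (∈-∃++; ∈-++⁺ˡ; ∈-++⁺ʳ; ∈-++⁻; ∈-filter⁺; ∈-filter⁻; ∈-map⁺; ∈-map⁻; ∈-allFin; ∈-lookup)
open import Data.List.Relation.Unary.All as All using (All; []; _∷_)
import Data.List.Relation.Unary.All.Properties as All
open import Data.List.Relation.Unary.AllPairs as AllPairs using (AllPairs; []; _∷_)
import Data.List.Relation.Unary.AllPairs.Properties as AllPairs
open import Data.List.Relation.Unary.Any as Any using (here; there)
open import Data.List.Relation.Unary.Linked using (Linked; []; [-]; _∷_)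
open import Data.List.Relation.Unary.Unique.Propositional using (Unique)
import Data.List.Relation.Unary.Unique.Propositional.Properties as Unique
open import Data.Product as Product using (Σ; _×_; _,_; proj₁; proj₂; ∃-syntax)
open import Data.Sum using (_⊎_; inj₁; inj₂; [_,_]′)
open import Data.Unit using (⊤; tt)
open import Function using (_∘_; case_of_)
open import Relation.Binary.Definitions using (tri<; tri≈; tri>)
open import Relation.Binary.PropositionalEquality
  using (_≡_; _≢_; refl; sym; trans; cong; cong₂; subst; subst₂; ≢-sym; module ≡-Reasoning)
open import Relation.Nullary using (¬_; Dec; yes; no; does; ¬?; _×-dec_; _⊎-dec_; _→-dec_)
open import Relation.Nullary.Decidable using (decidable-stable; dec-true; dec-false; from-yes)

-- Sparsity acts in one way throughout the upper bound: a triangle known to contain a vertex is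
-- full, so its remaining parts are empty. This empties the new triangles of an enlarged hole, and
-- it separates the splittings, since two crossing ones would put two vertices into one triangle.
-- These arguments need only orientation signs, and so does the doubling; coordinates enter when
-- signs are derived, when a small parameter is chosen and when polygons are translated. The count
-- is exact because the `k` vertices of the hole pay for the -1 in the bound of each group: there
-- are at most `k` groups, and removing the lightest one each time peels off one term of `G k`, the
-- sum of 2 ^ ⌊j/2⌋ over j below `k`. The doubling meets this with equality: the children number
-- exactly the next two terms of `G`, while free sets grow by at most two points. As the index rises
-- by two, each parity has its own seed. A largest hole is never named; instead, a hole of `k`
-- vertices among more than `G k` points is enlarged.

-- Orientation signs of points in the plane

module Orientations where

  open import Defs
  open import Data.Rational using (0ℚ; _+_; _*_; -_; _<_; _≤_; positive; nonNegative)
  open import Data.Rational.Properties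
  open import Data.Rational.Solver using (module +-*-Solver)

  open +-*-Solver using (solve; _:=_; _:+_; _:*_; _:-_; :-_; con; Polynomial)

  -- Knuth's axioms for the relation "a, b, c turn left"; In a b c p says that p is inside the
  -- triangle abc, which is then oriented counter-clockwise.
  record CCSystem (A : Set) : Set₁ where
    field
      L    : A → A → A → Set
      L?   : ∀ a b c → Dec (L a b c)
      cyc  : ∀ {a b c} → L a b c → L b c a
      asym : ∀ {a b c} → L a b c → ¬ L b a c
      tot  : ∀ {a b c} → a ≢ b → b ≢ c → a ≢ c → L a b c ⊎ L b a c

    In : A → A → A → A → Set
    In a b c p = L a b p × L b c p × L c a p

    field
      int  : ∀ {a b c p} → In a b c p → L a b c
      -- Within an open half-plane bounded by a line through `t`, the points are linearly ordered by
      -- angle about `t`; `tr` and `tr′` treat the two sides of the line `t s`.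
      tr   : ∀ {t s p q r} → L t s p → L t s q → L t s r → L t p q → L t q r → L t p r
      tr′  : ∀ {t s p q r} → L s t p → L s t q → L s t r → L t p q → L t q r → L t p r
      -- The negated orientations mean "on or left of `u v`", which allows `a` or `b` to coincide
      -- with `u` or `v`.
      bary : ∀ {a b c p u v} → In a b c p → ¬ L v u a → ¬ L v u b → L u v c → L u v p

  +-pos : ∀ {a b} → 0ℚ < a → 0ℚ < b → 0ℚ < a + b
  +-pos = +-mono-<

  +-nonNeg : ∀ {a b} → 0ℚ ≤ a → 0ℚ ≤ b → 0ℚ ≤ a + b
  +-nonNeg = +-mono-≤

  *-pos : ∀ {a b} → 0ℚ < a → 0ℚ < b → 0ℚ < a * b
  *-pos {a} {b} p q = positive⁻¹ (a * b) {{pos*pos⇒pos a {{positive p}} b {{positive q}}}}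

  *-nonNeg : ∀ {a b} → 0ℚ ≤ a → 0ℚ ≤ b → 0ℚ ≤ a * b
  *-nonNeg {a} {b} p q = nonNegative⁻¹ (a * b) {{nonNeg*nonNeg⇒nonNeg a {{nonNegative p}} b {{nonNegative q}}}}

  pos-cancelˡ : ∀ {a b} → 0ℚ < a → 0ℚ < a * b → 0ℚ < b
  pos-cancelˡ {a} {b} p q =
    *-cancelˡ-<-nonNeg a {{nonNegative (<⇒≤ p)}} (subst (_< a * b) (sym (*-zeroʳ a)) q)

  neg⇒pos : ∀ {a} → a < 0ℚ → 0ℚ < - a
  neg⇒pos = neg-antimono-<

  pos⇒neg : ∀ {a} → 0ℚ < a → - a < 0ℚ
  pos⇒neg = neg-antimono-<

  orientP : ∀ {n} → (a b c d e f : Polynomial n) → Polynomial n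
  orientP ax ay bx by cx cy = ((bx :- ax) :* (cy :- ay)) :- ((by :- ay) :* (cx :- ax))

  abstract
    orient-cyc : ∀ a b c → orient a b c ≡ orient b c a
    orient-cyc (ax , ay) (bx , by) (cx , cy) =
      solve 6 (λ ax ay bx by cx cy → orientP ax ay bx by cx cy := orientP bx by cx cy ax ay)
            refl ax ay bx by cx cy

    orient-anti : ∀ a b c → orient b a c ≡ - orient a b c
    orient-anti (ax , ay) (bx , by) (cx , cy) =
      solve 6 (λ ax ay bx by cx cy → orientP bx by ax ay cx cy := :- orientP ax ay bx by cx cy)
            refl ax ay bx by cx cy

    orient-sum : ∀ a b c p → orient a b c ≡ orient a b p + orient b c p + orient c a p
    orient-sum (ax , ay) (bx , by) (cx , cy) (px , py) =
      solve 8 (λ ax ay bx by cx cy px py → orientP ax ay bx by cx cy :=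
          orientP ax ay bx by px py :+ orientP bx by cx cy px py :+ orientP cx cy ax ay px py)
            refl ax ay bx by cx cy px py

    -- The three-term Grassmann-Plücker relation for the directions seen from `t`. It is the source
    -- of transitivity about a point: with positive terms on the right and one positive factor on
    -- the left, the other factor is positive.
    orient-GP : ∀ t a b c d →
      orient t a c * orient t b d ≡ orient t a b * orient t c d + orient t a d * orient t b c
    orient-GP (tx , ty) (ax , ay) (bx , by) (cx , cy) (dx , dy) =
      solve 10 (λ tx ty ax ay bx by cx cy dx dy →
          orientP tx ty ax ay cx cy :* orientP tx ty bx by dx dy :=
          orientP tx ty ax ay bx by :* orientP tx ty cx cy dx dy :+
          orientP tx ty ax ay dx dy :* orientP tx ty bx by cx cy)
            refl tx ty ax ay bx by cx cy dx dy

    -- The orientations of `b c p`, `c a p`, `a b p` are the unnormalized barycentric coordinates of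
    -- `p`, and `orient u v` is affine in its last argument.
    orient-bary : ∀ a b c p u v → orient a b c * orient u v p ≡
      orient b c p * orient u v a + orient c a p * orient u v b + orient a b p * orient u v c
    orient-bary (ax , ay) (bx , by) (cx , cy) (px , py) (ux , uy) (vx , vy) =
      solve 12 (λ ax ay bx by cx cy px py ux uy vx vy →
          orientP ax ay bx by cx cy :* orientP ux uy vx vy px py :=
          orientP bx by cx cy px py :* orientP ux uy vx vy ax ay :+
          orientP cx cy ax ay px py :* orientP ux uy vx vy bx by :+
          orientP ax ay bx by px py :* orientP ux uy vx vy cx cy)
            refl ax ay bx by cx cy px py ux uy vx vy

  left-anti : ∀ {a b c} → 0ℚ < orient a b c → orient b a c < 0ℚ
  left-anti {a} {b} {c} h = subst (_< 0ℚ) (sym (orient-anti a b c)) (pos⇒neg h)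

  right-anti : ∀ {a b c} → orient a b c < 0ℚ → 0ℚ < orient b a c
  right-anti {a} {b} {c} h = subst (0ℚ <_) (sym (orient-anti a b c)) (neg⇒pos h)

  ¬left⇒nonNeg : ∀ {a b c} → ¬ (0ℚ < orient b a c) → 0ℚ ≤ orient a b c
  ¬left⇒nonNeg {a} {b} {c} h = ≮⇒≥ λ k → h (right-anti {a} {b} {c} k)

  orientation : {A : Set} (pos : A → Point) →
    (∀ {a b c} → a ≢ b → b ≢ c → a ≢ c → orient (pos a) (pos b) (pos c) ≢ 0ℚ) → CCSystem A
  orientation {A} pos gp = record
    { L = L ; L? = λ a b c → 0ℚ <? orient (pos a) (pos b) (pos c)
    ; cyc = λ {a} {b} {c} → subst (0ℚ <_) (orient-cyc (pos a) (pos b) (pos c))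
    ; asym = λ {a} {b} {c} h k → <-asym (left-anti {pos a} {pos b} {pos c} h) k
    ; tot = λ {a} {b} {c} → tot {a} {b} {c}
    ; int = λ {a} {b} {c} {p} (h₁ , h₂ , h₃) →
        subst (0ℚ <_) (sym (orient-sum (pos a) (pos b) (pos c) (pos p))) (+-pos (+-pos h₁ h₂) h₃)
    ; tr = λ {t} {s} {p} {q} {r} sp sq sr pq qr → pos-cancelˡ sq
        (subst (0ℚ <_) (sym (orient-GP (pos t) (pos s) (pos p) (pos q) (pos r)))
          (+-pos (*-pos sp qr) (*-pos sr pq)))
    ; tr′ = λ {t} {s} {p} {q} {r} sp sq sr pq qr → pos-cancelˡ (flip sq)
        (subst (0ℚ <_) (*-comm (orient (pos t) (pos p) (pos r)) (orient (pos t) (pos q) (pos s)))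
        (subst (0ℚ <_) (sym (orient-GP (pos t) (pos p) (pos q) (pos r) (pos s)))
          (+-pos (*-pos pq (flip sr)) (subst (0ℚ <_) (*-comm (orient (pos t) (pos q) (pos r)) (orient (pos t) (pos p) (pos s))) (*-pos qr (flip sp))))))
    ; bary = λ {a} {b} {c} {p} {u} {v} (h₁ , h₂ , h₃) ka kb kc → pos-cancelˡ
        (subst (0ℚ <_) (sym (orient-sum (pos a) (pos b) (pos c) (pos p))) (+-pos (+-pos h₁ h₂) h₃))
        (subst (0ℚ <_) (sym (orient-bary (pos a) (pos b) (pos c) (pos p) (pos u) (pos v)))
          (+-mono-≤-< (+-nonNeg (*-nonNeg (<⇒≤ h₂) (¬left⇒nonNeg {pos u} {pos v} {pos a} ka))
                                (*-nonNeg (<⇒≤ h₃) (¬left⇒nonNeg {pos u} {pos v} {pos b} kb)))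
                      (*-pos h₁ kc)))
    }
    where
    L : A → A → A → Set
    L a b c = 0ℚ < orient (pos a) (pos b) (pos c)
    flip : ∀ {s t p} → L s t p → L t p s
    flip {s} {t} {p} = subst (0ℚ <_) (orient-cyc (pos s) (pos t) (pos p))
    tot : ∀ {a b c} → a ≢ b → b ≢ c → a ≢ c → L a b c ⊎ L b a c
    tot {a} {b} {c} x y z with <-cmp (orient (pos a) (pos b) (pos c)) 0ℚ
    ... | tri< h _ _ = inj₂ (right-anti {pos a} {pos b} {pos c} h)
    ... | tri≈ _ h _ = ⊥-elim (gp x y z h)
    ... | tri> _ _ h = inj₁ h

-- Counting pairwise nested chords

module Chords where

  open import Data.Bool.Properties using (not-¬) renaming (_≟_ to _≟ᵇ_)
  open import Data.Nat using (ℕ; zero; suc; _+_; _*_; _≤_; _<_; z≤n; s≤s)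
  open import Data.Nat.Properties
  open import Relation.Unary using (Decidable)

  private variable
    A : Set

  ∈-remove : ∀ {x z : A} xs {ys} → z ∈ xs ++ x ∷ ys → z ≢ x → z ∈ xs ++ ys
  ∈-remove xs z∈ z≢x with ∈-++⁻ xs z∈
  ... | inj₁ p = ∈-++⁺ˡ p
  ... | inj₂ (here p) = ⊥-elim (z≢x p)
  ... | inj₂ (there p) = ∈-++⁺ʳ xs p

  ∈-insert : ∀ {x z : A} xs {ys} → z ∈ xs ++ ys → z ∈ xs ++ x ∷ ys
  ∈-insert xs z∈ with ∈-++⁻ xs z∈
  ... | inj₁ p = ∈-++⁺ˡ p
  ... | inj₂ p = ∈-++⁺ʳ xs (there p)

  length-insert : ∀ {x : A} xs {ys} → length (xs ++ x ∷ ys) ≡ suc (length (xs ++ ys))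
  length-insert [] = refl
  length-insert (_ ∷ xs) = cong suc (length-insert xs)

  length-⊆ : {xs ys : List A} → Unique xs → (∀ {z} → z ∈ xs → z ∈ ys) → length xs ≤ length ys
  length-⊆ [] sub = z≤n
  length-⊆ {xs = x ∷ xs} (x∉ ∷ u) sub with ∈-∃++ (sub (here refl))
  ... | as , bs , refl rewrite length-insert {x = x} as {bs} =
    s≤s (length-⊆ u λ {z} z∈ → ∈-remove as (sub (there z∈)) λ { refl → All.lookup x∉ z∈ refl })

  selectMin : (m : A → ℕ) (x : A) (xs : List A) →
    Σ A λ y → Σ (List A) λ as → Σ (List A) λ bs →
      x ∷ xs ≡ as ++ y ∷ bs × (∀ {z} → z ∈ x ∷ xs → m y ≤ m z)
  selectMin m x [] = x , [] , [] , refl , λ { (here refl) → ≤-refl }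
  selectMin m x (x′ ∷ xs) with selectMin m x′ xs
  ... | y , as , bs , eq , least with ≤-total (m x) (m y)
  ...   | inj₁ le = x , [] , x′ ∷ xs , refl ,
          λ { (here refl) → ≤-refl ; (there z∈) → ≤-trans le (least z∈) }
  ...   | inj₂ le = y , x ∷ as , bs , cong (x ∷_) eq ,
          λ { (here refl) → le ; (there z∈) → least z∈ }

  AllPairs-remove : {R : A → A → Set} → (∀ {a b} → R a b → R b a) →
    ∀ as {y bs} → AllPairs R (as ++ y ∷ bs) → All (R y) (as ++ bs) × AllPairs R (as ++ bs)
  AllPairs-remove sy [] (h ∷ t) = h , t
  AllPairs-remove sy (a ∷ as) {y} {bs} (h ∷ t) with AllPairs-remove sy as t
  ... | r , ap = sy (All.lookup h (∈-++⁺ʳ as (here refl))) ∷ r ,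
    All.tabulate (λ z∈ → All.lookup h (∈-insert as z∈)) ∷ ap

  b2n : Bool → ℕ
  b2n true = 1
  b2n false = 0

  count : (A → Bool) → List A → ℕ
  count f [] = 0
  count f (x ∷ xs) = b2n (f x) + count f xs

  count-filter : {P : A → Set} (P? : Decidable P) → ∀ xs → length (filter P? xs) ≡ count (λ x → does (P? x)) xs
  count-filter P? [] = refl
  count-filter P? (x ∷ xs) with does (P? x)
  ... | true = cong suc (count-filter P? xs)
  ... | false = count-filter P? xs

  b2n-mono : ∀ {a b} → (a ≡ true → b ≡ true) → b2n a ≤ b2n b
  b2n-mono {false} h = z≤n
  b2n-mono {true} {true} h = ≤-refl
  b2n-mono {true} {false} h with () ← h refl

  count-mono : {f g : A → Bool} → ∀ xs → (∀ {x} → x ∈ xs → f x ≡ true → g x ≡ true) → count f xs ≤ count g xs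
  count-mono [] h = z≤n
  count-mono (x ∷ xs) h = +-mono-≤ (b2n-mono (h (here refl))) (count-mono xs (λ m → h (there m)))

  count-mono-< : {f g : A → Bool} → ∀ {xs} → (∀ {x} → x ∈ xs → f x ≡ true → g x ≡ true) →
    ∀ {u} → u ∈ xs → f u ≡ false → g u ≡ true → count f xs < count g xs
  count-mono-< {f = f} {g} {x ∷ xs} h (here refl) fu gu rewrite fu | gu = s≤s (count-mono xs (λ m → h (there m)))
  count-mono-< {f = f} {g} {x ∷ xs} h (there u∈) fu gu =
    +-mono-≤-< (b2n-mono (h (here refl))) (count-mono-< (λ m → h (there m)) u∈ fu gu)

  count-insert : (f : A → Bool) → ∀ xs {x ys} → count f (xs ++ x ∷ ys) ≡ b2n (f x) + count f (xs ++ ys)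
  count-insert f [] = refl
  count-insert f (z ∷ xs) {x} {ys} rewrite count-insert f xs {x} {ys}
    | sym (+-assoc (b2n (f z)) (b2n (f x)) (count f (xs ++ ys)))
    | +-comm (b2n (f z)) (b2n (f x)) = +-assoc (b2n (f x)) (b2n (f z)) _

  count-positive : {f : A → Bool} → ∀ xs → 1 ≤ count f xs → ∃[ x ] (x ∈ xs × f x ≡ true)
  count-positive {f = f} (x ∷ xs) h with f x in eq
  ... | true = x , here refl , eq
  ... | false with count-positive xs h
  ...   | y , y∈ , fy = y , there y∈ , fy

  -- A line through the vertex tip splits the other vertices into two sides.
  record Chord (A : Set) : Set where
    field
      tip  : A
      side : Bool → A → Bool
  open Chord

  -- With two sides per chord, "nested or disjoint" is one notion: a side of one chord is included
  -- in a side of the other. Each constructor also carries the complementary inclusion, which makes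
  -- the relation symmetric, and witnesses that the inclusions are strict: the tips, or for a common
  -- tip a separating vertex `u`. Strictness drives the induction below.
  data Nested (V : List A) (c d : Chord A) : Set where
    crossing : ∀ σ τ →
      (∀ {v} → v ∈ V → side c σ v ≡ true → side d τ v ≡ true) →
      (∀ {v} → v ∈ V → side d (not τ) v ≡ true → side c (not σ) v ≡ true) →
      side d τ (tip c) ≡ true → side c (not σ) (tip d) ≡ true → Nested V c d
    concurrent : ∀ σ → tip c ≡ tip d →
      (∀ {v} → v ∈ V → side c σ v ≡ true → side d σ v ≡ true) →
      (∀ {v} → v ∈ V → side d (not σ) v ≡ true → side c (not σ) v ≡ true) →
      ∀ {u} → u ∈ V → side d σ u ≡ true → side c (not σ) u ≡ true → Nested V c d

  Nested-sym : {V : List A} {c d : Chord A} → Nested V c d → Nested V d c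
  Nested-sym (crossing false false p q r s) = crossing true true q p s r
  Nested-sym (crossing false true p q r s) = crossing false true q p s r
  Nested-sym (crossing true false p q r s) = crossing true false q p s r
  Nested-sym (crossing true true p q r s) = crossing false false q p s r
  Nested-sym (concurrent false e p q u r s) = concurrent true (sym e) q p u s r
  Nested-sym (concurrent true e p q u r s) = concurrent false (sym e) q p u s r

  record IsChord (V : List A) (w : ℕ) (c : Chord A) : Set where
    field
      tip∈     : tip c ∈ V
      tip-off  : ∀ σ → side c σ (tip c) ≡ false
      disjoint : ∀ σ {v} → side c σ v ≡ true → side c (not σ) v ≡ false
      cover    : ∀ σ {v} → v ∈ V → v ≢ tip c → side c σ v ≡ false → side c (not σ) v ≡ true
      total    : suc (count (side c true) V + count (side c false) V) ≤ length V
      large    : ∀ σ → w ≤ count (side c σ) V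
  open IsChord

  t≢f : ∀ {b : Bool} → b ≡ true → b ≢ false
  t≢f refl ()

  -- What another chord `d` must satisfy for `v` to be removed from the minimal side σ of `c`: the
  -- side of `d` that loses `v` is strictly larger, so it keeps at least as many vertices as σ had.
  -- `tipSide` serves to replace `v` where it separates concurrent chords.
  record Behind (V : List A) (c d : Chord A) (σ : Bool) (v : A) : Set where
    field
      ρ       : Bool
      on      : side d ρ v ≡ true
      larger  : count (side c σ) V < count (side d ρ) V
      tipSide : side d ρ (tip c) ≡ true ⊎ (tip c ≡ tip d × ρ ≡ σ)

  flipB : ∀ σ {τ} → τ ≢ σ → τ ≡ not σ
  flipB false {false} h = ⊥-elim (h refl)
  flipB false {true} h = refl
  flipB true {false} h = refl
  flipB true {true} h = ⊥-elim (h refl)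

  not-not : ∀ σ → not (not σ) ≡ σ
  not-not false = refl
  not-not true = refl

  not≡ : ∀ {σ τ} → τ ≡ not σ → not τ ≡ σ
  not≡ {σ} refl = not-not σ

  -- the remaining cases shrink a side below the minimal one
  behind : ∀ {V : List A} {w c d σ v} → IsChord V w c → IsChord V w d → Nested V c d →
    (∀ τ → count (side c σ) V ≤ count (side d τ) V) →
    v ∈ V → side c σ v ≡ true → Behind V c d σ v
  behind {V = V} {c = c} {d} {σ} {v} ic id (crossing ς τ p q r s) mn v∈ sv with ς ≟ᵇ σ
  ... | yes refl = record { ρ = τ ; on = p v∈ sv ; tipSide = inj₁ r
        ; larger = count-mono-< p (tip∈ ic) (tip-off ic σ) r }
  ... | no ne with not≡ (flipB σ ne)
  ...   | refl = ⊥-elim (<⇒≱ (count-mono-< q (tip∈ id) (tip-off id _) s) (mn (not τ)))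
  behind {V = V} {c = c} {d} {σ} {v} ic id (concurrent ς e p q u∈ r s) mn v∈ sv with ς ≟ᵇ σ
  ... | yes refl = record { ρ = ς ; on = p v∈ sv ; tipSide = inj₂ (e , refl)
        ; larger = count-mono-< p u∈ (subst (λ b → side c b _ ≡ false) (not-not ς) (disjoint ic (not ς) s)) r }
  ... | no ne with not≡ (flipB σ ne)
  ...   | refl = ⊥-elim (<⇒≱ (count-mono-< q u∈ (disjoint id ς r) s) (mn (not ς)))

  same-side : ∀ {V : List A} {w d ρ τ v} → IsChord V w d → side d ρ v ≡ true → side d τ v ≡ true → ρ ≡ τ
  same-side {ρ = ρ} {τ} id p q with τ ≟ᵇ ρ
  ... | yes eq = sym eq
  ... | no ne with flipB ρ ne
  ...   | refl = ⊥-elim (t≢f q (disjoint id ρ p))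

  module _ {as bs : List A} {v : A} {c : Chord A} {σ : Bool} {w : ℕ}
    (w≤ : w ≤ count (side c σ) (as ++ v ∷ bs)) (tip∈′ : tip c ∈ as ++ v ∷ bs) (tip≢ : tip c ≢ v) where

    count-split : ∀ (f : A → Bool) → count f (as ++ v ∷ bs) ≡ b2n (f v) + count f (as ++ bs)
    count-split f = count-insert f as

    IsChord-remove : ∀ {d} → IsChord (as ++ v ∷ bs) w d → Behind (as ++ v ∷ bs) c d σ v → IsChord (as ++ bs) w d
    IsChord-remove {d} id b = record
      { tip∈ = ∈-remove as (tip∈ id) λ { refl → t≢f (on b) (tip-off id (ρ b)) }
      ; tip-off = tip-off id ; disjoint = disjoint id
      ; cover = λ σ v∈ → cover id σ (∈-insert as v∈)
      ; total = total′ (ρ b) (on b)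
      ; large = large′ }
      where
      open Behind
      V′ = as ++ bs
      total′ : ∀ ρ → side d ρ v ≡ true → suc (count (side d true) V′ + count (side d false) V′) ≤ length V′
      total′ true h with total id
      ... | t rewrite count-split (side d true) | count-split (side d false) | h | disjoint id true h
            | length-insert {x = v} as {bs} = ≤-pred t
      total′ false h with total id
      ... | t rewrite count-split (side d true) | count-split (side d false) | h | disjoint id false h
            | length-insert {x = v} as {bs} | +-suc (count (side d true) V′) (count (side d false) V′) = ≤-pred t
      large′ : ∀ τ → w ≤ count (side d τ) V′
      large′ τ with τ ≟ᵇ ρ b
      ... | yes refl = ≤-pred (≤-trans (s≤s w≤) (subst (λ k → suc (count (side c σ) (as ++ v ∷ bs)) ≤ k)
              (trans (count-split (side d τ)) (cong (λ k → b2n k + count (side d τ) V′) (on b))) (larger b)))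
      ... | no ne with flipB (ρ b) ne
      ...   | refl = subst (w ≤_) (trans (count-split (side d τ))
                       (cong (λ k → b2n k + count (side d τ) V′) (disjoint id (ρ b) (on b)))) (large id τ)

    -- Only a separating vertex of two concurrent chords can get lost. If it was `v`, then `tip c`
    -- separates them as well; its other possible positions contradict each other.
    Nested-remove : (∀ x → Dec (x ≡ v)) → ∀ {d e} → IsChord (as ++ v ∷ bs) w d → IsChord (as ++ v ∷ bs) w e →
      Behind (as ++ v ∷ bs) c d σ v → Behind (as ++ v ∷ bs) c e σ v →
      Nested (as ++ v ∷ bs) d e → Nested (as ++ bs) d e
    Nested-remove _ id ie bd be (crossing σ τ p q r s) =
      crossing σ τ (λ z∈ → p (∈-insert as z∈)) (λ z∈ → q (∈-insert as z∈)) r s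
    Nested-remove _≟v {d} {e} id ie bd be (concurrent ς eq p q {u} u∈ r s) with u ≟v
    ... | no u≢v = concurrent ς eq (λ z∈ → p (∈-insert as z∈)) (λ z∈ → q (∈-insert as z∈)) (∈-remove as u∈ u≢v) r s
    ... | yes refl with same-side id (Behind.on bd) s | same-side ie (Behind.on be) r
    ...   | refl | refl with Behind.tipSide bd | Behind.tipSide be
    ...     | inj₁ k | inj₁ l = concurrent ς eq (λ z∈ → p (∈-insert as z∈)) (λ z∈ → q (∈-insert as z∈))
                (∈-remove as tip∈′ tip≢) l k
    ...     | inj₁ k | inj₂ (h , _) = ⊥-elim (t≢f k (trans (cong (side d _) (trans h (sym eq))) (tip-off id _)))
    ...     | inj₂ (h , _) | inj₁ l = ⊥-elim (t≢f l (trans (cong (side e _) (trans h eq)) (tip-off ie _)))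
    ...     | inj₂ (_ , k) | inj₂ (_ , l) = ⊥-elim (not-¬ refl (trans l (sym k)))

  minSide : ∀ V (c : Chord A) → ∃[ σ ] (∀ τ → count (side c σ) V ≤ count (side c τ) V)
  minSide V c with ≤-total (count (side c true) V) (count (side c false) V)
  ... | inj₁ le = true , λ { true → ≤-refl ; false → le }
  ... | inj₂ le = false , λ { true → le ; false → ≤-refl }

  -- Induction: the chord with the smallest side is removed together with a vertex of that side.
  chord-bound : (∀ (a b : A) → Dec (a ≡ b)) → ∀ {V : List A} {w} → 1 ≤ w → ∀ c cs →
    All (IsChord V w) (c ∷ cs) → AllPairs (Nested V) (c ∷ cs) → length (c ∷ cs) + 2 * w ≤ length V
  chord-bound {A = A} _≟_ {w = w} 1≤w c cs = go (length cs) c cs refl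
    where
    go : ∀ N {V : List A} c cs → length cs ≡ N → All (IsChord V w) (c ∷ cs) → AllPairs (Nested V) (c ∷ cs) →
      length (c ∷ cs) + 2 * w ≤ length V
    -- A single chord consists of its tip and two sides of at least `w` vertices.
    go zero c [] _ (ic ∷ []) _ = ≤-trans (s≤s (+-mono-≤ (large ic true)
      (subst (_≤ _) (sym (+-identityʳ w)) (large ic false)))) (total ic)
    go (suc N) {V} c cs eq ics ns with selectMin (λ d → count (side d (proj₁ (minSide V d))) V) c cs
    ... | d , as , bs , cs≡ , least with subst (All (IsChord V w)) cs≡ ics
                                     | subst (AllPairs (Nested V)) cs≡ ns
                                     | suc-injective (trans (sym (length-insert as)) (trans (cong length (sym cs≡)) (cong suc eq)))
    ... | ics′ | ns′ | eq′ with as ++ bs in ds≡ | AllPairs-remove Nested-sym as ns′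
    ...   | e ∷ es | nd , ns″
      with proj₁ (minSide V d) in σ≡
         | count-positive V (≤-trans 1≤w (large (All.lookup ics′ (∈-++⁺ʳ as (here refl))) (proj₁ (minSide V d))))
    ...   | σ | v , v∈ , sv with ∈-∃++ v∈
    ...     | p , q , refl =
      subst₂ _≤_ (cong (λ k → suc k + 2 * w) (trans (cong length (sym ds≡))
         (suc-injective (trans (sym (length-insert as)) (cong length (sym cs≡)))))) (sym (length-insert p))
       (s≤s (go N e es (suc-injective eq′) rem₁ rem₂))
      where
      id : IsChord V w d
      id = All.lookup ics′ (∈-++⁺ʳ as (here refl))
      ∈cs : ∀ {z} → z ∈ e ∷ es → z ∈ c ∷ cs
      ∈cs {z} z∈ = subst (z ∈_) (sym cs≡) (∈-insert as (subst (z ∈_) (sym ds≡) z∈))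
      sv′ : side d σ v ≡ true
      sv′ = sv
      isC : ∀ {z} → z ∈ e ∷ es → IsChord V w z
      isC z∈ = All.lookup ics (∈cs z∈)
      beh : ∀ {z} → z ∈ e ∷ es → Behind V d z σ v
      beh {z} z∈ = behind id (isC z∈) (All.lookup nd z∈)
        (λ τ → ≤-trans (least (∈cs z∈)) (proj₂ (minSide V z) τ)) v∈ sv′
      tip≢ : tip d ≢ v
      tip≢ refl = t≢f sv′ (tip-off id σ)
      rem₁ : All (IsChord (p ++ q) w) (e ∷ es)
      rem₁ = All.tabulate λ z∈ → IsChord-remove {as = p} (large id σ) (tip∈ id) tip≢ (isC z∈) (beh z∈)
      rem₂ : AllPairs (Nested (p ++ q)) (e ∷ es)
      rem₂ = restrict (λ a∈ b∈ → Nested-remove {as = p} (large id σ) (tip∈ id) tip≢ (_≟ v) (isC a∈) (isC b∈) (beh a∈) (beh b∈)) ns″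
        where
        restrict : ∀ {xs : List (Chord A)} {R S : Chord A → Chord A → Set} →
          (∀ {a b} → a ∈ xs → b ∈ xs → R a b → S a b) → AllPairs R xs → AllPairs S xs
        restrict f [] = []
        restrict f (h ∷ t) = All.tabulate (λ z∈ → f (here refl) (there z∈) (All.lookup h z∈))
                             ∷ restrict (λ a∈ b∈ → f (there a∈) (there b∈)) t

-- Holes in sets with at most one point in any triangle

module ConvexPosition where

  open Orientations
  open Chords
  open import Data.Bool.Properties using () renaming (_≟_ to _≟ᵇ_)
  open import Data.Nat as ℕ using (ℕ; zero; suc; _+_; _*_; _^_; _∸_; _⊓_; ⌊_/2⌋; _≤_; _<_; z≤n; s≤s)
  import Data.Nat.Properties as ℕₚ
  open import Data.Nat.ListAction using (sum)
  open import Data.List.Properties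
    using (length-++; length-take; length-drop; take++drop≡id; ++-assoc; ++-identityʳ; ∷-injectiveˡ; ∷-injectiveʳ; length-filter; filter-accept; length-map; ≡-dec)

  private variable
    A : Set

  sides : List A → List (A × A)
  sides [] = []
  sides (v ∷ vs) = zip (v ∷ vs) (vs ++ v ∷ [])

  sides-split : ∀ {v a b : A} x xs → (a , b) ∈ zip (x ∷ xs) (xs ++ v ∷ []) →
    (∃[ as ] ∃[ bs ] x ∷ xs ≡ as ++ a ∷ b ∷ bs) ⊎ (∃[ as ] (x ∷ xs ≡ as ++ a ∷ [] × b ≡ v))
  sides-split x [] (here refl) = inj₂ ([] , refl , refl)
  sides-split x (y ∷ xs) (here refl) = inj₁ ([] , xs , refl)
  sides-split x (y ∷ xs) (there m) with sides-split y xs m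
  ... | inj₁ (as , bs , eq) = inj₁ (x ∷ as , bs , cong (x ∷_) eq)
  ... | inj₂ (as , eq , b≡v) = inj₂ (x ∷ as , cong (x ∷_) eq , b≡v)

  ∈-rotate : ∀ {z : A} as {bs : List A} → z ∈ as ++ bs → z ∈ bs ++ as
  ∈-rotate as {bs} m = [ ∈-++⁺ʳ bs , ∈-++⁺ˡ ]′ (∈-++⁻ as m)

  linked-join : {R : A → A → Set} → ∀ xs {b ys} → Linked R (xs ++ b ∷ []) → Linked R (b ∷ ys) → Linked R (xs ++ b ∷ ys)
  linked-join [] _ l = l
  linked-join (x ∷ []) (r ∷ _) l = r ∷ l
  linked-join (x ∷ x′ ∷ xs) (r ∷ k) l = r ∷ linked-join (x′ ∷ xs) k l

  allPairs-++⁻ : {R : A → A → Set} → ∀ xs {ys} → AllPairs R (xs ++ ys) →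
    AllPairs R xs × AllPairs R ys × (∀ {x y} → x ∈ xs → y ∈ ys → R x y)
  allPairs-++⁻ [] r = [] , r , λ ()
  allPairs-++⁻ (x ∷ xs) (h ∷ t) with allPairs-++⁻ xs t
  ... | p , q , r = All.++⁻ˡ xs h ∷ p , q ,
    λ { (here refl) y∈ → All.lookup (All.++⁻ʳ xs h) y∈ ; (there x∈) y∈ → r x∈ y∈ }

  lastTwo : ∀ (xs : List A) → 2 ≤ length xs → ∃[ ys ] ∃[ a ] ∃[ b ] xs ≡ ys ++ a ∷ b ∷ []
  lastTwo (a ∷ b ∷ []) _ = [] , a , b , refl
  lastTwo (x ∷ xs@(_ ∷ _ ∷ _)) _ with lastTwo xs (s≤s (s≤s z≤n))
  ... | ys , a , b , eq = x ∷ ys , a , b , cong (x ∷_) eq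
  lastTwo (_ ∷ []) (s≤s ())

  -- Convexity and holes are invariant under rotation, so a claim about an arbitrary side reduces to
  -- the first side of a list.
  rotateTo : ∀ {v w : A} {vs a b} → (a , b) ∈ sides (v ∷ w ∷ vs) →
    ∃[ R ] ∃[ as ] ∃[ bs ] (v ∷ w ∷ vs ≡ as ++ bs × a ∷ b ∷ R ≡ bs ++ as)
  rotateTo {v = v} {w} {vs} {a} m with sides-split v (w ∷ vs) m
  ... | inj₁ (as , bs , eq) = bs ++ as , as , _ , eq , refl
  ... | inj₂ ([] , () , _)
  ... | inj₂ (u ∷ as , eq , refl) with ∷-injectiveˡ eq
  ...   | refl = as , u ∷ as , a ∷ [] , eq , refl

  does-true : {P : Set} (p? : Dec P) → does p? ≡ true → P
  does-true (yes p) _ = p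

  does-false : {P : Set} (p? : Dec P) → does p? ≡ false → ¬ P
  does-false (no ¬p) _ = ¬p

  count-member : {f : A → Bool} {x : A} → ∀ {xs} → x ∈ xs → f x ≡ true → 1 ≤ count f xs
  count-member {f = f} {x} {xs} x∈ fx =
    ℕₚ.≤-trans (s≤s z≤n) (count-mono-< {f = λ _ → false} {f} (λ _ ()) x∈ refl fx)

  count-disjoint : {f g : A → Bool} → (∀ {x} → f x ≡ true → g x ≡ false) → ∀ xs → count f xs + count g xs ≤ length xs
  count-disjoint d [] = z≤n
  count-disjoint {f = f} {g} d (x ∷ xs) with f x in fx | g x in gx
  ... | true | true = ⊥-elim (t≢f gx (d fx))
  ... | true | false = s≤s (count-disjoint d xs)
  ... | false | true = subst (_≤ suc (length xs)) (sym (ℕₚ.+-suc (count f xs) (count g xs))) (s≤s (count-disjoint d xs))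
  ... | false | false = ℕₚ.m≤n⇒m≤1+n (count-disjoint d xs)

  count-sides : {f g : A → Bool} {t : A} → ∀ {xs} → t ∈ xs → f t ≡ false → g t ≡ false →
    (∀ {x} → f x ≡ true → g x ≡ false) → suc (count f xs + count g xs) ≤ length xs
  count-sides {f = f} {g} {t} t∈ ft gt d with ∈-∃++ t∈
  ... | as , bs , refl rewrite count-insert f as {t} {bs} | count-insert g as {t} {bs} | ft | gt
    | length-insert {x = t} as {bs} = s≤s (count-disjoint d (as ++ bs))

  -- G K = M (K + 1) − 1 is the largest size of a set without a (K + 1)-hole and an empty
  -- 5-pseudo-triangle.
  G : ℕ → ℕ
  G zero = 0
  G (suc j) = G j + 2 ^ ⌊ j /2⌋

  count-++ : (f : A → Bool) → ∀ xs {ys} → count f (xs ++ ys) ≡ count f xs + count f ys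
  count-++ f [] = refl
  count-++ f (x ∷ xs) {ys} = trans (cong (b2n (f x) +_) (count-++ f xs)) (sym (ℕₚ.+-assoc (b2n (f x)) (count f xs) (count f ys)))

  count-rotate : (f : A → Bool) → ∀ {t : A} as {bs} → f t ≡ false → count f (as ++ t ∷ bs) ≡ count f (bs ++ as)
  count-rotate f {t} as {bs} ft rewrite count-++ f as {t ∷ bs} | count-++ f bs {as} | ft = ℕₚ.+-comm (count f as) (count f bs)

  count-partition : {f g : A → Bool} → ∀ xs → (∀ {x} → x ∈ xs → f x ≡ true → g x ≡ false) →
    (∀ {x} → x ∈ xs → f x ≡ false → g x ≡ true) → count f xs + count g xs ≡ length xs
  count-partition [] _ _ = refl
  count-partition {f = f} {g} (x ∷ xs) d c with f x in fx
  ... | true rewrite d (here refl) fx = cong suc (count-partition xs (λ m → d (there m)) (λ m → c (there m)))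
  ... | false rewrite c (here refl) fx = trans (ℕₚ.+-suc (count f xs) (count g xs))
    (cong suc (count-partition xs (λ m → d (there m)) (λ m → c (there m))))

  map-differ : (f g : A → Bool) → ∀ xs → map f xs ≢ map g xs → ∃[ u ] (u ∈ xs × f u ≢ g u)
  map-differ f g [] ne = ⊥-elim (ne refl)
  map-differ f g (x ∷ xs) ne with f x ≟ᵇ g x
  ... | no fx≢gx = x , here refl , fx≢gx
  ... | yes fx≡gx with map-differ f g xs (λ eq → ne (cong₂ _∷_ fx≡gx eq))
  ...   | u , u∈ , ne′ = u , there u∈ , ne′

  filter-split : {P : A → Set} (P? : ∀ x → Dec (P x)) → ∀ xs →
    length (filter P? xs) + length (filter (λ x → ¬? (P? x)) xs) ≡ length xs
  filter-split P? [] = refl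
  filter-split P? (x ∷ xs) with does (P? x)
  ... | true = cong suc (filter-split P? xs)
  ... | false = trans (ℕₚ.+-suc (length (filter P? xs)) _) (cong suc (filter-split P? xs))

  filter-filter : {P Q : A → Set} (P? : ∀ x → Dec (P x)) (Q? : ∀ x → Dec (Q x)) → ∀ xs →
    length (filter P? (filter Q? xs)) ≤ length (filter P? xs)
  filter-filter P? Q? [] = z≤n
  filter-filter P? Q? (x ∷ xs) with does (Q? x)
  ... | true with does (P? x)
  ...   | true = s≤s (filter-filter P? Q? xs)
  ...   | false = filter-filter P? Q? xs
  filter-filter P? Q? (x ∷ xs) | false with does (P? x)
  ...   | true = ℕₚ.m≤n⇒m≤1+n (filter-filter P? Q? xs)
  ...   | false = filter-filter P? Q? xs

  -- Greedy choice: the first element represents everything related to it, at most `w x` elements,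
  -- and these are filtered out. Filtering only shrinks the classes of the rest, so their bounds
  -- persist; `n` bounds the recursion.
  representatives : {R : A → A → Set} (R? : ∀ a b → Dec (R a b)) → (∀ a → R a a) → (w : A → ℕ) →
    ∀ n xs → length xs ≤ n → (∀ {x} → x ∈ xs → length (filter (R? x) xs) ≤ w x) →
    ∃[ rs ] (AllPairs (λ a b → ¬ R a b) rs × (∀ {x} → x ∈ rs → x ∈ xs) × length xs ≤ sum (map w rs))
  representatives R? rf w n [] _ _ = [] , [] , (λ ()) , z≤n
  representatives R? rf w (suc n) (x ∷ xs) (s≤s le) small with representatives R? rf w n rest len small′
    where
    rest = filter (λ y → ¬? (R? x y)) xs
    len : length rest ≤ n
    len = ℕₚ.≤-trans (length-filter _ xs) le
    small′ : ∀ {y} → y ∈ rest → length (filter (R? y) rest) ≤ w y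
    small′ {y} y∈ = ℕₚ.≤-trans (filter-filter (R? y) (λ z → ¬? (R? x z)) xs)
      (ℕₚ.≤-trans (drop-head (R? y) x xs) (small (there (proj₁ (∈-filter⁻ _ {xs = xs} y∈)))))
      where
      drop-head : {P : _ → Set} (P? : ∀ z → Dec (P z)) → ∀ z zs → length (filter P? zs) ≤ length (filter P? (z ∷ zs))
      drop-head P? z zs with does (P? z)
      ... | true = ℕₚ.n≤1+n _
      ... | false = ℕₚ.≤-refl
  ... | rs , apart , sub , bound = x ∷ rs ,
    All.tabulate (λ r∈ → proj₂ (∈-filter⁻ (λ y → ¬? (R? x y)) {xs = xs} (sub r∈))) ∷ apart ,
    (λ { (here p) → here p ; (there r∈) → there (proj₁ (∈-filter⁻ (λ y → ¬? (R? x y)) {xs = xs} (sub r∈))) }) ,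
    ℕₚ.≤-trans (ℕₚ.≤-reflexive (cong suc (sym (filter-split (R? x) xs))))
      (ℕₚ.+-mono-≤ (ℕₚ.≤-trans (ℕₚ.≤-reflexive (sym accept)) (small (here refl))) bound)
    where
    accept : length (filter (R? x) (x ∷ xs)) ≡ suc (length (filter (R? x) xs))
    accept = cong length (filter-accept (R? x) (rf x))

  sum-remove : (w : A → ℕ) → ∀ as {y bs} → sum (map w (as ++ y ∷ bs)) ≡ w y + sum (map w (as ++ bs))
  sum-remove w [] = refl
  sum-remove w (a ∷ as) {y} {bs} rewrite sum-remove w as {y} {bs} | sym (ℕₚ.+-assoc (w a) (w y) (sum (map w (as ++ bs))))
    | ℕₚ.+-comm (w a) (w y) = ℕₚ.+-assoc (w y) (w a) _

  sum-pred : (w : A → ℕ) → (∀ x → 1 ≤ w x) → ∀ xs → sum (map (λ x → ℕ.pred (w x)) xs) + length xs ≡ sum (map w xs)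
  sum-pred w pos [] = refl
  sum-pred w pos (x ∷ xs) with w x | pos x
  ... | suc k | _ = trans (ℕₚ.+-suc _ (length xs)) (cong suc (trans (ℕₚ.+-assoc k _ (length xs)) (cong (k +_) (sum-pred w pos xs))))

  j≤Gj : ∀ j → j ≤ G j
  j≤Gj zero = z≤n
  j≤Gj (suc j) = subst (_≤ G (suc j)) (ℕₚ.+-comm j 1) (ℕₚ.+-mono-≤ (j≤Gj j) (ℕₚ.m^n>0 2 ⌊ j /2⌋))

  -- If every subfamily obeys the chord bound, its smallest weights are the largest possible.
  sum-bound : {R : A → A → Set} → (∀ {a b} → R a b → R b a) → (m : A → ℕ) → ∀ k →
    (∀ x xs → AllPairs R (x ∷ xs) → (∀ {y} → y ∈ x ∷ xs → m x ≤ m y) → length (x ∷ xs) + 2 * m x ≤ k) →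
    ∀ N xs → length xs ≡ N → AllPairs R xs → sum (map (λ x → 2 ^ m x) xs) + G (k ∸ N) ≤ G k × N ≤ k
  sum-bound sy m k ch zero [] _ _ = ℕₚ.≤-refl , z≤n
  sum-bound sy m k ch (suc N) (x ∷ xs) len rs with selectMin m x xs
  ... | y , as , bs , eq , least with AllPairs-remove sy as (subst (AllPairs _) eq rs)
  ...   | ry , rs′ with sum-bound sy m k ch N (as ++ bs) len′ rs′
    where
    len′ : length (as ++ bs) ≡ N
    len′ = ℕₚ.suc-injective (trans (sym (length-insert as)) (trans (cong length (sym eq)) len))
  ...     | ih , _ = total , sN≤k
    where
    len″ : suc (length (as ++ bs)) ≡ suc N
    len″ = trans (sym (length-insert as)) (trans (cong length (sym eq)) len)
    c : suc N + 2 * m y ≤ k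
    c = subst (λ l → l + 2 * m y ≤ k) len″ (ch y (as ++ bs) (ry ∷ rs′)
      λ { (here refl) → ℕₚ.≤-refl ; (there z∈) → least (subst (_ ∈_) (sym eq) (∈-insert as z∈)) })
    sN≤k : suc N ≤ k
    sN≤k = ℕₚ.≤-trans (ℕₚ.m≤m+n (suc N) _) c
    -- Exactly the exponent of the term by which `G (k ∸ N)` exceeds `G (k ∸ suc N)`, so the
    -- lightest element is paid for by one term of `G`.
    half : m y ≤ ⌊ (k ∸ suc N) /2⌋
    half = subst (_≤ ⌊ (k ∸ suc N) /2⌋) (sym (ℕₚ.n≡⌊n+n/2⌋ (m y)))
      (ℕₚ.⌊n/2⌋-mono (ℕₚ.m+n≤o⇒m≤o∸n (m y + m y) (subst (_≤ k)
        (trans (ℕₚ.+-comm (suc N) _) (cong (λ j → m y + j + suc N) (ℕₚ.+-identityʳ (m y)))) c)))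
    S = sum (map (λ x → 2 ^ m x) (as ++ bs))
    open ℕₚ.≤-Reasoning
    total : sum (map (λ x → 2 ^ m x) (x ∷ xs)) + G (k ∸ suc N) ≤ G k
    total = begin
      sum (map (λ x → 2 ^ m x) (x ∷ xs)) + G (k ∸ suc N)
        ≡⟨ cong (λ l → sum (map (λ x → 2 ^ m x) l) + G (k ∸ suc N)) eq ⟩
      sum (map (λ x → 2 ^ m x) (as ++ y ∷ bs)) + G (k ∸ suc N)
        ≡⟨ cong (_+ G (k ∸ suc N)) (sum-remove (λ x → 2 ^ m x) as) ⟩
      2 ^ m y + S + G (k ∸ suc N)
        ≡⟨ cong (_+ G (k ∸ suc N)) (ℕₚ.+-comm (2 ^ m y) S) ⟩
      S + 2 ^ m y + G (k ∸ suc N)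
        ≡⟨ ℕₚ.+-assoc S (2 ^ m y) _ ⟩
      S + (2 ^ m y + G (k ∸ suc N))
        ≤⟨ ℕₚ.+-monoʳ-≤ S (ℕₚ.+-monoˡ-≤ _ (ℕₚ.^-monoʳ-≤ 2 half)) ⟩
      S + (2 ^ ⌊ (k ∸ suc N) /2⌋ + G (k ∸ suc N))
        ≡⟨ cong (S +_) (ℕₚ.+-comm (2 ^ ⌊ (k ∸ suc N) /2⌋) _) ⟩
      S + G (suc (k ∸ suc N))
        ≡⟨ cong (λ j → S + G j) (sym (ℕₚ.+-∸-assoc 1 sN≤k)) ⟩
      S + G (k ∸ N)
        ≤⟨ ih ⟩
      G k ∎

  -- Convex position and holes in terms of signs

  module Planar {A : Set} (C : CCSystem A) where
    open CCSystem C public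

    cyc² : ∀ {a b c} → L a b c → L c a b
    cyc² = cyc ∘ cyc

    ≢₁₂ : ∀ {a b c} → L a b c → a ≢ b
    ≢₁₂ h refl = asym h h

    ≢₂₃ : ∀ {a b c} → L a b c → b ≢ c
    ≢₂₃ = ≢₁₂ ∘ cyc

    ≢₁₃ : ∀ {a b c} → L a b c → a ≢ c
    ≢₁₃ h refl = ≢₁₂ (cyc² h) refl

    asym₂₃ : ∀ {a b c} → L a b c → ¬ L a c b
    asym₂₃ h k = asym (cyc h) (cyc k)

    flip : ∀ {a b c} → a ≢ b → b ≢ c → a ≢ c → ¬ L b a c → L a b c
    flip p q r h = [ (λ k → k) , ⊥-elim ∘ h ]′ (tot p q r)

    In-cyc : ∀ {a b c p} → In a b c p → In b c a p
    In-cyc (h , k , l) = k , l , h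

    In-sub : ∀ {a b c p q} → In a b c p → In a b p q → In a b c q
    In-sub i@(_ , h₂ , h₃) j@(k₁ , _ , _) =
      k₁ ,
      bary j (asym (cyc (int i))) (λ h → ≢₂₃ h refl) h₂ ,
      bary j (λ h → ≢₁₃ h refl) (asym (cyc² (int i))) h₃

    In-distinct : ∀ {a b c p} → In a b c p → a ≢ b × b ≢ c × a ≢ c × p ≢ a × p ≢ b × p ≢ c
    In-distinct i@(h , k , _) = ≢₁₂ (int i) , ≢₂₃ (int i) , ≢₁₃ (int i) ,
      ≢-sym (≢₁₃ h) , ≢-sym (≢₂₃ h) , ≢-sym (≢₂₃ k)

    -- The corners cannot all lie on one side of the line `p q`, because then `p` would lie strictly
    -- on that side, too. A change of side between two successive corners names the part that
    -- contains `q`.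
    In-split : ∀ {a b c p q} → In a b c p → In a b c q → p ≢ q → In a b p q ⊎ In b c p q ⊎ In c a p q
    In-split {a} {b} {c} {p} {q} i@(h₁ , h₂ , h₃) (k₁ , k₂ , k₃) ne = go (side h₃ k₃) (side h₁ k₁) (side h₂ k₂)
      where
      side : ∀ {u v} → L v u p → L v u q → L u p q ⊎ L p u q
      side m n = tot (≢₂₃ m) ne (≢₂₃ n)
      go : L a p q ⊎ L p a q → L b p q ⊎ L p b q → L c p q ⊎ L p c q → In a b p q ⊎ In b c p q ⊎ In c a p q
      go (inj₂ x) (inj₁ y) _ = inj₁ (k₁ , y , x)
      go _ (inj₂ x) (inj₁ y) = inj₂ (inj₁ (k₂ , y , x))
      go (inj₁ y) _ (inj₂ x) = inj₂ (inj₂ (k₃ , y , x))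
      go (inj₁ x) (inj₁ y) (inj₁ z) = ⊥-elim (≢₁₃ (bary i (asym (cyc x)) (asym (cyc y)) (cyc z)) refl)
      go (inj₂ x) (inj₂ y) (inj₂ z) = ⊥-elim (≢₂₃ (bary i (asym (cyc² x)) (asym (cyc² y)) (cyc² z)) refl)

    -- Convexity of a chain sorted about `t` is a local property: as seen from `b`, the points `d`,
    -- `t`, `a` lie to the left of `b c` in this angular order. `chainʳ` argues in the same way
    -- about the point `c`.
    chainˡ : ∀ {t a b c d} → L t a b → L t b c → L t b d → L a b c → L b c d → L a b d
    chainˡ tab tbc tbd abc bcd = cyc² (tr bcd (cyc tbc) (cyc abc) (cyc tbd) (cyc² tab))

    chainʳ : ∀ {t a b c d} → L t a c → L t b c → L t c d → L a b c → L b c d → L a c d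
    chainʳ tac tbc tcd abc bcd = cyc² (tr′ bcd (cyc tbc) (cyc abc) (cyc tcd) (cyc² tac))

    cochainˡ : ∀ {t a b c d} → L t a b → L t b c → L t b d → L t a d → L b a c → L c b d → L b a d
    cochainˡ tab tbc tbd tad bac cbd =
      flip (≢-sym (≢₂₃ tab)) (≢₂₃ tad) (≢₂₃ tbd) λ abd →
        asym (cyc tab) (tr (cyc abd) (cyc cbd) (cyc tbd) bac (cyc tbc))

    cochainʳ : ∀ {t a b c d} → L t a c → L t b c → L t c d → L t a d → L b a c → L c b d → L c a d
    cochainʳ tac tbc tcd tad bac cbd =
      flip (≢-sym (≢₂₃ tac)) (≢₂₃ tad) (≢₂₃ tcd) λ acd →
        asym tcd (tr′ (cyc tac) (cyc bac) acd (cyc² tbc) cbd)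

    -- All triples in list order turn left, not only consecutive ones, so that sublists and
    -- rotations inherit the property directly.
    conv : List A → Set
    conv [] = ⊤
    conv (v ∷ vs) = AllPairs (L v) vs × conv vs
    conv-++ : ∀ {xs ys} → conv xs → conv ys → AllPairs (λ a b → All (L a b) ys) xs →
      All (λ z → AllPairs (L z) ys) xs → conv (xs ++ ys)
    conv-++ {[]} _ cy _ _ = cy
    conv-++ {x ∷ xs} (h , cx) cy (k ∷ ks) (l ∷ ls) =
      AllPairs.++⁺ h l k , conv-++ cx cy ks ls

    conv-step : ∀ {v vs} → conv (v ∷ vs) → conv (vs ++ v ∷ [])
    conv-step (h , c) = conv-++ c ([] , tt) (AllPairs.map (λ k → cyc k ∷ []) h) (All.tabulate λ _ → [] ∷ [])

    conv-rotate : ∀ xs {ys} → conv (xs ++ ys) → conv (ys ++ xs)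
    conv-rotate [] {ys} c = subst conv (sym (++-identityʳ ys)) c
    conv-rotate (x ∷ xs) {ys} c =
      subst conv (++-assoc ys (x ∷ []) xs)
        (conv-rotate xs {ys ++ x ∷ []} (subst conv (++-assoc xs ys (x ∷ [])) (conv-step {x} {xs ++ ys} c)))

    conv-filter : {P : A → Set} (P? : ∀ x → Dec (P x)) → ∀ {xs} → conv xs → conv (filter P? xs)
    conv-filter P? {[]} c = tt
    conv-filter P? {x ∷ xs} (h , c) with does (P? x)
    ... | true = AllPairs.filter⁺ P? h , conv-filter P? c
    ... | false = conv-filter P? c

    -- Emptiness of all triangles of vertices. It makes sense for a set of points in any order, and
    -- for convex lists it amounts to emptiness of the polygon because of the fan in `no-interior`.
    Free : List A → Set
    Free P = ∀ {a b c p} → a ∈ P → b ∈ P → c ∈ P → ¬ In a b c p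

    record Hole (P : List A) : Set where
      field
        unique : Unique P
        convex : conv P
        empty  : Free P

    on-side : ∀ {u w R a} → conv (u ∷ w ∷ R) → a ∈ u ∷ w ∷ R → (a ≡ u ⊎ a ≡ w) ⊎ L u w a
    on-side c (here p) = inj₁ (inj₁ p)
    on-side c (there (here p)) = inj₁ (inj₂ p)
    on-side ((h ∷ _) , _) (there (there m)) = inj₂ (All.lookup h m)

    conv-last : ∀ xs {a} → conv (xs ++ a ∷ []) → AllPairs (λ u v → L u v a) xs
    conv-last [] _ = []
    conv-last (x ∷ xs) (h , c) =
      All.tabulate (λ y∈ → proj₂ (proj₂ (allPairs-++⁻ xs h)) y∈ (here refl)) ∷ conv-last xs c

    OnOrLeft : A → A → A → Set
    OnOrLeft u w z = (z ≡ u ⊎ z ≡ w) ⊎ L u w z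

    -- Three different corners cannot all be among `u` and `w`; one is strictly left of the line,
    -- and `bary` applies to it.
    In-left : ∀ {u w a b c p} → OnOrLeft u w a → OnOrLeft u w b → OnOrLeft u w c → In a b c p → L u w p
    In-left {u} {w} {a} {b} {c} {p} pa pb pc i = go pa pb pc
      where
      weak : ∀ {z} → OnOrLeft u w z → ¬ L w u z
      weak (inj₁ (inj₁ refl)) h = ≢₂₃ h refl
      weak (inj₁ (inj₂ refl)) h = ≢₁₃ h refl
      weak (inj₂ k) h = asym k h
      two : a ≡ u ⊎ a ≡ w → b ≡ u ⊎ b ≡ w → c ≡ u ⊎ c ≡ w → ⊥
      two (inj₁ refl) (inj₁ refl) _ = ≢₁₂ (int i) refl
      two (inj₂ refl) (inj₂ refl) _ = ≢₁₂ (int i) refl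
      two (inj₁ refl) _ (inj₁ refl) = ≢₁₃ (int i) refl
      two (inj₂ refl) _ (inj₂ refl) = ≢₁₃ (int i) refl
      two _ (inj₁ refl) (inj₁ refl) = ≢₂₃ (int i) refl
      two _ (inj₂ refl) (inj₂ refl) = ≢₂₃ (int i) refl
      go : OnOrLeft u w a → OnOrLeft u w b → OnOrLeft u w c → L u w p
      go x y (inj₂ z) = bary i (weak x) (weak y) z
      go x (inj₂ y) z = bary (In-cyc (In-cyc i)) (weak z) (weak x) y
      go (inj₂ x) y z = bary (In-cyc i) (weak y) (weak z) x
      go (inj₁ x) (inj₁ y) (inj₁ z) = ⊥-elim (two x y z)

    side-left : ∀ {u w R a b c p} → conv (u ∷ w ∷ R) → a ∈ u ∷ w ∷ R → b ∈ u ∷ w ∷ R → c ∈ u ∷ w ∷ R →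
      In a b c p → L u w p
    side-left cv a∈ b∈ c∈ = In-left (on-side cv a∈) (on-side cv b∈) (on-side cv c∈)

    NoneIn : A → A → A → Set
    NoneIn v a b = ∀ {p} → ¬ In v a b p

    -- Walk along the fan at `v` while `p` stays left of the spoke. The first spoke with `p` on its
    -- other side closes a triangle around `p`, and the last side of the polygon prevents the walk
    -- from ending without one.
    fan : ∀ {v p} x xs → (∀ {a b} → (a , b) ∈ zip (x ∷ xs) (xs ++ v ∷ []) → L a b p) → L v x p →
      All (_≢ v) xs → Linked (NoneIn v) (x ∷ xs) → ⊥
    fan x [] e h _ _ = asym h (e (here refl))
    fan {v} {p} x (y ∷ xs) e h (y≢v ∷ ne) (k ∷ ks) with L? v y p
    ... | yes vyp = fan y xs (λ m → e (there m)) vyp ne ks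
    ... | no nvyp = k (h , e (here refl) ,
            flip y≢v (≢₁₃ h) (≢₂₃ (e (here refl))) nvyp)

    no-interior : ∀ {v w vs p} → Unique (v ∷ w ∷ vs) → Linked (NoneIn v) (w ∷ vs) →
      ¬ (∀ {a b} → (a , b) ∈ sides (v ∷ w ∷ vs) → L a b p)
    no-interior {v} {w} {vs} ((_ ∷ v∉) ∷ _) l e =
      fan w vs (λ m → e (there m)) (e (here refl)) (All.map ≢-sym v∉) l

    -- The triangles of one fan suffice: a point in any triangle of vertices is left of all sides,
    -- hence in some triangle of the fan.
    fan-hole : ∀ {v w vs} → Unique (v ∷ w ∷ vs) → conv (v ∷ w ∷ vs) → Linked (NoneIn v) (w ∷ vs) →
      Hole (v ∷ w ∷ vs)
    fan-hole u c l = record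
      { unique = u ; convex = c
      ; empty = λ a∈ b∈ c∈ i → no-interior u l λ m →
          case rotateTo m of λ { (R , as , bs , eq , eq′) →
            let sub : ∀ {z} → z ∈ _ → z ∈ _
                sub {z} z∈ = subst (z ∈_) (sym eq′) (∈-rotate as (subst (z ∈_) eq z∈))
            in side-left (subst conv (sym eq′) (conv-rotate as (subst conv eq c))) (sub a∈) (sub b∈) (sub c∈) i } }

    hole-rotate : ∀ as {bs} → Hole (as ++ bs) → Hole (bs ++ as)
    hole-rotate as {bs} h = record
      { unique = let p , q , r = allPairs-++⁻ as (Hole.unique h)
          in AllPairs.++⁺ q p (All.tabulate λ y∈ → All.tabulate λ x∈ → ≢-sym (r x∈ y∈))
      ; convex = conv-rotate as (Hole.convex h)
      ; empty = λ a∈ b∈ c∈ → Hole.empty h (∈-rotate bs a∈) (∈-rotate bs b∈) (∈-rotate bs c∈) }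

    hole-no-interior : ∀ {v w vs p} → Hole (v ∷ w ∷ vs) →
      ¬ (∀ {a b} → (a , b) ∈ sides (v ∷ w ∷ vs) → L a b p)
    hole-no-interior {v} {w} {vs} h = no-interior (Hole.unique h) (linked w vs there)
      where
      linked : ∀ x xs → (∀ {z} → z ∈ x ∷ xs → z ∈ v ∷ w ∷ vs) → Linked (NoneIn v) (x ∷ xs)
      linked x [] sub = [-]
      linked x (y ∷ xs) sub = Hole.empty h (here refl) (sub (here refl)) (sub (there (here refl)))
        ∷ linked y xs (sub ∘ there)

    module Finite (_≟_ : ∀ (a b : A) → Dec (a ≡ b)) (elements : List A) (complete : ∀ a → a ∈ elements) where

      search : ∀ {P : A → Set} → (∀ x → Dec (P x)) → Dec (∃[ x ] P x)
      search P? with Any.any? P? elements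
      ... | yes any = yes (let x , _ , px = find any in x , px)
      ... | no none = no λ { (x , px) → none (lose (complete x) px) }

      In? : ∀ a b c p → Dec (In a b c p)
      In? a b c p = L? a b p ×-dec L? b c p ×-dec L? c a p

      In-self : ∀ {a b c} → ¬ In a b c b
      In-self (h , _) = ≢₂₃ h refl

      NoneIn-cyc : ∀ {a b c} → NoneIn a b c → NoneIn b c a
      NoneIn-cyc n i = n (In-cyc (In-cyc i))

    -- Caps, groups and the growth of holes

    module Sparse (_≟_ : ∀ (a b : A) → Dec (a ≡ b))
      (elements : List A) (complete : ∀ a → a ∈ elements) (distinct : Unique elements)
      (ac : ∀ {a b c p q} → In a b c p → In a b c q → p ≡ q) where

      open Finite _≟_ elements complete
      open import Data.List.Membership.DecPropositional _≟_ using (_∈?_)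

      -- A single replacement suffices since a triangle contains at most one point.
      shrink : ∀ {a b c} → (P : A → Set) → P c → (∀ {p} → In a b c p → P p) →
        ∃[ d ] (P d × NoneIn a b d)
      shrink {a} {b} {c} P pc step with search (In? a b c)
      ... | no none = c , pc , λ {p} i → none (p , i)
      ... | yes (d , i) = d , step i , λ j → case ac i (In-sub i j) of λ { refl → ≢₂₃ (proj₁ (proj₂ j)) refl }

      -- A chain that makes a hole together with `t` in front: sorted about `t`, convex, and with
      -- empty triangles in the fan at `t`.
      record Cap (t : A) (X : List A) (m : ℕ) : Set where
        field
          points : List A
          size   : length points ≡ m
          sub    : ∀ {z} → z ∈ points → z ∈ X
          sorted : AllPairs (L t) points
          convex : conv points
          empty  : Linked (NoneIn t) points

      -- The turn at the last two points is all that has to be known about the new point `y`;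
      -- `chainˡ` and `chainʳ` carry it to all earlier pairs.
      snoc-turns : ∀ {t y} xs {a b} → let C = xs ++ a ∷ b ∷ [] in
        AllPairs (L t) C → All (λ c → L t c y) C → conv C → L a b y → AllPairs (λ u v → L u v y) C
      snoc-turns [] _ _ _ h = (h ∷ []) ∷ [] ∷ []
      snoc-turns {t} {y} (c ∷ xs) {a} {b} (tc ∷ tcs) (_ ∷ ys) (cs , cv) h =
        go xs tc tcs ys cs rest ∷ rest
        where
        rest = snoc-turns xs tcs ys cv h
        go : ∀ xs → let C = xs ++ a ∷ b ∷ [] in All (L t c) C → AllPairs (L t) C → All (λ u → L t u y) C →
          AllPairs (L c) C → AllPairs (λ u v → L u v y) C → All (λ u → L c u y) C
        go [] (tca ∷ tcb ∷ []) ((tab ∷ []) ∷ _) (tay ∷ tby ∷ []) ((cab ∷ []) ∷ _) ((aby ∷ []) ∷ _) =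
          chainˡ tca tab tay cab aby ∷ chainʳ tcb tab tby cab aby ∷ []
        go (x ∷ xs) (tcx ∷ tcs) (tx ∷ txs) (txy ∷ tys) (cx ∷ cxs) (xy ∷ xys) =
          chainˡ tcx (All.lookup tx b∈) txy (All.lookup cx b∈) (All.lookup xy b∈) ∷ go xs tcs txs tys cxs xys
          where b∈ = ∈-++⁺ʳ xs (there (here refl))

      cons-turns : ∀ {t y e f R} → All (L t y) (e ∷ f ∷ R) → AllPairs (L t) (e ∷ f ∷ R) →
        conv (e ∷ f ∷ R) → L y e f → conv (y ∷ e ∷ f ∷ R)
      cons-turns {t} {y} {e} {f} {R} (tye ∷ ty) (te ∷ ts) cv@((ef ∷ es) , _) h =
        (first ∷ go ty te ts first (ef ∷ es)) , cv
        where
        first : All (L y e) (f ∷ R)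
        first = h ∷ All.zipWith (λ { (tec , efc) → chainˡ tye (All.head te) tec h efc }) (All.tail te , ef)
        go : ∀ {Z} → All (L t y) Z → All (L t e) Z → AllPairs (L t) Z → All (L y e) Z → AllPairs (L e) Z → AllPairs (L y) Z
        go [] [] [] [] [] = []
        go (tyc ∷ tys) (tec ∷ tes) (tc ∷ tcs) (yec ∷ yecs) (ec ∷ ecs) =
          All.zipWith (λ { (tcd , ecd) → chainʳ tyc tec tcd yec ecd }) (tc , ec) ∷ go tys tes tcs yecs ecs

      -- Keeps the replacements made by `shrink` inside the set from which a cap is taken.
      Closed : A → List A → Set
      Closed t X = ∀ {x y p} → x ∈ X → y ∈ X → In t x y p → p ∈ X

      -- If neither cap extended into the other part, the last two points of the first cap and the
      -- first two of the second would turn outwards, with two of them in one triangle.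
      merge : ∀ {t X₁ X₂ m} → (∀ {x y} → x ∈ X₁ → y ∈ X₂ → L t x y) → Closed t (X₁ ++ X₂) →
        Cap t X₁ (suc (suc m)) → Cap t X₂ (suc (suc m)) → Cap t (X₁ ++ X₂) (suc (suc (suc m)))
      merge {t} {X₁} {X₂} {n} before cl c₁ c₂ =
        split (lastTwo C₁.points (subst (2 ≤_) (sym C₁.size) (s≤s (s≤s z≤n)))) C₂.points refl
        where
        X = X₁ ++ X₂
        module C₁ = Cap c₁
        module C₂ = Cap c₂
        sub₁ : ∀ {z} → z ∈ X₁ → z ∈ X
        sub₁ = ∈-++⁺ˡ
        sub₂ : ∀ {z} → z ∈ X₂ → z ∈ X
        sub₂ = ∈-++⁺ʳ X₁

        split : ∃[ as ] ∃[ a ] ∃[ b ] C₁.points ≡ as ++ a ∷ b ∷ [] → ∀ D → C₂.points ≡ D → Cap t X (suc (suc (suc n)))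
        split _ [] eq = ⊥-elim (ℕₚ.0≢1+n (trans (cong length (sym eq)) C₂.size))
        split _ (_ ∷ []) eq = ⊥-elim (ℕₚ.0≢1+n (ℕₚ.suc-injective (trans (cong length (sym eq)) C₂.size)))
        split (as , a , b , eq₁) (e ∷ f ∷ R) eq₂ =
          decide (search λ y → (y ∈? X₂) ×-dec L? a b y) (search λ y → (y ∈? X₁) ×-dec L? y e f)
          where
          D₁ = as ++ a ∷ b ∷ []
          D₂ = e ∷ f ∷ R
          sorted₁ : AllPairs (L t) D₁
          sorted₁ = subst (AllPairs (L t)) eq₁ C₁.sorted
          sorted₂ : AllPairs (L t) D₂
          sorted₂ = subst (AllPairs (L t)) eq₂ C₂.sorted
          in₁ : ∀ {z} → z ∈ D₁ → z ∈ X₁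
          in₁ {z} z∈ = C₁.sub (subst (z ∈_) (sym eq₁) z∈)
          in₂ : ∀ {z} → z ∈ D₂ → z ∈ X₂
          in₂ {z} z∈ = C₂.sub (subst (z ∈_) (sym eq₂) z∈)
          a∈ : a ∈ D₁
          a∈ = ∈-++⁺ʳ as (here refl)
          b∈ : b ∈ D₁
          b∈ = ∈-++⁺ʳ as (there (here refl))
          tab : L t a b
          tab = All.head (AllPairs.head (proj₁ (proj₂ (allPairs-++⁻ as sorted₁))))
          tef : L t e f
          tef = All.head (AllPairs.head sorted₂)
          D₁-before-b : ∀ {c} → c ∈ D₁ → c ≡ b ⊎ L t c b
          D₁-before-b {c} c∈ with allPairs-++⁻ (as ++ a ∷ []) (subst (AllPairs (L t)) (sym (++-assoc as (a ∷ []) (b ∷ []))) sorted₁)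
                                | ∈-++⁻ (as ++ a ∷ []) (subst (c ∈_) (sym (++-assoc as (a ∷ []) (b ∷ []))) c∈)
          ... | _ , _ , r | inj₁ c∈′ = inj₂ (r c∈′ (here refl))
          ... | _ | inj₂ (here refl) = inj₁ refl

          Right : A → Set
          Right p = p ∈ X × L a b p × (∀ {c} → c ∈ D₁ → L t c p)
          extendʳ : ∃[ y ] (Right y × NoneIn t b y) → Cap t X (suc (suc (suc n)))
          extendʳ (y , (y∈ , aby , ty) , none) = record
            { points = D₁ ++ y ∷ []
            ; size = trans (length-++ D₁) (trans (ℕₚ.+-comm _ 1) (cong suc (trans (cong length (sym eq₁)) C₁.size)))
            ; sub = λ z∈ → [ sub₁ ∘ in₁ , (λ { (here refl) → y∈ }) ]′ (∈-++⁻ D₁ z∈)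
            ; sorted = AllPairs.++⁺ sorted₁ ([] ∷ []) (All.map (_∷ []) (All.tabulate ty))
            ; convex = conv-++ conv₁ ([] , tt) (AllPairs.map (_∷ []) (snoc-turns as sorted₁ (All.tabulate ty) conv₁ aby))
                (All.tabulate λ _ → [] ∷ [])
            ; empty = subst (Linked (NoneIn t)) (trans (++-assoc as (a ∷ []) (b ∷ y ∷ [])) (sym (++-assoc as (a ∷ b ∷ []) (y ∷ []))))
                (linked-join (as ++ a ∷ []) (subst (Linked (NoneIn t)) (trans eq₁ (sym (++-assoc as (a ∷ []) (b ∷ [])))) C₁.empty) ((λ {p} → none {p}) ∷ [-])) }
            where
            conv₁ : conv D₁
            conv₁ = subst conv eq₁ C₁.convex

          Left : A → Set
          Left p = p ∈ X × L p e f × (∀ {c} → c ∈ D₂ → L t p c)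
          extendˡ : ∃[ y ] (Left y × NoneIn e t y) → Cap t X (suc (suc (suc n)))
          extendˡ (y , (y∈ , yef , ty) , none) = record
            { points = y ∷ D₂
            ; size = cong suc (trans (cong length (sym eq₂)) C₂.size)
            ; sub = λ { (here refl) → y∈ ; (there z∈) → sub₂ (in₂ z∈) }
            ; sorted = All.tabulate ty ∷ sorted₂
            ; convex = cons-turns (All.tabulate ty) sorted₂ (subst conv eq₂ C₂.convex) yef
            ; empty = NoneIn-cyc none ∷ subst (Linked (NoneIn t)) eq₂ C₂.empty }

          decide : Dec (∃[ y ] (y ∈ X₂ × L a b y)) → Dec (∃[ y ] (y ∈ X₁ × L y e f)) → Cap t X (suc (suc (suc n)))
          decide (yes (y , y∈ , aby)) _ = extendʳ (shrink Right (sub₂ y∈ , aby , λ c∈ → before (in₁ c∈) y∈) step)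
            where
            step : ∀ {p} → In t b y p → Right p
            step {p} i@(tbp , _ , ytp) = cl (sub₁ (in₁ b∈)) (sub₂ y∈) i ,
              bary i (asym (cyc tab)) (λ h → ≢₁₃ h refl) aby ,
              λ c∈ → case D₁-before-b c∈ of λ
                { (inj₁ refl) → tbp
                ; (inj₂ tcb) → tr′ (cyc² (before (in₁ c∈) y∈)) (cyc² (before (in₁ b∈) y∈)) ytp tcb tbp }
          decide (no _) (yes (y , y∈ , yef)) = extendˡ (shrink Left (sub₁ y∈ , yef , λ c∈ → before y∈ (in₂ c∈)) step)
            where
            step : ∀ {p} → In e t y p → Left p
            step {p} i@(etp , typ , _) = cl (sub₁ y∈) (sub₂ (in₂ (here refl))) (In-cyc i) ,
              cyc² (bary (In-cyc (In-cyc i)) (asym (cyc yef)) (λ h → ≢₂₃ h refl) (cyc tef)) ,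
              λ { (here refl) → cyc etp
                ; (there c∈) → tr typ (before y∈ (in₂ (here refl))) (before y∈ (in₂ (there c∈))) (cyc etp)
                                 (All.lookup (AllPairs.head sorted₂) c∈) }
          -- The full triangle here is `t a f`: it contains both `b` and `e`.
          decide (no none₂) (no none₁) = ⊥-elim (≢₂₃ tbe (ac {t} {a} {f} (tab , afb , cyc² tbf) (tae , afe , cyc² tef)))
            where
            tbe = before (in₁ b∈) (in₂ (here refl))
            tbf = before (in₁ b∈) (in₂ (there (here refl)))
            tae = before (in₁ a∈) (in₂ (here refl))
            taf = before (in₁ a∈) (in₂ (there (here refl)))
            afb : L a f b
            afb = cyc (flip (≢-sym (≢₂₃ tab)) (≢₂₃ taf) (≢₂₃ tbf) λ h → none₂ (f , in₂ (there (here refl)) , h))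
            afe : L a f e
            afe = cyc (flip (≢-sym (≢₂₃ tae)) (≢₂₃ taf) (≢₂₃ tef) λ h → none₁ (a , in₁ a∈ , h))

      -- Halving in the order about `t`: both halves are again closed, and `merge` gains one point
      -- for each doubling. Since `merge` looks at the last two and the first two points, two points
      -- form a base case of their own; the first two in the order span an empty triangle with `t`,
      -- as closedness leaves nothing to lie between them.
      cap : ∀ {t} n X → AllPairs (L t) X → Closed t X → 2 ^ n ≤ length X → Cap t X (suc n)
      cap zero (x ∷ X) _ _ _ = record
        { points = x ∷ [] ; size = refl ; sub = λ { (here refl) → here refl } ; sorted = [] ∷ []
        ; convex = [] , tt ; empty = [-] }
      cap zero [] _ _ ()
      cap (suc zero) (x ∷ y ∷ X) ((txy ∷ txs) ∷ (tys ∷ _)) cl _ = record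
        { points = x ∷ y ∷ [] ; size = refl
        ; sub = λ { (here refl) → here refl ; (there (here refl)) → there (here refl) }
        ; sorted = (txy ∷ []) ∷ [] ∷ [] ; convex = ([] ∷ []) , [] , tt
        ; empty = (λ i → none tys i (cl (here refl) (there (here refl)) i)) ∷ [-] }
        where
        none : ∀ {t p} → All (L t y) X → In t x y p → ¬ p ∈ x ∷ y ∷ X
        none tys i (here refl) = In-self i
        none tys (_ , h , _) (there (here refl)) = ≢₂₃ h refl
        none tys (_ , _ , h) (there (there p∈)) = asym (All.lookup tys p∈) h
      cap (suc zero) (x ∷ []) _ _ (s≤s ())
      cap (suc zero) [] _ _ ()
      cap {t} (suc (suc n)) X so cl le =
        subst (λ Y → Cap t Y (suc (suc (suc n)))) X≡ (merge before (subst (Closed t) (sym X≡) cl)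
          (cap (suc n) X₁ (proj₁ parts) cl₁ len₁) (cap (suc n) X₂ (proj₁ (proj₂ parts)) cl₂ len₂))
        where
        k = 2 ^ suc n
        X₁ = take k X
        X₂ = drop k X
        X≡ : X₁ ++ X₂ ≡ X
        X≡ = take++drop≡id k X
        parts = allPairs-++⁻ X₁ (subst (AllPairs (L t)) (sym X≡) so)
        before : ∀ {x y} → x ∈ X₁ → y ∈ X₂ → L t x y
        before = proj₂ (proj₂ parts)
        sub₁ : ∀ {z} → z ∈ X₁ → z ∈ X
        sub₁ {z} z∈ = subst (z ∈_) X≡ (∈-++⁺ˡ z∈)
        sub₂ : ∀ {z} → z ∈ X₂ → z ∈ X
        sub₂ {z} z∈ = subst (z ∈_) X≡ (∈-++⁺ʳ X₁ z∈)
        cl₁ : Closed t X₁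
        cl₁ {p = p} x∈ y∈ i@(_ , _ , h) with ∈-++⁻ X₁ (subst (p ∈_) (sym X≡) (cl (sub₁ x∈) (sub₁ y∈) i))
        ... | inj₁ p∈ = p∈
        ... | inj₂ p∈ = ⊥-elim (asym (before y∈ p∈) h)
        cl₂ : Closed t X₂
        cl₂ {p = p} x∈ y∈ i@(h , _ , _) with ∈-++⁻ X₁ (subst (p ∈_) (sym X≡) (cl (sub₂ x∈) (sub₂ y∈) i))
        ... | inj₁ p∈ = ⊥-elim (asym (cyc (before p∈ x∈)) (cyc h))
        ... | inj₂ p∈ = p∈
        k≤ : k ≤ length X
        k≤ = ℕₚ.≤-trans (ℕₚ.m≤m+n k _) le
        len₁ : k ≤ length X₁
        len₁ = ℕₚ.≤-reflexive (sym (trans (length-take k X) (ℕₚ.m≤n⇒m⊓n≡m k≤)))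
        len₂ : k ≤ length X₂
        len₂ = subst (k ≤_) (sym (length-drop k X))
          (ℕₚ.m+n≤o⇒m≤o∸n k (subst (λ m → k + m ≤ length X) (ℕₚ.+-identityʳ k) le))

      insertAround : ∀ {t s} x ys → All (L t s) (x ∷ ys) → x ∉ ys → AllPairs (L t) ys → ∃[ zs ]
        (length zs ≡ suc (length ys) × (∀ {z} → z ∈ zs → z ∈ x ∷ ys) × (∀ {z} → z ∈ x ∷ ys → z ∈ zs) × AllPairs (L t) zs)
      insertAround x [] _ _ _ = x ∷ [] , refl , (λ m → m) , (λ m → m) , [] ∷ []
      insertAround {t} x (y ∷ ys) (sx ∷ sy ∷ ss) x∉ (ty ∷ tys) with L? t x y
      ... | yes txy = x ∷ y ∷ ys , refl , (λ m → m) , (λ m → m) ,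
        (txy ∷ All.zipWith (λ { (k , sz) → tr sx sy sz txy k }) (ty , ss)) ∷ ty ∷ tys
      ... | no ntxy with insertAround x ys (sx ∷ ss) (x∉ ∘ there) tys
      ...   | zs , len , to , from , srt = y ∷ zs , cong suc len ,
        (λ { (here p) → there (here p) ; (there m) → case to m of λ { (here p) → here p ; (there k) → there (there k) } }) ,
        (λ { (here p) → there (from (here p)) ; (there (here p)) → here p ; (there (there m)) → there (from (there m)) }) ,
        All.tabulate (λ m → case to m of λ { (here refl) → tyx ; (there k) → All.lookup ty k }) ∷ srt
        where
        tyx : L t y x
        tyx = flip (≢₁₃ sy) (λ { refl → x∉ (here refl) }) (≢₁₃ sx) λ h → ntxy (cyc h)

      sortAround : ∀ {t s} xs → Unique xs → All (L t s) xs →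
        ∃[ ys ] (length ys ≡ length xs × (∀ {z} → z ∈ ys → z ∈ xs) × (∀ {z} → z ∈ xs → z ∈ ys) × AllPairs (L t) ys)
      sortAround [] _ _ = [] , refl , (λ ()) , (λ ()) , []
      sortAround (x ∷ xs) (x∉ ∷ u) (sx ∷ ss) with sortAround xs u ss
      ... | ys , len , to , from , srt
        with insertAround x ys (sx ∷ All.tabulate (All.lookup ss ∘ to)) (λ m → All.All¬⇒¬Any x∉ (to m)) srt
      ...   | zs , len′ , to′ , from′ , srt′ = zs , trans len′ (cong suc len) ,
        (λ m → case to′ m of λ { (here p) → here p ; (there k) → there (to k) }) ,
        (λ { (here p) → from′ (here p) ; (there m) → from′ (there (from m)) }) , srt′

      linked-all : ∀ {R : A → A → Set} xs → (∀ {x y} → x ∈ xs → y ∈ xs → R x y) → Linked R xs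
      linked-all [] h = []
      linked-all (x ∷ []) h = [-]
      linked-all (x ∷ y ∷ xs) h = h (here refl) (there (here refl)) ∷ linked-all (y ∷ xs) λ m n → h (there m) (there n)

      linked-++ : ∀ {R : A → A → Set} {xs ys} → Linked R xs → (∀ {x y} → x ∈ xs → y ∈ ys → R x y) → Linked R ys → Linked R (xs ++ ys)
      linked-++ [] h l = l
      linked-++ {ys = []} [-] h l = [-]
      linked-++ {ys = y ∷ ys} [-] h l = h (here refl) (here refl) ∷ l
      linked-++ (r ∷ k) h l = r ∷ linked-++ k (λ m → h (there m)) l

      -- A mixed triple that failed to turn left would have its middle point inside the triangle of
      -- `t` and the two outer points, which is assumed to be empty.
      glue : ∀ {t x xs y ys} → let X = x ∷ xs ; Y = y ∷ ys in
        conv X → conv Y → AllPairs (L t) X → AllPairs (L t) Y → Linked (NoneIn t) X → Linked (NoneIn t) Y →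
        (∀ {a b} → a ∈ X → b ∈ Y → L t a b) → (∀ {a b} → a ∈ X → b ∈ Y → NoneIn t a b) →
        Hole (t ∷ X ++ Y)
      glue {t} {x} {xs} {y} {ys} cX cY sX sY eX eY lt none =
        fan-hole (All.tabulate t≢ ∷ AllPairs.map ≢₂₃ sXY) (sXY , conv-++ cX cY
            (turnsˡ (λ a∈ → a∈) sX) (All.tabulate λ a∈ → turnsʳ a∈ (λ b∈ → b∈) sY))
          (linked-++ eX (λ a∈ b∈ {p} → none a∈ b∈ {p}) eY)
        where
        X = x ∷ xs
        Y = y ∷ ys
        sXY : AllPairs (L t) (X ++ Y)
        sXY = AllPairs.++⁺ sX sY (All.tabulate λ a∈ → All.tabulate (lt a∈))
        t≢ : ∀ {z} → z ∈ X ++ Y → t ≢ z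
        t≢ z∈ = [ (λ m → ≢₁₂ (lt m (here refl))) , (λ m → ≢₁₃ (lt (here refl) m)) ]′ (∈-++⁻ X z∈)
        turnsˡ : ∀ {Z} → (∀ {z} → z ∈ Z → z ∈ X) → AllPairs (L t) Z → AllPairs (λ a b → All (L a b) Y) Z
        turnsˡ sub [] = []
        turnsˡ {a ∷ Z} sub (h ∷ hs) = All.tabulate (λ b∈ → All.tabulate λ c∈ →
            flip (≢₂₃ (All.lookup h b∈)) (≢₂₃ (lt (sub (there b∈)) c∈)) (≢₂₃ (lt (sub (here refl)) c∈))
              λ bac → none (sub (here refl)) c∈ (All.lookup h b∈ , cyc bac , cyc² (lt (sub (there b∈)) c∈)))
          ∷ turnsˡ (sub ∘ there) hs
        turnsʳ : ∀ {a Z} → a ∈ X → (∀ {z} → z ∈ Z → z ∈ Y) → AllPairs (L t) Z → AllPairs (L a) Z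
        turnsʳ a∈ sub [] = []
        turnsʳ {a} {b ∷ Z} a∈ sub (h ∷ hs) = All.tabulate (λ c∈ →
            flip (≢₂₃ (lt a∈ (sub (here refl)))) (≢₂₃ (All.lookup h c∈)) (≢₂₃ (lt a∈ (sub (there c∈))))
              λ bac → none a∈ (sub (there c∈)) (lt a∈ (sub (here refl)) , cyc bac , cyc² (All.lookup h c∈)))
          ∷ turnsʳ a∈ (sub ∘ there) hs

      -- That `t` is in front of one pair of vertices passes to every pair from the two sides of the
      -- line `d t`. First `y₀` and then `x₀` is replaced; a reversed turn at `t` would put `t` into
      -- a triangle of vertices or violate the angular order about `t`.
      near : ∀ {P t x₀ y₀ d x y} → Free P → t ∈ P → x₀ ∈ P → y₀ ∈ P → In d x₀ y₀ t →
        x ∈ P → y ∈ P → L t d x → L t y d → In d x y t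
      near {P} {t} {x₀} {y₀} {d} {x} {y} free t∈ x₀∈ y₀∈ (dxt , xyt , ydt) x∈ y∈ tdx tyd =
        cyc tdx , cyc txy , cyc² (cyc² tyd)
        where
        tdx₀ : L t d x₀
        tdx₀ = cyc² dxt
        tx₀y₀ : L t x₀ y₀
        tx₀y₀ = cyc² xyt
        ty₀d : L t y₀ d
        ty₀d = cyc² ydt
        tx₀y : L t x₀ y
        tx₀y = flip (≢₁₃ tdx₀) (λ { refl → asym₂₃ tdx₀ tyd }) (≢₁₂ tyd) λ h → wrong (cyc h)
          where
          wrong : ¬ L t y x₀
          wrong tyx₀ = [ (λ k → free x₀∈ y₀∈ y∈ (cyc tx₀y₀ , cyc k , cyc tyx₀))
                       , (λ k → asym₂₃ tdx₀ (tr tyx₀ (cyc k) tyd tx₀y₀ ty₀d)) ]′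
            (tot (≢₁₂ ty₀d) (λ { refl → asym₂₃ tx₀y₀ tyx₀ }) (≢₁₂ tyd))
        txy : L t x y
        txy = flip (≢₁₃ tdx) (λ { refl → asym₂₃ tdx tyd }) (≢₁₂ tyd) λ h → wrong (cyc h)
          where
          wrong : ¬ L t y x
          wrong tyx = [ (λ k → free x∈ x₀∈ y∈ (cyc k , cyc tx₀y , cyc tyx))
                      , (λ k → asym₂₃ tyd (tr′ (cyc² tdx) k (cyc² tyx) tdx₀ tx₀y)) ]′
            (tot (≢₁₃ tyx) (λ { refl → asym₂₃ tx₀y tyx }) (≢₁₃ tdx₀))

      -- A cone at `t`, which contains all points behind `t` that split the other vertices into `Z`
      -- and `X`. Being a cone, it is closed in the sense that `cap` requires.
      Wedge : A → List A → List A → List A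
      Wedge t Z X = filter (λ d → All.all? (λ z → L? t z d) Z ×-dec All.all? (λ x → L? t d x) X) elements

      module Group {t z x : A} {zs xs : List A}
        (cZ : conv (z ∷ zs)) (cX : conv (x ∷ xs)) (sZ : AllPairs (L t) (z ∷ zs)) (sX : AllPairs (L t) (x ∷ xs))
        (eZ : Linked (NoneIn t) (z ∷ zs)) (eX : Linked (NoneIn t) (x ∷ xs))
        (across : ∀ {a b} → a ∈ x ∷ xs → b ∈ z ∷ zs → L t a b) where

        Z X : List A
        Z = z ∷ zs
        X = x ∷ xs

        W : List A
        W = Wedge t Z X

        ∈W⁻ : ∀ {d} → d ∈ W → All (λ z → L t z d) Z × All (λ x → L t d x) X
        ∈W⁻ d∈ = proj₂ (∈-filter⁻ _ {xs = elements} d∈)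

        left : ∀ {d a} → d ∈ W → a ∈ Z → L t a d
        left d∈ a∈ = All.lookup (proj₁ (∈W⁻ d∈)) a∈

        right : ∀ {d a} → d ∈ W → a ∈ X → L t d a
        right d∈ a∈ = All.lookup (proj₂ (∈W⁻ d∈)) a∈

        apex : ∀ {d a b} → d ∈ W → a ∈ X → b ∈ Z → In d a b t
        apex d∈ a∈ b∈ = cyc (right d∈ a∈) , cyc (across a∈ b∈) , cyc (left d∈ b∈)

        -- The triangle `d x b` already contains `t`, so sparsity leaves no point for its part
        -- `t b d`.
        none-left : ∀ {d b} → d ∈ W → b ∈ Z → NoneIn t b d
        none-left d∈ b∈ i = case ac ap (In-sub ap (In-cyc i)) of λ { refl → ≢₁₃ (proj₁ i) refl }
          where ap = In-cyc (In-cyc (apex d∈ (here refl) b∈))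

        none-right : ∀ {d a} → d ∈ W → a ∈ X → NoneIn t d a
        none-right d∈ a∈ i = case ac ap (In-sub ap (In-cyc i)) of λ { refl → ≢₁₃ (proj₁ i) refl }
          where ap = apex d∈ a∈ (here refl)

        W-closed : Closed t W
        W-closed {a} {b} {p} a∈ b∈ i@(tap , _ , btp) = ∈-filter⁺ _ (complete p)
          ( All.tabulate (λ c∈ → tr′ (cyc² (left b∈ c∈)) (cyc² (int i)) btp (left a∈ c∈) tap)
          , All.tabulate (λ c∈ → tr tap (int i) (right a∈ c∈) (cyc btp) (right b∈ c∈)) )

        W-cap : ∀ m → 2 ^ m ≤ length W → Cap t W (suc m)
        W-cap m le with sortAround {t} {z} W (Unique.filter⁺ _ distinct)
                          (All.tabulate λ d∈ → left d∈ (here refl))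
        ... | Y , len , to , from , srt = record
          { points = C.points ; size = C.size ; sub = to ∘ C.sub ; sorted = C.sorted ; convex = C.convex ; empty = C.empty }
          where
          c = cap m Y srt (λ a∈ b∈ i → from (W-closed (to a∈) (to b∈) i)) (subst (2 ^ m ≤_) (sym len) le)
          module C = Cap c

        -- Trades the vertices of `X` for a cap of the wedge. If `X` has `m` vertices, this gains
        -- one over the old hole; `right-hole` trades `Z` instead.
        left-hole : ∀ m → 2 ^ m ≤ length W → ∃[ P ] (Hole P × length P ≡ suc (length Z + suc m))
        left-hole m le with W-cap m le
        ... | record { points = [] ; size = () }
        ... | record { points = y ∷ ys ; size = size ; sub = sub ; sorted = sY ; convex = cY ; empty = eY } =
          t ∷ Z ++ y ∷ ys ,
          glue cZ cY sZ sY eZ eY (λ a∈ b∈ → left (sub b∈) a∈) (λ a∈ b∈ {p} → none-left (sub b∈) a∈ {p}) ,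
          cong suc (trans (length-++ Z) (cong (length Z +_) size))

        right-hole : ∀ m → 2 ^ m ≤ length W → ∃[ P ] (Hole P × length P ≡ suc (suc m + length X))
        right-hole m le with W-cap m le
        ... | record { points = [] ; size = () }
        ... | record { points = y ∷ ys ; size = size ; sub = sub ; sorted = sY ; convex = cY ; empty = eY } =
          t ∷ (y ∷ ys) ++ X ,
          glue cY cX sY sX eY eX (λ a∈ b∈ → right (sub a∈) b∈) (λ a∈ b∈ {p} → none-right (sub a∈) b∈ {p}) ,
          cong suc (trans (length-++ (y ∷ ys)) (cong (_+ length X) size))

      -- d lies beyond exactly one side of the hole
      module Beyond {P d} (hole : Hole P) (3≤ : 3 ≤ length P) (d∉ : d ∉ P)
        (far : ∀ {t x y} → t ∈ P → x ∈ P → y ∈ P → ¬ In d x y t) where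

        violated : ∀ {v w vs} → Hole (v ∷ w ∷ vs) → ∃[ e ] (e ∈ sides (v ∷ w ∷ vs) × ¬ L (proj₁ e) (proj₂ e) d)
        violated {v} {w} {vs} h with Any.any? (λ e → ¬? (L? (proj₁ e) (proj₂ e) d)) (sides (v ∷ w ∷ vs))
        ... | yes any = find any
        ... | no none = ⊥-elim (hole-no-interior h λ {a} {b} e∈ →
                decidable-stable (L? a b d) λ n → none (lose e∈ n))

        module Across {a b c R} (h : Hole (b ∷ c ∷ R ++ a ∷ [])) (bad : ¬ L a b d)
          (sub : ∀ {z} → z ∈ b ∷ c ∷ R ++ a ∷ [] → z ∈ P) where

          M = c ∷ R
          T = M ++ a ∷ []
          bT : AllPairs (L b) T
          bT = proj₁ (Hole.convex h)
          a∈ : a ∈ T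
          a∈ = ∈-++⁺ʳ M (here refl)
          ∈≢ : ∀ {z} → z ∈ b ∷ T → z ≢ d
          ∈≢ z∈ refl = d∉ (sub z∈)
          bxa : ∀ {x} → x ∈ M → L b x a
          bxa x∈ = proj₂ (proj₂ (allPairs-++⁻ M bT)) x∈ (here refl)
          bad′ : L b a d
          bad′ = flip (≢₁₃ (bxa (here refl))) (∈≢ (there a∈)) (∈≢ (here refl)) bad
          bxd : ∀ {x} → x ∈ M → L b x d
          bxd x∈ = flip (≢₁₂ (bxa x∈)) (∈≢ (there (∈-++⁺ˡ x∈))) (∈≢ (here refl)) λ xbd →
            far (sub (here refl)) (sub (there (∈-++⁺ˡ x∈))) (sub (there a∈)) (cyc² xbd , cyc (bxa x∈) , cyc bad′)

          Turns : A → Set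
          Turns p = AllPairs (λ u v → L u v p) (b ∷ T)

          uad : ∀ {u} → u ∈ M → L u a d
          uad u∈ = flip (≢₂₃ (bxa u∈)) (∈≢ (there a∈)) (∈≢ (there (∈-++⁺ˡ u∈))) λ aud →
            far (sub (there a∈)) (sub (here refl)) (sub (there (∈-++⁺ˡ u∈))) (cyc² bad′ , bxa u∈ , cyc aud)

          rows : ∀ {Z} → (∀ {z} → z ∈ Z → z ∈ M) → AllPairs (L b) Z → AllPairs (λ u v → L u v d) Z
          rows inM [] = []
          rows inM (h ∷ hs) = All.tabulate (λ v∈ → let u∈ = inM (here refl) ; v∈M = inM (there v∈) in
              flip (≢₂₃ (All.lookup h v∈)) (∈≢ (there (∈-++⁺ˡ v∈M))) (∈≢ (there (∈-++⁺ˡ u∈))) λ vud →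
                far (sub (there (∈-++⁺ˡ v∈M))) (sub (here refl)) (sub (there (∈-++⁺ˡ u∈)))
                  (cyc² (bxd v∈M) , All.lookup h v∈ , cyc vud))
            ∷ rows (inM ∘ there) hs

          -- If `d` were on the wrong side of some chord of the hole, one end of a chord would lie
          -- in a triangle spanned by `d` and two other vertices, contrary to `far`.
          turns-d : Turns d
          turns-d = All.++⁺ (All.tabulate bxd) (bad′ ∷ []) ∷
            AllPairs.++⁺ (rows (λ z∈ → z∈) (proj₁ (allPairs-++⁻ M bT))) ([] ∷ []) (All.tabulate λ u∈ → uad u∈ ∷ [])

          turns-in : ∀ {p} → In b a d p → Turns p
          turns-in i = AllPairs.zipWith (λ { (nb , na , h) → bary i nb na h })
            (not-b , AllPairs.zip (not-a , turns-d))
            where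
            not-b : AllPairs (λ u v → ¬ L v u b) (b ∷ T)
            not-b = All.tabulate (λ _ h → ≢₂₃ h refl) ∷ AllPairs.map (λ buv → asym (cyc buv)) bT
            not-a : AllPairs (λ u v → ¬ L v u a) (b ∷ T)
            not-a = AllPairs.++⁺ (AllPairs.map asym (conv-last (b ∷ M) (Hole.convex h))) ([] ∷ [])
              (All.tabulate λ _ → (λ k → ≢₁₃ k refl) ∷ [])

          -- The triangle `b a d` may contain a point. Then that point is taken in place of `d`: it
          -- keeps all turns by `turns-in`, and its own triangle over the side is empty.
          extended : ∃[ H ] (Hole H × length H ≡ suc (length (b ∷ T)))
          extended with shrink Turns turns-d turns-in
          ... | p , turns , none = b ∷ T ++ p ∷ [] ,
            fan-hole
              (AllPairs.++⁺ (Hole.unique h) ([] ∷ []) (All.map (_∷ []) (All.tabulate ≢p)))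
              (conv-++ (Hole.convex h) ([] , tt) (AllPairs.map (_∷ []) turns) (All.tabulate λ _ → [] ∷ []))
              (subst (Linked (NoneIn b)) (sym (++-assoc M (a ∷ []) (p ∷ [])))
                (linked-join M (linked-all T λ x∈ y∈ {_} → Hole.empty h (here refl) (there x∈) (there y∈)) ((λ {q} → none {q}) ∷ [-]))) ,
            cong suc (trans (length-++ T) (ℕₚ.+-comm (length T) 1))
            where
            ≢p : ∀ {z} → z ∈ b ∷ T → z ≢ p
            ≢p (here refl) = ≢₁₃ (All.lookup (AllPairs.head turns) a∈)
            ≢p (there z∈) = ≢₂₃ (All.lookup (AllPairs.head turns) z∈)

        grown : ∃[ H ] (Hole H × length H ≡ suc (length P))
        grown = go hole 3≤ (λ z∈ → z∈)
          where
          len-rotate : ∀ (xs {ys} : List A) → length (ys ++ xs) ≡ length (xs ++ ys)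
          len-rotate xs {ys} = trans (length-++ ys) (trans (ℕₚ.+-comm (length ys) (length xs)) (sym (length-++ xs)))
          go : ∀ {Q} → Hole Q → 3 ≤ length Q → (∀ {z} → z ∈ Q → z ∈ P) → ∃[ H ] (Hole H × length H ≡ suc (length Q))
          go {v ∷ w ∷ u ∷ us} h 3≤ inP with violated h
          ... | (a , b) , e∈ , bad with rotateTo e∈
          ...   | [] , as , bs , eq , eq′ = ⊥-elim (ℕₚ.<⇒≢ (s≤s (s≤s (s≤s z≤n)))
                  (trans (cong length eq′) (trans (len-rotate as) (cong length (sym eq)))))
          ...   | c ∷ R , as , bs , eq , eq′ = proj₁ result , proj₁ (proj₂ result) ,
                  trans (proj₂ (proj₂ result)) (cong suc (trans (len-rotate (a ∷ []) {b ∷ c ∷ R})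
                    (trans (cong length eq′) (trans (len-rotate as) (cong length (sym eq))))))
            where
            turned : Hole (b ∷ c ∷ R ++ a ∷ [])
            turned = hole-rotate (a ∷ []) (subst Hole (sym eq′) (hole-rotate as (subst Hole eq h)))
            back : ∀ {z} → z ∈ b ∷ c ∷ R ++ a ∷ [] → z ∈ P
            back {z} z∈ = inP (subst (z ∈_) (sym eq) (∈-rotate bs (subst (z ∈_) eq′ (∈-rotate (b ∷ c ∷ R) z∈))))
            result : ∃[ H ] (Hole H × length H ≡ suc (length (b ∷ c ∷ R ++ a ∷ [])))
            result = Across.extended {a} {b} {c} {R} turned bad back
          go {_ ∷ []} _ (s≤s ()) _
          go {_ ∷ _ ∷ []} _ (s≤s (s≤s ())) _
          go {[]} _ () _

      -- Both tips lie in the triangle `d d′ v`, which has room for only one point.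
      crossing-pair : ∀ {d d′ t t′ v} → In d t′ v t → In d′ v t t′ → t ≡ t′
      crossing-pair {d} {d′} {t} {t′} {v} i@(dt′t , _ , vdt) j@(d′vt′ , vtt′ , td′t′) = ac {d} {d′} {v}
        (cyc (cochainˡ vdt vtt′ vtd′ vdd′ (cyc² dt′t) (cyc² td′t′)) , int j , vdt)
        (cyc (cochainʳ vdt′ vtt′ (cyc d′vt′) vdd′ (cyc² dt′t) (cyc² td′t′)) , d′vt′ , vdt′)
        where
        vtd′ = cyc (int j)
        vdt′ : L v d t′
        vdt′ = cyc² (int i)
        vdd′ : L v d d′
        vdd′ = flip (≢₁₂ vdt) (λ { refl → asym₂₃ vdt vtd′ }) (≢₁₃ vtd′) λ dvd′ →
          let t′d′v = cyc² d′vt′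
              inside = int i , t′d′v , cyc² dvd′
          in asym (cyc td′t′) (bary i (asym (cyc (int inside))) (λ h → ≢₂₃ h refl) t′d′v)

      -- Points outside a hole and the chords they define

      module Outside {P} (hole : Hole P) where

        free : Free P
        free = Hole.empty hole

        record Outer : Set where
          field
            pt       : A
            pt∉      : pt ∉ P
            tip x₀ y₀ : A
            tip∈     : tip ∈ P
            x₀∈      : x₀ ∈ P
            y₀∈      : y₀ ∈ P
            apex     : In pt x₀ y₀ tip
        open Outer

        side : Outer → Bool → A → Bool
        side o true z = does (L? (tip o) z (pt o))
        side o false z = does (L? (tip o) (pt o) z)

        chord : Outer → Chord A
        chord o = record { tip = tip o ; side = side o }

        Left Right : Outer → A → Set
        Left o z = L (tip o) z (pt o)
        Right o z = L (tip o) (pt o) z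

        left : ∀ o {z} → side o true z ≡ true → Left o z
        left o = does-true (L? _ _ _)

        right : ∀ o {z} → side o false z ≡ true → Right o z
        right o = does-true (L? _ _ _)

        left⁺ : ∀ o {z} → Left o z → side o true z ≡ true
        left⁺ o = dec-true (L? _ _ _)

        right⁺ : ∀ o {z} → Right o z → side o false z ≡ true
        right⁺ o = dec-true (L? _ _ _)

        tip≢pt : ∀ o → tip o ≢ pt o
        tip≢pt o eq = pt∉ o (subst (_∈ P) eq (tip∈ o))

        apexOf : ∀ o {x y} → x ∈ P → y ∈ P → Right o x → Left o y → In (pt o) x y (tip o)
        apexOf o = near free (tip∈ o) (x₀∈ o) (y₀∈ o) (apex o)

        leftOr : ∀ o {z} → z ∈ P → z ≢ tip o → Left o z ⊎ Right o z
        leftOr o z∈ ne = [ inj₁ , (λ h → inj₂ (cyc h)) ]′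
          (tot (≢-sym ne) (λ { refl → pt∉ o z∈ }) (tip≢pt o))

        isChord : ∀ o → IsChord P 1 (chord o)
        isChord o = record
          { tip∈ = tip∈ o
          ; tip-off = λ { true → dec-false (L? _ _ _) (λ h → ≢₁₂ h refl) ; false → dec-false (L? _ _ _) (λ h → ≢₁₃ h refl) }
          ; disjoint = disjoint
          ; cover = λ
            { true v∈ ne off → right⁺ o ([ ⊥-elim ∘ does-false (L? _ _ _) off , (λ h → h) ]′ (leftOr o v∈ ne))
            ; false v∈ ne off → left⁺ o ([ (λ h → h) , ⊥-elim ∘ does-false (L? _ _ _) off ]′ (leftOr o v∈ ne)) }
          ; total = total
          ; large = λ { true → count-member (y₀∈ o) (left⁺ o (cyc² (proj₂ (proj₂ (apex o)))))
                      ; false → count-member (x₀∈ o) (right⁺ o (cyc² (proj₁ (apex o)))) } }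
          where
          disjoint : ∀ σ {v} → side o σ v ≡ true → side o (not σ) v ≡ false
          disjoint true h = dec-false (L? _ _ _) (asym₂₃ (left o h))
          disjoint false h = dec-false (L? _ _ _) (asym₂₃ (right o h))
          total : suc (count (side o true) P + count (side o false) P) ≤ length P
          total = count-sides (tip∈ o) (dec-false (L? _ _ _) (λ h → ≢₁₂ h refl))
            (dec-false (L? _ _ _) (λ h → ≢₁₃ h refl)) (disjoint true)

        crossing′ : ∀ {o o′} σ τ → (∀ {v} → v ∈ P → side o σ v ≡ true → side o′ τ v ≡ true) →
          side o′ τ (tip o) ≡ true → side o (not σ) (tip o′) ≡ true → Nested P (chord o) (chord o′)
        crossing′ {o} {o′} σ τ f r s = crossing σ τ f back r s
          where
          back : ∀ {v} → v ∈ P → side o′ (not τ) v ≡ true → side o (not σ) v ≡ true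
          back {v} v∈ h with side o σ v in eq
          ... | true = ⊥-elim (t≢f h (IsChord.disjoint (isChord o′) τ (f v∈ eq)))
          ... | false = IsChord.cover (isChord o) σ v∈ (λ { refl → t≢f h (IsChord.disjoint (isChord o′) τ r) }) eq

        nested-right-left : ∀ o o′ → tip o ≢ tip o′ → Right o (tip o′) → Left o′ (tip o) → Nested P (chord o) (chord o′)
        nested-right-left o o′ ne r l = crossing′ {o} {o′} true true
          (λ v∈ h → left⁺ o′ ([ (λ k → k) , (λ k → ⊥-elim (ne (crossing-pair
                (apexOf o (tip∈ o′) v∈ r (left o h)) (apexOf o′ v∈ (tip∈ o) k l)))) ]′
              (leftOr o′ v∈ λ { refl → asym₂₃ r (left o h) })))
          (left⁺ o′ l) (right⁺ o r)

        concur : ∀ o o′ → tip o ≡ tip o′ → ∀ {u} → u ∈ P → side o true u ≡ false → side o′ true u ≡ true →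
          Nested P (chord o) (chord o′)
        concur o o′ eq {u} u∈ s s′ = concurrent true eq sub back u∈ s′ rightu
          where
          rightu : side o false u ≡ true
          rightu = IsChord.cover (isChord o) true u∈ (λ { refl → ≢₁₂ (left o′ s′) (sym eq) }) s
          sub : ∀ {v} → v ∈ P → side o true v ≡ true → side o′ true v ≡ true
          sub {v} v∈ h = left⁺ o′ ([ (λ k → k) , (λ k → ⊥-elim (asym
              (proj₁ (proj₂ (apexOf o u∈ v∈ (right o rightu) (left o h))))
              (subst (L v u) (sym eq) (proj₁ (proj₂ (apexOf o′ v∈ u∈ k (left o′ s′))))))) ]′
            (leftOr o′ v∈ λ { refl → ≢₁₂ (left o h) eq }))
          back : ∀ {v} → v ∈ P → side o′ false v ≡ true → side o false v ≡ true
          back {v} v∈ h with side o true v in sv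
          ... | true = ⊥-elim (t≢f (sub v∈ sv) (IsChord.disjoint (isChord o′) false h))
          ... | false = IsChord.cover (isChord o) true v∈ (λ { refl → ≢₁₃ (right o′ h) (sym eq) }) sv

        -- For different tips, the position of each tip relative to the other line leaves four
        -- cases. If the tips are on opposite sides, a vertex violating the inclusion is excluded by
        -- `crossing-pair`, hence by sparsity; if they are on equally named sides, it yields
        -- contradictory orientations. A common tip is settled by a vertex on which the splittings
        -- differ.
        nested : ∀ o o′ → (tip o ≡ tip o′ → ∃[ u ] (u ∈ P × side o true u ≢ side o′ true u)) →
          Nested P (chord o) (chord o′)
        nested o o′ differ with tip o ≟ tip o′
        ... | no ne with leftOr o (tip∈ o′) (≢-sym ne) | leftOr o′ (tip∈ o) ne
        ...   | inj₂ r | inj₁ l = nested-right-left o o′ ne r l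
        ...   | inj₁ l | inj₂ r = Nested-sym (nested-right-left o′ o (≢-sym ne) r l)
        ...   | inj₂ r | inj₂ r′ = crossing′ {o} {o′} true false
                (λ v∈ h → right⁺ o′ ([ (λ k → ⊥-elim (asym (proj₁ (proj₂ (apexOf o (tip∈ o′) v∈ r (left o h))))
                    (cyc (proj₁ (proj₂ (apexOf o′ (tip∈ o) v∈ r′ k)))))) , (λ k → k) ]′
                  (leftOr o′ v∈ λ { refl → asym₂₃ r (left o h) })))
                (right⁺ o′ r′) (right⁺ o r)
        ...   | inj₁ l | inj₁ l′ = crossing′ {o} {o′} false true
                (λ v∈ h → left⁺ o′ ([ (λ k → k) , (λ k → ⊥-elim (asym₂₃ (proj₁ (proj₂ (apexOf o v∈ (tip∈ o′) (right o h) l)))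
                    (proj₁ (proj₂ (apexOf o′ v∈ (tip∈ o) k l′))))) ]′
                  (leftOr o′ v∈ λ { refl → asym₂₃ l (right o h) })))
                (left⁺ o′ l′) (left⁺ o l)
        nested o o′ differ | yes eq with differ eq
        ... | u , u∈ , ne with side o true u in s | side o′ true u in s′
        ...   | true | true = ⊥-elim (ne refl)
        ...   | false | false = ⊥-elim (ne refl)
        ...   | false | true = concur o o′ eq u∈ s s′
        ...   | true | false = Nested-sym (concur o′ o (sym eq) u∈ s′ s)

        weight : Outer → ℕ
        weight o = count (side o true) P ⊓ count (side o false) P

        Larger : Set
        Larger = ∃[ H ] (Hole H × length H ≡ suc (length P))

        Same : Outer → Outer → Set
        Same o o′ = tip o ≡ tip o′ × map (side o true) P ≡ map (side o′ true) P

        Same? : ∀ o o′ → Dec (Same o o′)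
        Same? o o′ = (tip o ≟ tip o′) ×-dec ≡-dec _≟ᵇ_ (map (side o true) P) (map (side o′ true) P)

        Small : Outer → Set
        Small o = ∃[ W ] (length W < 2 ^ weight o × (∀ {o′} → Same o o′ → pt o′ ∈ W))

        group-small : ∀ o → Larger ⊎ Small o
        group-small o with ∈-∃++ (tip∈ o)
        ... | as , bs , eq = go refl refl
          where
          t = tip o
          Q = bs ++ as
          lt? : ∀ z → Dec (L t z (pt o))
          lt? z = L? t z (pt o)
          rt? : ∀ z → Dec (L t (pt o) z)
          rt? z = L? t (pt o) z
          hole′ : Hole (t ∷ Q)
          hole′ = hole-rotate as (subst Hole eq hole)
          inP : ∀ {z} → z ∈ Q → z ∈ P
          inP z∈ = subst (_ ∈_) (sym eq) (∈-rotate (t ∷ bs) (there z∈))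
          inQ : ∀ {z} → z ∈ P → z ≢ t → z ∈ Q
          inQ {z} z∈ ne with ∈-rotate as (subst (z ∈_) eq z∈)
          ... | here p = ⊥-elim (ne p)
          ... | there m = m
          t∉Q : ∀ {z} → z ∈ Q → z ≢ t
          t∉Q z∈ refl = All.lookup (AllPairs.head (Hole.unique hole′)) z∈ refl
          l r : ℕ
          l = length (filter lt? Q)
          r = length (filter rt? Q)
          countP : ∀ σ → count (side o σ) P ≡ count (side o σ) Q
          countP σ = trans (cong (count (side o σ)) eq) (count-rotate (side o σ) as (IsChord.tip-off (isChord o) σ))
          weight≡ : weight o ≡ l ⊓ r
          weight≡ = cong₂ _⊓_ (trans (countP true) (sym (count-filter lt? Q)))
                              (trans (countP false) (sym (count-filter rt? Q)))
          l+r : l + r ≡ length Q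
          l+r = trans (cong₂ _+_ (count-filter lt? Q) (count-filter rt? Q)) (count-partition Q
            (λ _ → IsChord.disjoint (isChord o) true)
            (λ z∈ → IsChord.cover (isChord o) true (inP z∈) (t∉Q z∈)))
          lenP : length P ≡ suc (length Q)
          lenP = trans (cong length eq) (trans (length-insert as) (cong suc (trans (length-++ as)
            (trans (ℕₚ.+-comm (length as) (length bs)) (sym (length-++ bs))))))
          ∈lt : ∀ {z} → z ∈ filter lt? Q → z ∈ P × Left o z
          ∈lt z∈ = let m , h = ∈-filter⁻ lt? {xs = Q} z∈ in inP m , h
          ∈rt : ∀ {z} → z ∈ filter rt? Q → z ∈ P × Right o z
          ∈rt z∈ = let m , h = ∈-filter⁻ rt? {xs = Q} z∈ in inP m , h
          sorted : ∀ {R : A → Set} (R? : ∀ z → Dec (R z)) → AllPairs (L t) (filter R? Q)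
          sorted R? = AllPairs.filter⁺ R? (proj₁ (Hole.convex hole′))

          go : ∀ {Z X} → filter lt? Q ≡ Z → filter rt? Q ≡ X →
            Larger ⊎ Small o
          go {[]} eZ _ = case subst (y₀ o ∈_) eZ (∈-filter⁺ lt? (inQ (y₀∈ o) (λ h → ≢₁₂ y-left (sym h))) y-left) of λ ()
            where
            y-left : Left o (y₀ o)
            y-left = cyc² (proj₂ (proj₂ (apex o)))
          go {_ ∷ _} {[]} _ eX = case subst (x₀ o ∈_) eX (∈-filter⁺ rt? (inQ (x₀∈ o) (λ h → ≢₁₃ x-right (sym h))) x-right) of λ ()
            where
            x-right : Right o (x₀ o)
            x-right = cyc² (proj₁ (apex o))
          go {z ∷ zs} {x ∷ xs} eZ eX = decide (2 ^ weight o ℕₚ.≤? length Gr.W)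
            where
            inZ : ∀ {a} → a ∈ z ∷ zs → a ∈ P × Left o a
            inZ {a} a∈ = ∈lt (subst (a ∈_) (sym eZ) a∈)
            inX : ∀ {a} → a ∈ x ∷ xs → a ∈ P × Right o a
            inX {a} a∈ = ∈rt (subst (a ∈_) (sym eX) a∈)
            module Gr = Group {t} {z} {x} {zs} {xs}
              (subst conv eZ (conv-filter lt? (proj₂ (Hole.convex hole′))))
              (subst conv eX (conv-filter rt? (proj₂ (Hole.convex hole′))))
              (subst (AllPairs (L t)) eZ (sorted lt?)) (subst (AllPairs (L t)) eX (sorted rt?))
              (linked-all _ λ a∈ b∈ {p} → free (tip∈ o) (proj₁ (inZ a∈)) (proj₁ (inZ b∈)))
              (linked-all _ λ a∈ b∈ {p} → free (tip∈ o) (proj₁ (inX a∈)) (proj₁ (inX b∈)))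
              (λ a∈ b∈ → cyc² (proj₁ (proj₂ (apexOf o (proj₁ (inX a∈)) (proj₁ (inZ b∈)) (proj₂ (inX a∈)) (proj₂ (inZ b∈))))))
            decide : Dec (2 ^ weight o ≤ length Gr.W) → Larger ⊎ Small o
            decide (no few) = inj₂ (Gr.W , ℕₚ.≰⇒> few , λ {o′} (tip≡ , sides≡) → ∈-filter⁺ _ (complete (pt o′))
              ( All.tabulate (λ {a} a∈ → let a∈P , h = inZ a∈ in
                  subst (λ s → L s a (pt o′)) (sym tip≡) (left o′ (trans (sym (map-same sides≡ a∈P)) (left⁺ o h))))
              , All.tabulate (λ {a} a∈ → let a∈P , h = inX a∈ in
                  subst (λ s → L s (pt o′) a) (sym tip≡) (right o′ (IsChord.cover (isChord o′) true a∈P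
                    (λ { refl → ≢₁₃ h tip≡ })
                    (trans (sym (map-same sides≡ a∈P)) (IsChord.disjoint (isChord o) false (right⁺ o h))))))))
              where
              map-same : ∀ {f g : A → Bool} {xs a} → map f xs ≡ map g xs → a ∈ xs → f a ≡ g a
              map-same {xs = _ ∷ _} e (here refl) = ∷-injectiveˡ e
              map-same {xs = _ ∷ _} e (there m) = map-same (∷-injectiveʳ e) m
            -- The smaller side has `weight o` vertices and is exchanged for a cap with one point
            -- more.
            decide (yes many) with ℕₚ.≤-total l r
            ... | inj₂ r≤l with Gr.left-hole (weight o) many
            ...   | H , hH , len = inj₁ (H , hH , trans len (cong suc (trans (ℕₚ.+-suc (length (z ∷ zs)) (weight o))
                      (trans (cong₂ (λ a b → suc (a + b)) (cong length (sym eZ)) (trans weight≡ (ℕₚ.m≥n⇒m⊓n≡n r≤l)))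
                      (trans (cong suc l+r) (sym lenP))))))
            decide (yes many) | inj₁ l≤r with Gr.right-hole (weight o) many
            ...   | H , hH , len = inj₁ (H , hH , trans len (cong suc
                      (trans (cong₂ (λ a b → suc (a + b)) (trans weight≡ (ℕₚ.m≤n⇒m⊓n≡m l≤r)) (cong length (sym eX)))
                      (trans (cong suc l+r) (sym lenP)))))

        near? : ∀ d → Dec (∃[ t ] (t ∈ P × ∃[ x ] (x ∈ P × ∃[ y ] (y ∈ P × In d x y t))))
        near? d = search λ t → (t ∈? P) ×-dec search λ x → (x ∈? P) ×-dec search λ y → (y ∈? P) ×-dec In? d x y t

        outers : ∀ D → Unique D → (∀ {d} → d ∈ D → ∃[ o ] (pt o ≡ d)) →
          ∃[ os ] (length os ≡ length D × AllPairs (λ a b → pt a ≢ pt b) os × (∀ {o} → o ∈ os → pt o ∈ D))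
        outers [] _ _ = [] , refl , [] , λ ()
        outers (d ∷ D) (d∉ ∷ u) f with f (here refl) | outers D u (f ∘ there)
        ... | o , refl | os , len , apart , sub = o ∷ os , cong suc len ,
          All.tabulate (λ o∈ → All.lookup d∉ (sub o∈)) ∷ apart ,
          λ { (here refl) → here refl ; (there o∈) → there (sub o∈) }

        larger : 3 ≤ length P → G (length P) < length elements → Larger
        -- A point with no vertex in any of its triangles over two vertices is beyond a single side,
        -- where the hole can be extended.
        larger 3≤ many with search (λ d → ¬? (d ∈? P) ×-dec ¬? (near? d))
        ... | yes (d , d∉ , far) = Beyond.grown hole 3≤ d∉ λ t∈ x∈ y∈ i → far (_ , t∈ , _ , x∈ , _ , y∈ , i)
        ... | no all-near = fromGroups (decideAll os)
          where
          outside? : ∀ d → Dec (¬ d ∈ P)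
          outside? d = ¬? (d ∈? P)
          D = filter outside? elements
          toOuter : ∀ {d} → d ∈ D → ∃[ o ] (pt o ≡ d)
          toOuter {d} d∈ with near? d
          ... | yes (t , t∈ , x , x∈ , y , y∈ , i) = record
                { pt = d ; pt∉ = proj₂ (∈-filter⁻ outside? {xs = elements} d∈) ; tip = t ; x₀ = x ; y₀ = y
                ; tip∈ = t∈ ; x₀∈ = x∈ ; y₀∈ = y∈ ; apex = i } , refl
          ... | no far = ⊥-elim (all-near (d , proj₂ (∈-filter⁻ outside? {xs = elements} d∈) , far))
          built = outers D (Unique.filter⁺ outside? distinct) toOuter
          os = proj₁ built
          apart = proj₁ (proj₂ (proj₂ built))
          enough : length elements ≤ length P + length os
          enough = begin
            length elements ≡⟨ filter-split (_∈? P) elements ⟨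
            length (filter (_∈? P) elements) + length D
              ≤⟨ ℕₚ.+-mono-≤ (length-⊆ (Unique.filter⁺ (_∈? P) distinct) (λ z∈ → proj₂ (∈-filter⁻ (_∈? P) {xs = elements} z∈)))
                              (ℕₚ.≤-reflexive (sym (proj₁ (proj₂ built)))) ⟩
            length P + length os ∎
            where open ℕₚ.≤-Reasoning

          decideAll : ∀ xs → Larger ⊎ (∀ {o} → o ∈ xs → Small o)
          decideAll [] = inj₂ λ ()
          decideAll (o ∷ xs) with group-small o | decideAll xs
          ... | inj₁ h | _ = inj₁ h
          ... | _ | inj₁ h = inj₁ h
          ... | inj₂ s | inj₂ ss = inj₂ λ { (here refl) → s ; (there m) → ss m }

          fromGroups : Larger ⊎ (∀ {o} → o ∈ os → Small o) → Larger
          fromGroups (inj₁ h) = h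
          fromGroups (inj₂ small) = ⊥-elim (ℕₚ.<⇒≱ many few)
            where
            k = length P
            class-small : ∀ {o} → o ∈ os → length (filter (Same? o) os) ≤ ℕ.pred (2 ^ weight o)
            class-small {o} o∈ with small {o} o∈
            ... | W , lt , cover = ℕₚ.<⇒≤pred (ℕₚ.≤-<-trans (subst (_≤ length W) (length-map pt (filter (Same? o) os))
              (length-⊆ (AllPairs.map⁺ (AllPairs.filter⁺ (Same? o) apart)) inW)) lt)
              where
              inW : ∀ {z} → z ∈ map pt (filter (Same? o) os) → z ∈ W
              inW z∈ with ∈-map⁻ pt z∈
              ... | o′ , o′∈ , refl = cover {o′} (proj₂ (∈-filter⁻ (Same? o) {xs = os} o′∈))
            chosen = representatives Same? (λ _ → refl , refl) (λ o → ℕ.pred (2 ^ weight o)) (length os) os ℕₚ.≤-refl class-small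
            rs = proj₁ chosen
            rs-nested : AllPairs (λ a b → Nested P (chord a) (chord b)) rs
            rs-nested = AllPairs.map (λ {a} {b} ns → nested a b λ tip≡ → map-differ _ _ P λ eq → ns (tip≡ , eq)) (proj₁ (proj₂ chosen))
            at-least : ∀ {o w} → w ≤ weight o → IsChord P w (chord o)
            at-least {o} le = record
              { tip∈ = IsChord.tip∈ c ; tip-off = IsChord.tip-off c ; disjoint = IsChord.disjoint c
              ; cover = IsChord.cover c ; total = IsChord.total c
              ; large = λ { true → ℕₚ.≤-trans le (ℕₚ.m⊓n≤m _ _) ; false → ℕₚ.≤-trans le (ℕₚ.m⊓n≤n _ _) } }
              where c = isChord o
            chords : ∀ x xs → AllPairs (λ a b → Nested P (chord a) (chord b)) (x ∷ xs) →
              (∀ {y} → y ∈ x ∷ xs → weight x ≤ weight y) → length (x ∷ xs) + 2 * weight x ≤ k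
            chords x xs ns least = subst (λ n → suc n + 2 * weight x ≤ k) (length-map chord xs)
              (chord-bound _≟_ {w = weight x} (ℕₚ.⊓-glb (IsChord.large (isChord x) true) (IsChord.large (isChord x) false))
                (chord x) (map chord xs) (All.map⁺ (All.tabulate {xs = x ∷ xs} λ y∈ → at-least (least y∈)))
                (AllPairs.map⁺ {f = chord} {xs = x ∷ xs} ns))
            bound = sum-bound Nested-sym weight k chords (length rs) rs refl rs-nested
            open ℕₚ.≤-Reasoning
            Σw = sum (map (λ o → ℕ.pred (2 ^ weight o)) rs)
            -- At most `k` classes occur, so one vertex of the hole offsets the -1 in the bound of
            -- each class. The vertices left over are counted through `j≤Gj`, which completes the
            -- sum to `G k`.
            few : length elements ≤ G k
            few = begin
              length elements ≤⟨ enough ⟩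
              k + length os ≤⟨ ℕₚ.+-monoʳ-≤ k (proj₂ (proj₂ (proj₂ chosen))) ⟩
              k + Σw ≡⟨ ℕₚ.+-comm k Σw ⟩
              Σw + k ≡⟨ cong (Σw +_) (sym (ℕₚ.m+[n∸m]≡n (proj₂ bound))) ⟩
              Σw + (length rs + (k ∸ length rs)) ≡⟨ ℕₚ.+-assoc Σw (length rs) _ ⟨
              Σw + length rs + (k ∸ length rs) ≡⟨ cong (_+ (k ∸ length rs)) (sum-pred (λ o → 2 ^ weight o) (λ o → ℕₚ.m^n>0 2 (weight o)) rs) ⟩
              sum (map (λ o → 2 ^ weight o) rs) + (k ∸ length rs) ≤⟨ ℕₚ.+-monoʳ-≤ _ (j≤Gj (k ∸ length rs)) ⟩
              sum (map (λ o → 2 ^ weight o) rs) + G (k ∸ length rs) ≤⟨ proj₁ bound ⟩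
              G k ∎

      start : 3 ≤ length elements → ∃[ H ] (Hole H × length H ≡ 3)
      start = go elements distinct
        where
        corner : ∀ {a b c} → L a b c → ∃[ H ] (Hole H × length H ≡ 3)
        corner {a} {b} {c} abc with shrink {a} {b} {c} (L a b) abc proj₁
        ... | d , abd , none = a ∷ b ∷ d ∷ [] ,
          fan-hole ((≢₁₂ abd ∷ ≢₁₃ abd ∷ []) ∷ (≢₂₃ abd ∷ []) ∷ [] ∷ [])
            (((abd ∷ []) ∷ [] ∷ []) , ([] ∷ []) , [] , tt) ((λ {p} → none {p}) ∷ [-]) , refl
        go : ∀ xs → Unique xs → 3 ≤ length xs → ∃[ H ] (Hole H × length H ≡ 3)
        go (a ∷ b ∷ c ∷ _) ((a≢b ∷ a≢c ∷ _) ∷ (b≢c ∷ _) ∷ _) _ = [ corner , corner ]′ (tot a≢b b≢c a≢c)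
        go (_ ∷ _ ∷ []) _ (s≤s (s≤s ()))
        go (_ ∷ []) _ (s≤s ())

      holes : ∀ j → G (2 + j) < length elements → ∃[ H ] (Hole H × length H ≡ 3 + j)
      holes zero many = start many
      holes (suc j) many with holes j (ℕₚ.≤-<-trans (ℕₚ.m≤m+n _ _) many)
      ... | H , hH , len with Outside.larger hH (subst (3 ≤_) (sym len) (ℕₚ.m≤m+n 3 j))
                                 (subst (λ k → G k < length elements) (sym len) many)
      ...   | H′ , hH′ , len′ = H′ , hH′ , trans len′ (cong suc len)

-- Empty pentagons in triangles with two interior points

module CrowdedTriangles where

  open Orientations
  open Chords
  open ConvexPosition
  open import Data.Nat as ℕ using (ℕ; zero; suc; _≤_; _<_; z≤n; s≤s)
  import Data.Nat.Properties as ℕₚ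

  module Crowded {A : Set} (C : CCSystem A) (_≟_ : ∀ (a b : A) → Dec (a ≡ b))
    (elements : List A) (complete : ∀ a → a ∈ elements) where

    open Planar C
    open Finite _≟_ elements complete

    -- The polygon b c p q a has corners a, b, c and is fanned by b into three triangles.
    record Pentagon : Set where
      field
        a b c p q : A
        p∈   : In a b c p
        q∈   : In a b c q
        bpq  : L b p q
        pcq  : L p c q
        qpa  : L q p a
        fan₁ : NoneIn b c p
        fan₂ : NoneIn b p q
        fan₃ : NoneIn b q a

    size : A → A → A → ℕ
    size a b c = length (filter (In? a b c) elements)

    size-< : ∀ {a b c x y z p} → (∀ {q} → In x y z q → In a b c q) → In a b c p → ¬ In x y z p →
      size x y z < size a b c
    size-< {a} {b} {c} {x} {y} {z} {p} sub p∈ p∉ =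
      subst₂ _<_ (sym (count-filter (In? x y z) elements)) (sym (count-filter (In? a b c) elements))
        (count-mono-< (λ {q} _ h → dec-true (In? a b c q) (sub (does-true (In? x y z q) h)))
          (complete p) (dec-false (In? x y z p) p∉) (dec-true (In? a b c p) p∈))

    In-self₃ : ∀ {a b c} → ¬ In a b c c
    In-self₃ (_ , h , _) = ≢₂₃ h refl

    In-sub₂ : ∀ {a b c p q} → In a b c p → In b c p q → In a b c q
    In-sub₂ i j = In-cyc (In-cyc (In-sub (In-cyc i) j))

    In-sub₃ : ∀ {a b c p q} → In a b c p → In c a p q → In a b c q
    In-sub₃ i j = In-cyc (In-sub (In-cyc (In-cyc i)) j)

    second? : ∀ a b c p → Dec (∃[ q ] (In a b c q × q ≢ p))
    second? a b c p = search λ q → In? a b c q ×-dec ¬? (q ≟ p)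

    only : ∀ {a b c p} → ¬ (∃[ q ] (In a b c q × q ≢ p)) → ∀ {q} → In a b c q → q ≡ p
    only {p = p} no2 {q} i = decidable-stable (q ≟ p) λ ne → no2 (q , i , ne)

    -- Recursion to smaller crowded triangles leaves at most three interior points.
    pentagon : ∀ n a b c {p q} → size a b c ℕ.≤ n → In a b c p → In a b c q → p ≢ q → Pentagon
    pentagon zero a b c le p∈ _ _ = ⊥-elim (ℕₚ.<⇒≱ (member (∈-filter⁺ (In? a b c) (complete _) p∈)) le)
      where
      member : ∀ {x : A} {xs} → x ∈ xs → 0 < length xs
      member (here _) = s≤s z≤n
      member (there _) = s≤s z≤n
    pentagon (suc n) a b c {p₀} {q₀} le p₀∈ q₀∈ p₀≢q₀ = start (search (In? b c p₀))
      where
      smaller : ∀ {x y z r} → (∀ {s} → In x y z s → In a b c s) → In a b c r → ¬ In x y z r →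
        ∀ {u v} → In x y z u → In x y z v → u ≢ v → Pentagon
      smaller sub r∈ r∉ = pentagon n _ _ _ (ℕₚ.≤-pred (ℕₚ.≤-trans (size-< sub r∈ r∉) le))

      -- As `b c p` is empty, `q` lies in one of the other two parts at `p`; a second point there
      -- makes that part a smaller crowded triangle. Otherwise the opposite corner's side of the
      -- line `p q` decides at which corner to fan. One triangle of the second fan may be occupied,
      -- and then `p` and its occupant crowd a triangle that leaves out `q`.
      low : ∀ {p q} → In a b c p → NoneIn b c p → In a b c q → p ≢ q → Pentagon
      low {p} {q} p∈ none q∈ p≢q with In-split p∈ q∈ p≢q
      ... | inj₂ (inj₁ i) = ⊥-elim (none i)
      ... | inj₁ i@(abq , bpq , paq) with second? a b p q
      ...   | yes (r , r∈ , r≢q) = smaller (In-sub p∈) p∈ In-self₃ r∈ i r≢q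
      ...   | no single with tot p≢q (≢-sym (≢₂₃ (proj₁ (proj₂ q∈)))) (≢-sym (≢₂₃ (proj₁ (proj₂ p∈))))
      ...     | inj₂ qpc = record
        { a = a ; b = b ; c = c ; p = p ; q = q ; p∈ = p∈ ; q∈ = q∈ ; bpq = bpq ; pcq = cyc qpc ; qpa = cyc² paq
        ; fan₁ = none
        ; fan₂ = λ j → case only single (In-sub₂ i j) of λ { refl → In-self₃ j }
        ; fan₃ = λ j → case only single (In-sub i (In-cyc (In-cyc j))) of λ { refl → In-self j } }
      ...     | inj₁ pqc with search (In? c a p)
      ...       | no none′ = record
        { a = c ; b = a ; c = b ; p = q ; q = p ; p∈ = In-cyc (In-cyc q∈) ; q∈ = In-cyc (In-cyc p∈)
        ; bpq = cyc paq ; pcq = cyc² bpq ; qpa = pqc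
        ; fan₁ = λ j → case only single (In-sub i j) of λ { refl → In-self₃ j }
        ; fan₂ = λ j → case only single (In-sub₃ i (In-cyc (In-cyc j))) of λ { refl → In-self j }
        ; fan₃ = λ j → none′ (_ , In-cyc (In-cyc j)) }
      ...       | yes (r , r∈) = smaller (In-sub₃ q∈) q∈ In-self₃ p∈′ (In-sub p∈′ r∈) λ { refl → In-self₃ r∈ }
        where p∈′ : In c a q p
              p∈′ = proj₂ (proj₂ p∈) , cyc paq , cyc pqc
      low {p} {q} p∈ none q∈ p≢q | inj₂ (inj₂ i@(caq , apq , pcq)) with second? c a p q
      ...   | yes (r , r∈ , r≢q) = smaller (In-sub₃ p∈) p∈ In-self₃ r∈ i r≢q
      ...   | no single with tot p≢q (λ { refl → ≢₂₃ (proj₁ q∈) refl }) (λ { refl → ≢₂₃ (proj₁ p∈) refl })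
      ...     | inj₁ pqb = record
        { a = b ; b = c ; c = a ; p = q ; q = p ; p∈ = In-cyc q∈ ; q∈ = In-cyc p∈
        ; bpq = cyc pcq ; pcq = cyc² apq ; qpa = pqb
        ; fan₁ = λ j → case only single (In-sub i j) of λ { refl → In-self₃ j }
        ; fan₂ = λ j → case only single (In-sub₃ i (In-cyc (In-cyc j))) of λ { refl → In-self j }
        ; fan₃ = λ j → none (In-cyc (In-cyc j)) }
      ...     | inj₂ qpb with search (In? a b p)
      ...       | no none′ = record
        { a = c ; b = a ; c = b ; p = p ; q = q ; p∈ = In-cyc (In-cyc p∈) ; q∈ = In-cyc (In-cyc q∈)
        ; bpq = apq ; pcq = cyc qpb ; qpa = cyc² pcq
        ; fan₁ = λ j → none′ (_ , j)
        ; fan₂ = λ j → case only single (In-sub₂ i j) of λ { refl → In-self₃ j }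
        ; fan₃ = λ j → case only single (In-sub i (In-cyc (In-cyc j))) of λ { refl → In-self j } }
      ...       | yes (r , r∈) = smaller (In-sub q∈) q∈ In-self₃ p∈′ (In-sub p∈′ r∈) λ { refl → In-self₃ r∈ }
        where p∈′ : In a b q p
              p∈′ = proj₁ p∈ , cyc² qpb , cyc² apq

      start : Dec (∃[ x ] In b c p₀ x) → Pentagon
      start (no none) = low p₀∈ (λ {x} i → none (x , i)) q₀∈ p₀≢q₀
      -- If `p` is the only point of `b c p₀`, then `b c p` is empty, since any point of it would be
      -- another one.
      start (yes (p , p∈)) with second? b c p₀ p
      ... | yes (r , r∈ , r≢p) = smaller (In-sub₂ p₀∈) p₀∈ In-self₃ r∈ p∈ r≢p
      ... | no single = low (In-sub₂ p₀∈ p∈) (λ i → case only single (In-sub p∈′ i) of λ { refl → In-self₃ i })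
              p₀∈ λ { refl → In-self₃ p∈ }
        where p∈′ = p∈

-- Winding numbers around triangles

module WindingNumbers where

  open import Defs
  open Orientations
  open ConvexPosition using (does-true; does-false)
  open import Data.Integer as ℤ using (ℤ)
  import Data.Integer.Properties as ℤₚ
  open import Data.Rational using (ℚ; 0ℚ; _+_; _*_; _-_; -_; _<_; _≤_; positive; nonNegative; nonPositive)
  open import Data.Rational.Properties
  open import Data.Rational.Solver using (module +-*-Solver)

  open +-*-Solver using (solve; _:=_; _:+_; _:*_; _:-_; :-_; con)

  -- The crossing rule as a function of four Booleans, so that its behaviour under reversing an edge
  -- is a finite check.
  crossingB : Bool → Bool → Bool → Bool → ℤ
  crossingB lowA lowB left right =
    if lowA ∧ not lowB ∧ left then ℤ.+ 1 else if lowB ∧ not lowA ∧ right then ℤ.-[1+ 0 ] else ℤ.+ 0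

  low : Point → Point → Bool
  low z a = does (y a ≤? y z)

  <?-not-≤? : ∀ p q → does (p <? q) ≡ not (does (q ≤? p))
  <?-not-≤? p q = go (q ≤? p)
    where
    go : (d : Dec (q ≤ p)) → does (p <? q) ≡ not (does d)
    go (yes h) = dec-false (p <? q) (λ k → <-irrefl refl (<-≤-trans k h))
    go (no h) = dec-true (p <? q) (≰⇒> h)

  windContribution≡ : ∀ z a b → windContribution z (a , b) ≡
    crossingB (low z a) (low z b) (does (0ℚ <? orient a b z)) (does (orient a b z <? 0ℚ))
  windContribution≡ z a b rewrite <?-not-≤? (y z) (y b) | <?-not-≤? (y z) (y a) = refl

  crossingB-anti : ∀ p q l r → crossingB q p r l ≡ ℤ.- crossingB p q l r
  crossingB-anti false false l r = refl
  crossingB-anti false true l false = refl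
  crossingB-anti false true l true = refl
  crossingB-anti true false false r = refl
  crossingB-anti true false true r = refl
  crossingB-anti true true l r = refl

  does-⇔ : {P Q : Set} (p? : Dec P) (q? : Dec Q) → (P → Q) → (Q → P) → does p? ≡ does q?
  does-⇔ (yes p) q? f g = sym (dec-true q? (f p))
  does-⇔ (no ¬p) q? f g = sym (dec-false q? (λ q → ¬p (g q)))

  -- A diagonal traversed in both directions cancels, so winding numbers add up over a
  -- triangulation.
  windContribution-anti : ∀ z a b → windContribution z (b , a) ≡ ℤ.- windContribution z (a , b)
  windContribution-anti z a b = trans (windContribution≡ z b a) (trans
    (cong₂ (crossingB (low z b) (low z a))
      (does-⇔ (0ℚ <? orient b a z) (orient a b z <? 0ℚ) (left-anti {b} {a} {z}) (right-anti {a} {b} {z}))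
      (does-⇔ (orient b a z <? 0ℚ) (0ℚ <? orient a b z) (right-anti {b} {a} {z}) (left-anti {a} {b} {z})))
    (trans (crossingB-anti (low z a) (low z b) (does (0ℚ <? orient a b z)) (does (orient a b z <? 0ℚ)))
      (cong ℤ.-_ (sym (windContribution≡ z a b)))))

  windTriangle : Point → Point → Point → Point → ℤ
  windTriangle z a b c = windContribution z (a , b) ℤ.+ windContribution z (b , c) ℤ.+ windContribution z (c , a)

  windTriangle-cyc : ∀ z a b c → windTriangle z a b c ≡ windTriangle z b c a
  windTriangle-cyc z a b c = trans (ℤₚ.+-assoc u v w) (ℤₚ.+-comm u (v ℤ.+ w))
    where
    u = windContribution z (a , b)
    v = windContribution z (b , c)
    w = windContribution z (c , a)

  abstract
    -- The vertical coordinate of the barycentric representation of `z`: the weighted heights above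
    -- `z` balance.
    heights : ∀ a b c z →
      orient b c z * (y a - y z) + orient c a z * (y b - y z) + orient a b z * (y c - y z) ≡ 0ℚ
    heights (ax , ay) (bx , by) (cx , cy) (zx , zy) =
      solve 8 (λ ax ay bx by cx cy zx zy →
        orientP bx by cx cy zx zy :* (ay :- zy) :+ orientP cx cy ax ay zx zy :* (by :- zy)
          :+ orientP ax ay bx by zx zy :* (cy :- zy) := con 0ℚ) refl ax ay bx by cx cy zx zy

  crossingB-same : ∀ p l r → crossingB p p l r ≡ ℤ.+ 0
  crossingB-same true l r = refl
  crossingB-same false l r = refl

  wind-left : ∀ z a b {p q} → low z a ≡ p → low z b ≡ q → 0ℚ < orient a b z →
    windContribution z (a , b) ≡ crossingB p q true false
  wind-left z a b refl refl h = trans (windContribution≡ z a b)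
    (cong₂ (crossingB (low z a) (low z b)) (dec-true (0ℚ <? orient a b z) h)
      (dec-false (orient a b z <? 0ℚ) (<-asym h)))

  wind-right : ∀ z a b {p q} → low z a ≡ p → low z b ≡ q → orient a b z < 0ℚ →
    windContribution z (a , b) ≡ crossingB p q false true
  wind-right z a b refl refl h = trans (windContribution≡ z a b)
    (cong₂ (crossingB (low z a) (low z b)) (dec-false (0ℚ <? orient a b z) (<-asym h))
      (dec-true (orient a b z <? 0ℚ) h))

  wind-level : ∀ z a b {p} → low z a ≡ p → low z b ≡ p → windContribution z (a , b) ≡ ℤ.+ 0
  wind-level z a b refl e = trans (windContribution≡ z a b)
    (trans (cong (λ q → crossingB (low z a) q (does (0ℚ <? orient a b z)) (does (orient a b z <? 0ℚ))) e)
      (crossingB-same (low z a) _ _))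

  add₃ : ∀ {u u′ v v′ w w′} → u ≡ u′ → v ≡ v′ → w ≡ w′ → u ℤ.+ v ℤ.+ w ≡ u′ ℤ.+ v′ ℤ.+ w′
  add₃ refl refl refl = refl

  low-true : ∀ {z a} → low z a ≡ true → y a - y z ≤ 0ℚ
  low-true {z} {a} e = subst (y a - y z ≤_) (+-inverseʳ (y z)) (+-monoˡ-≤ (- y z) (does-true (y a ≤? y z) e))

  low-false : ∀ {z a} → low z a ≡ false → 0ℚ < y a - y z
  low-false {z} {a} e = subst (_< y a - y z) (+-inverseʳ (y z)) (+-monoˡ-< (- y z) (≰⇒> (does-false (y a ≤? y z) e)))

  pos*nonPos : ∀ {a b} → 0ℚ ≤ a → b ≤ 0ℚ → a * b ≤ 0ℚ
  pos*nonPos {a} {b} h k = subst (a * b ≤_) (*-zeroʳ a) (*-monoˡ-≤-nonNeg a {{nonNegative h}} k)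

  neg*nonPos : ∀ {a b} → a ≤ 0ℚ → b ≤ 0ℚ → 0ℚ ≤ a * b
  neg*nonPos {a} {b} h k = subst (_≤ a * b) (*-zeroʳ a) (*-monoˡ-≤-nonPos a {{nonPositive h}} k)

  pos*neg : ∀ {a b} → 0ℚ < a → b < 0ℚ → a * b < 0ℚ
  pos*neg {a} {b} h k = subst (a * b <_) (*-zeroʳ a) (*-monoʳ-<-pos a {{positive h}} k)

  neg*pos : ∀ {a b} → a < 0ℚ → 0ℚ < b → a * b < 0ℚ
  neg*pos {a} {b} h k = subst (_< 0ℚ) (*-comm b a) (pos*neg k h)

  -- In the next lemmas only the vertex a is on its side of the horizontal line through z;
  -- u, v, w are the barycentric weights of z and α, β, γ the heights of a, b, c above z.
  module Weights (u v w α β γ : ℚ) (balance : u * α + v * β + w * γ ≡ 0ℚ) (total : 0ℚ < u + v + w) where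

    weights-low⁺ : α ≤ 0ℚ → 0ℚ < β → 0ℚ < γ → 0ℚ < v → 0ℚ < w → ¬ u < 0ℚ
    weights-low⁺ hα hβ hγ hv hw hu = <-irrefl (sym balance)
      (+-mono-≤-< (+-mono-≤ (neg*nonPos (<⇒≤ hu) hα) (<⇒≤ (*-pos hv hβ))) (*-pos hw hγ))

    weights-low⁻ : α ≤ 0ℚ → 0ℚ < β → 0ℚ < γ → v < 0ℚ → w < 0ℚ → ⊥
    weights-low⁻ hα hβ hγ hv hw with <-cmp u 0ℚ
    ... | tri< hu _ _ = <-asym total (+-mono-< (+-mono-< hu hv) hw)
    ... | tri≈ _ hu _ = <-irrefl balance (+-mono-≤-< (+-mono-≤ (pos*nonPos (≤-reflexive (sym hu)) hα) (<⇒≤ (neg*pos hv hβ))) (neg*pos hw hγ))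
    ... | tri> _ _ hu = <-irrefl balance (+-mono-≤-< (+-mono-≤ (pos*nonPos (<⇒≤ hu) hα) (<⇒≤ (neg*pos hv hβ))) (neg*pos hw hγ))

    weights-high⁺ : 0ℚ < α → β ≤ 0ℚ → γ ≤ 0ℚ → 0ℚ < v → 0ℚ < w → ¬ u < 0ℚ
    weights-high⁺ hα hβ hγ hv hw hu = <-irrefl balance
      (+-mono-<-≤ (+-mono-<-≤ (neg*pos hu hα) (pos*nonPos (<⇒≤ hv) hβ)) (pos*nonPos (<⇒≤ hw) hγ))

    weights-high⁻ : 0ℚ < α → β ≤ 0ℚ → γ ≤ 0ℚ → v < 0ℚ → w < 0ℚ → ⊥
    weights-high⁻ hα hβ hγ hv hw with <-cmp 0ℚ u
    ... | tri< hu _ _ = <-irrefl (sym balance) (+-mono-<-≤ (+-mono-<-≤ (*-pos hu hα) (neg*nonPos (<⇒≤ hv) hβ)) (neg*nonPos (<⇒≤ hw) hγ))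
    ... | tri≈ _ hu _ = <-asym total (+-mono-≤-< (+-mono-≤ (≤-reflexive (sym hu)) (<⇒≤ hv)) hw)
    ... | tri> _ _ hu = <-asym total (+-mono-< (+-mono-< hu hv) hw)

  private
    Sign : ℚ → Set
    Sign r = 0ℚ < r ⊎ r < 0ℚ

  sign : ∀ {r} → r ≢ 0ℚ → Sign r
  sign {r} ne with <-cmp r 0ℚ
  ... | tri< h _ _ = inj₂ h
  ... | tri≈ _ h _ = ⊥-elim (ne h)
  ... | tri> _ _ h = inj₁ h

  module _ {z a b c : Point} (abc : 0ℚ < orient a b c)
    (n₁ : orient a b z ≢ 0ℚ) (n₂ : orient b c z ≢ 0ℚ) (n₃ : orient c a z ≢ 0ℚ)
    (out : ¬ (0ℚ < orient a b z × 0ℚ < orient b c z × 0ℚ < orient c a z)) where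

    private
      total : 0ℚ < orient b c z + orient c a z + orient a b z
      total = subst (0ℚ <_) (trans (orient-cyc a b c) (orient-sum b c a z)) abc
      open Weights (orient b c z) (orient c a z) (orient a b z) (y a - y z) (y b - y z) (y c - y z)
        (heights a b c z) total

      not-inside : 0ℚ < orient a b z → 0ℚ < orient c a z → ¬ (orient b c z < 0ℚ) → ⊥
      not-inside h₁ h₃ k with sign n₂
      ... | inj₁ h₂ = out (h₁ , h₂ , h₃)
      ... | inj₂ h₂ = k h₂

    -- Only the two edges at `a` cross the level of `z`. With `z` left of one and right of the
    -- other, their contributions are +1 and -1 or both zero. Left of both would place `z` inside
    -- the triangle, and right of both contradicts the balance of heights or the positive area.
    odd-one : ∀ p → low z a ≡ p → low z b ≡ not p → low z c ≡ not p → windTriangle z a b c ≡ ℤ.+ 0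
    odd-one true la lb lc with sign n₁ | sign n₃
    ... | inj₁ h₁ | inj₁ h₃ = ⊥-elim (not-inside h₁ h₃ (weights-low⁺ (low-true {z} {a} la) (low-false {z} {b} lb) (low-false {z} {c} lc) h₃ h₁))
    ... | inj₂ h₁ | inj₂ h₃ = ⊥-elim (weights-low⁻ (low-true {z} {a} la) (low-false {z} {b} lb) (low-false {z} {c} lc) h₃ h₁)
    ... | inj₁ h₁ | inj₂ h₃ = add₃ (wind-left z a b la lb h₁) (wind-level z b c lb lc) (wind-right z c a lc la h₃)
    ... | inj₂ h₁ | inj₁ h₃ = add₃ (wind-right z a b la lb h₁) (wind-level z b c lb lc) (wind-left z c a lc la h₃)
    odd-one false la lb lc with sign n₁ | sign n₃
    ... | inj₁ h₁ | inj₁ h₃ = ⊥-elim (not-inside h₁ h₃ (weights-high⁺ (low-false {z} {a} la) (low-true {z} {b} lb) (low-true {z} {c} lc) h₃ h₁))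
    ... | inj₂ h₁ | inj₂ h₃ = ⊥-elim (weights-high⁻ (low-false {z} {a} la) (low-true {z} {b} lb) (low-true {z} {c} lc) h₃ h₁)
    ... | inj₁ h₁ | inj₂ h₃ = add₃ (wind-left z a b la lb h₁) (wind-level z b c lb lc) (wind-right z c a lc la h₃)
    ... | inj₂ h₁ | inj₁ h₃ = add₃ (wind-right z a b la lb h₁) (wind-level z b c lb lc) (wind-left z c a lc la h₃)

    same-level : ∀ p → low z a ≡ p → low z b ≡ p → low z c ≡ p → windTriangle z a b c ≡ ℤ.+ 0
    same-level p la lb lc = add₃ (wind-level z a b la lb) (wind-level z b c lb lc) (wind-level z c a lc la)

  windTriangle-outside : ∀ {z a b c} → 0ℚ < orient a b c →
    orient a b z ≢ 0ℚ → orient b c z ≢ 0ℚ → orient c a z ≢ 0ℚ →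
    ¬ (0ℚ < orient a b z × 0ℚ < orient b c z × 0ℚ < orient c a z) → windTriangle z a b c ≡ ℤ.+ 0
  windTriangle-outside {z} {a} {b} {c} h n₁ n₂ n₃ out = go (low z a) (low z b) (low z c) refl refl refl
    where
    bca = subst (0ℚ <_) (orient-cyc a b c) h
    cab = subst (0ℚ <_) (orient-cyc b c a) bca
    atB : ∀ p → low z b ≡ p → low z c ≡ not p → low z a ≡ not p → windTriangle z a b c ≡ ℤ.+ 0
    atB p lb lc la = trans (windTriangle-cyc z a b c)
      (odd-one {z} {b} {c} {a} bca n₂ n₃ n₁ (λ (k₂ , k₃ , k₁) → out (k₁ , k₂ , k₃)) p lb lc la)
    atC : ∀ p → low z c ≡ p → low z a ≡ not p → low z b ≡ not p → windTriangle z a b c ≡ ℤ.+ 0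
    atC p lc la lb = trans (windTriangle-cyc z a b c) (trans (windTriangle-cyc z b c a)
      (odd-one {z} {c} {a} {b} cab n₃ n₁ n₂ (λ (k₃ , k₁ , k₂) → out (k₁ , k₂ , k₃)) p lc la lb))
    go : ∀ p q r → low z a ≡ p → low z b ≡ q → low z c ≡ r → windTriangle z a b c ≡ ℤ.+ 0
    go true true true la lb lc = same-level {z} {a} {b} {c} h n₁ n₂ n₃ out true la lb lc
    go false false false la lb lc = same-level {z} {a} {b} {c} h n₁ n₂ n₃ out false la lb lc
    go true false false la lb lc = odd-one {z} {a} {b} {c} h n₁ n₂ n₃ out true la lb lc
    go false true true la lb lc = odd-one {z} {a} {b} {c} h n₁ n₂ n₃ out false la lb lc
    go false true false la lb lc = atB true lb lc la
    go true false true la lb lc = atB false lb lc la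
    go false false true la lb lc = atC true lc la lb
    go true true false la lb lc = atC false lc la lb

-- The upper bound for points in the plane

module UpperBound where

  open import Defs
  open Orientations
  open Chords
  open ConvexPosition
  open CrowdedTriangles
  open WindingNumbers
  open import Data.Fin as Fin using (Fin)
  import Data.Fin.Properties as Finₚ
  open import Data.Integer as ℤ using (ℤ)
  import Data.Integer.Solver as ℤSolver
  open import Data.Nat as ℕ using (ℕ; zero; suc)
  import Data.Nat.Properties as ℕₚ
  open import Data.Rational using (0ℚ; _+_; _*_; _<_; negative)
  open import Data.Rational.Properties
  open import Data.Rational.Solver using (module +-*-Solver)
  open import Data.List.Properties using (length-map; length-tabulate; map-++; filter-accept; filter-reject)
  open import Data.List.Relation.Unary.Any using (index)
  import Data.List.Relation.Unary.Any.Properties as Any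

  open +-*-Solver using (solve; _:=_; _:+_; _:*_; _:-_; :-_; con)

  zip-map : {A B : Set} (f : A → B) → ∀ (xs ys : List A) →
    zip (map f xs) (map f ys) ≡ map (Product.map f f) (zip xs ys)
  zip-map f [] ys = refl
  zip-map f (x ∷ xs) [] = refl
  zip-map f (x ∷ xs) (y ∷ ys) = cong (_ ∷_) (zip-map f xs ys)

  edges-map : {A : Set} (f : A → Point) → ∀ xs → edges (map f xs) ≡ map (Product.map f f) (sides xs)
  edges-map f [] = refl
  edges-map f (v ∷ vs) = trans (cong (zip (map f (v ∷ vs))) (sym (map-++ f vs (v ∷ []))))
    (zip-map f (v ∷ vs) (vs ++ v ∷ []))

  lookup-∈ : {A : Set} → ∀ {xs : List A} {p} → p ∈ xs → ∃[ i ] (lookup xs i ≡ p)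
  lookup-∈ p∈ = index p∈ , sym (Any.lookup-index p∈)

  lookup-injective : {A : Set} → ∀ {xs : List A} → Unique xs → ∀ i j → lookup xs i ≡ lookup xs j → i ≡ j
  lookup-injective (_ ∷ _) Fin.zero Fin.zero _ = refl
  lookup-injective {xs = _ ∷ xs} (h ∷ _) Fin.zero (Fin.suc j) eq = ⊥-elim (All.lookup h (∈-lookup j) eq)
  lookup-injective {xs = _ ∷ xs} (h ∷ _) (Fin.suc i) Fin.zero eq = ⊥-elim (All.lookup h (∈-lookup i) (sym eq))
  lookup-injective (_ ∷ u) (Fin.suc i) (Fin.suc j) eq = cong Fin.suc (lookup-injective u i j eq)

  neg*neg : ∀ {a b} → a < 0ℚ → b < 0ℚ → ¬ (a * b < 0ℚ)
  neg*neg {a} {b} ha hb h = <-asym h (positive⁻¹ (a * b) {{neg*neg⇒pos a {{negative ha}} b {{negative hb}}}})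

  pos*pos : ∀ {a b} → 0ℚ < a → 0ℚ < b → ¬ (a * b < 0ℚ)
  pos*pos ha hb = <-asym (*-pos ha hb)

  module ReflexQuad {a b c p q : Point}
    (abc : 0ℚ < orient a b c) (abp : 0ℚ < orient a b p) (abq : 0ℚ < orient a b q)
    (bcp : 0ℚ < orient b c p) (bcq : 0ℚ < orient b c q) (qab : 0ℚ < orient q a b) (bca : 0ℚ < orient b c a)
    (bpq : 0ℚ < orient b p q) (bqa : 0ℚ < orient b q a)
    (cpq : orient c p q < 0ℚ) (pqa : orient p q a < 0ℚ) (cpa : orient c p a < 0ℚ) where

    P : List Point
    P = b ∷ c ∷ p ∷ q ∷ a ∷ []

    private
      NoCross : Point × Point → Point × Point → Set
      NoCross (u , v) (s , t) = u ≢ s → u ≢ t → v ≢ s → v ≢ t → ¬ Cross u v s t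

      uncrossed : All (λ e → All (NoCross e) (edges P)) (edges P)
      uncrossed =
          ((λ h _ _ _ _ → h refl) ∷ (λ _ _ h _ _ → h refl) ∷ (λ _ _ _ _ k → pos*pos bcp bcq (proj₁ k))
            ∷ (λ _ _ _ _ k → pos*pos bcq bca (proj₁ k)) ∷ (λ _ h _ _ _ → h refl) ∷ [])
        ∷ ((λ _ h _ _ _ → h refl) ∷ (λ h _ _ _ _ → h refl) ∷ (λ _ _ h _ _ → h refl)
            ∷ (λ _ _ _ _ k → neg*neg cpq cpa (proj₁ k)) ∷ (λ _ _ _ _ k → pos*pos abc abp (proj₂ k)) ∷ [])
        ∷ ((λ _ _ _ _ k → pos*pos bcp bcq (proj₂ k)) ∷ (λ _ h _ _ _ → h refl) ∷ (λ h _ _ _ _ → h refl)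
            ∷ (λ _ _ h _ _ → h refl) ∷ (λ _ _ _ _ k → pos*pos abp abq (proj₂ k)) ∷ [])
        ∷ ((λ _ _ _ _ k → pos*pos bcq bca (proj₂ k)) ∷ (λ _ _ _ _ k → neg*neg cpq cpa (proj₂ k))
            ∷ (λ _ h _ _ _ → h refl) ∷ (λ h _ _ _ _ → h refl) ∷ (λ _ _ h _ _ → h refl) ∷ [])
        ∷ ((λ _ _ h _ _ → h refl) ∷ (λ _ _ _ _ k → pos*pos abc abp (proj₁ k))
            ∷ (λ _ _ _ _ k → pos*pos abp abq (proj₁ k)) ∷ (λ _ h _ _ _ → h refl) ∷ (λ h _ _ _ _ → h refl) ∷ [])
        ∷ []

    simple : Simple P
    simple e f = All.lookup (All.lookup uncrossed e) f

    private
      convex? : ∀ (t : Point × Point × Point) → Dec (0ℚ < orient (proj₁ t) (proj₁ (proj₂ t)) (proj₂ (proj₂ t)))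
      convex? t = 0ℚ <? orient (proj₁ t) (proj₁ (proj₂ t)) (proj₂ (proj₂ t))

    three-corners : numConvexCorners P ≡ 3
    three-corners = cong length (
      trans (filter-accept convex? {x = b , c , p} bcp) (cong (_ ∷_) (
      trans (filter-reject convex? {x = c , p , q} (<-asym cpq)) (
      trans (filter-reject convex? {x = p , q , a} (<-asym pqa)) (
      trans (filter-accept convex? {x = q , a , b} qab) (cong (_ ∷_) (
      filter-accept convex? {x = a , b , c} abc)))))))

    area : 0ℚ < area2 P
    area = subst (0ℚ <_) (sym (fan-area b c p q a)) (+-pos (+-pos bcp bpq) bqa)
      where
      shoelace : ∀ {n} → (a b c d : +-*-Solver.Polynomial n) → +-*-Solver.Polynomial n
      shoelace ax ay bx by = (ax :* by) :- (bx :* ay)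
      abstract
        fan-area : ∀ b c p q a → area2 (b ∷ c ∷ p ∷ q ∷ a ∷ []) ≡ orient b c p + orient b p q + orient b q a
        fan-area (bx , by) (cx , cy) (px , py) (qx , qy) (ax , ay) =
          solve 10 (λ bx by cx cy px py qx qy ax ay →
            shoelace bx by cx cy :+ (shoelace cx cy px py :+ (shoelace px py qx qy :+
              (shoelace qx qy ax ay :+ (shoelace ax ay bx by :+ con 0ℚ)))) :=
            orientP bx by cx cy px py :+ orientP bx by px py qx qy :+ orientP bx by qx qy ax ay)
            refl bx by cx cy px py qx qy ax ay

    -- The diagonals `b p` and `b q` are inserted in both directions.
    fan-winding : ∀ z → winding P z ≡ windTriangle z b c p ℤ.+ windTriangle z b p q ℤ.+ windTriangle z b q a
    fan-winding z = trans
      (solveℤ 7 (λ w₁ w₂ w₃ w₄ w₅ u v → (w₁ ⊕ (w₂ ⊕ (w₃ ⊕ (w₄ ⊕ (w₅ ⊕ conℤ (ℤ.+ 0)))))) ≔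
          ((w₁ ⊕ w₂ ⊕ (⊝ u)) ⊕ (u ⊕ w₃ ⊕ (⊝ v)) ⊕ (v ⊕ w₄ ⊕ w₅)))
        refl (w b c) (w c p) (w p q) (w q a) (w a b) (w b p) (w b q))
      (cong₂ (λ r s → (w b c ℤ.+ w c p ℤ.+ r) ℤ.+ (w b p ℤ.+ w p q ℤ.+ s) ℤ.+ windTriangle z b q a)
        (sym (windContribution-anti z b p)) (sym (windContribution-anti z b q)))
      where
      w : Point → Point → ℤ
      w s t = windContribution z (s , t)
      open ℤSolver.+-*-Solver using () renaming (solve to solveℤ; _:+_ to _⊕_; :-_ to ⊝_; _:=_ to _≔_; con to conℤ)

  module FromPoints (S : List Point) (unique : Unique S) (gp : GeneralPosition S) where

    n = length S
    pos : Fin n → Point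
    pos = lookup S

    pos-injective : ∀ {i j} → pos i ≡ pos j → i ≡ j
    pos-injective = lookup-injective unique _ _

    pos∈ : ∀ i → pos i ∈ S
    pos∈ i = ∈-lookup i

    system : CCSystem (Fin n)
    system = orientation pos λ {a} {b} {c} x y z →
      gp (pos∈ a) (pos∈ b) (pos∈ c) (x ∘ pos-injective) (y ∘ pos-injective) (z ∘ pos-injective)

    open Planar system
    open Finite Finₚ._≟_ (allFin n) ∈-allFin

    nonzero : ∀ {a b c} → a ≢ b → b ≢ c → a ≢ c → orient (pos a) (pos b) (pos c) ≢ 0ℚ
    nonzero {a} {b} {c} x y z = gp (pos∈ a) (pos∈ b) (pos∈ c) (x ∘ pos-injective) (y ∘ pos-injective) (z ∘ pos-injective)

    to-hole : ∀ {H k} → Hole H → length H ≡ 3 ℕ.+ k → HasHole (3 ℕ.+ k) S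
    to-hole {v ∷ w ∷ vs} hH len = map pos (v ∷ w ∷ vs) , trans (length-map pos (v ∷ w ∷ vs)) len ,
      (Unique.map⁺ pos-injective (Hole.unique hH) , All.map⁺ (All.tabulate λ {i} _ → pos∈ i)) , convexCCW , empty
      where
      H = v ∷ w ∷ vs
      convexCCW : ConvexCCW (map pos H)
      convexCCW {s} {t} e∈ z∈ z≢a z≢b with ∈-map⁻ (Product.map pos pos) (subst ((s , t) ∈_) (edges-map pos H) e∈) | ∈-map⁻ pos z∈
      ... | (a , b) , ab∈ , refl | c , c∈ , refl with rotateTo ab∈
      ...   | R , as , bs , eq , eq′ with on-side {a} {b} {R} {c} (subst conv (sym eq′) (conv-rotate as (subst conv eq (Hole.convex hH))))
                (subst (c ∈_) (sym eq′) (∈-rotate as (subst (c ∈_) eq c∈)))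
      ...     | inj₁ (inj₁ refl) = ⊥-elim (z≢a refl)
      ...     | inj₁ (inj₂ refl) = ⊥-elim (z≢b refl)
      ...     | inj₂ h = h
      empty : ∀ {p} → p ∈ S → ¬ InConvexInterior (map pos H) p
      empty p∈ inside with lookup-∈ p∈
      ... | i , refl = hole-no-interior {p = i} hH λ {a} {b} ab∈ →
            inside (subst ((pos a , pos b) ∈_) (sym (edges-map pos H)) (∈-map⁺ (Product.map pos pos) ab∈))
    to-hole {[]} _ ()
    to-hole {_ ∷ []} _ ()

    to-pseudoTriangle : Crowded.Pentagon system Finₚ._≟_ (allFin n) ∈-allFin → HasEmptyPseudoTriangle 5 S
    to-pseudoTriangle P = Quad.P , (uniq , pos∈ _ ∷ pos∈ _ ∷ pos∈ _ ∷ pos∈ _ ∷ pos∈ _ ∷ []) ,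
      (refl , Quad.simple , Quad.area , Quad.three-corners) , outside
      where
      open Crowded.Pentagon P
      abc = int p∈
      bca = cyc abc
      bpa : L b p a
      bpa = cyc (proj₁ p∈)
      bcp = proj₁ (proj₂ p∈)
      bcq = proj₁ (proj₂ q∈)
      bqa = cyc (proj₁ q∈)
      qab = cyc bqa
      -- The chain `c p q a` turns right at `p` and at `q`, so `a` is on the same side of the line
      -- `c p` as `q`. This keeps the edges `c p` and `q a` from crossing.
      pca : L p c a
      pca = cochainˡ bcp bpq bpa bca pcq qpa
      module Quad = ReflexQuad {pos a} {pos b} {pos c} {pos p} {pos q}
        abc (proj₁ p∈) (proj₁ q∈) bcp bcq qab bca bpq bqa
        (left-anti {pos p} {pos c} {pos q} pcq) (left-anti {pos q} {pos p} {pos a} qpa) (left-anti {pos p} {pos c} {pos a} pca)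
      uniq : Unique Quad.P
      uniq = Unique.map⁺ pos-injective
        ((≢₁₂ bcp ∷ ≢₁₃ bcp ∷ ≢₁₃ bcq ∷ ≢₁₃ bca ∷ []) ∷ (≢₂₃ bcp ∷ ≢₂₃ bcq ∷ ≢₂₃ bca ∷ []) ∷
         (≢₂₃ bpq ∷ ≢₂₃ bpa ∷ []) ∷ (≢₂₃ bqa ∷ []) ∷ [] ∷ [])
      outside : ∀ {z} → z ∈ S → ¬ InInterior Quad.P z
      outside z∈ (z∉ , w≢0) with lookup-∈ z∈
      ... | i , refl = w≢0 (trans (Quad.fan-winding (pos i))
          (add₃ (zero-in bcp fan₁ z≢b z≢c z≢p) (zero-in bpq fan₂ z≢b z≢p z≢q) (zero-in bqa fan₃ z≢b z≢q z≢a)))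
        where
        z≢b : i ≢ b
        z≢b refl = z∉ (here refl)
        z≢c : i ≢ c
        z≢c refl = z∉ (there (here refl))
        z≢p : i ≢ p
        z≢p refl = z∉ (there (there (here refl)))
        z≢q : i ≢ q
        z≢q refl = z∉ (there (there (there (here refl))))
        z≢a : i ≢ a
        z≢a refl = z∉ (there (there (there (there (here refl)))))
        zero-in : ∀ {u v w} → L u v w → NoneIn u v w → i ≢ u → i ≢ v → i ≢ w →
          windTriangle (pos i) (pos u) (pos v) (pos w) ≡ ℤ.+ 0
        zero-in {u} {v} {w} uvw none nu nv nw = windTriangle-outside {pos i} {pos u} {pos v} {pos w} uvw
          (nonzero (≢₁₂ uvw) (≢-sym nv) (≢-sym nu)) (nonzero (≢₂₃ uvw) (≢-sym nw) (≢-sym nv))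
          (nonzero (≢-sym (≢₁₃ uvw)) (≢-sym nu) (≢-sym nw)) (none {i})

    hole-or-pseudoTriangle : ∀ j → G (2 ℕ.+ j) ℕ.< n → HasHole (3 ℕ.+ j) S ⊎ HasEmptyPseudoTriangle 5 S
    hole-or-pseudoTriangle j many with
      search (λ a → search λ b → search λ c → search λ p → search λ q → In? a b c p ×-dec In? a b c q ×-dec ¬? (p Finₚ.≟ q))
    ... | yes (a , b , c , p , q , p∈ , q∈ , ne) =
      inj₂ (to-pseudoTriangle (Crowded.pentagon system Finₚ._≟_ (allFin n) ∈-allFin _ a b c ℕₚ.≤-refl p∈ q∈ ne))
    ... | no sparse = inj₁ (let H , hH , len = holes j (subst (G (2 ℕ.+ j) ℕ.<_) (sym (length-tabulate {n = n} (λ i → i))) many) in to-hole hH len)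
      where
      open Sparse Finₚ._≟_ (allFin n) ∈-allFin (Unique.allFin⁺ n)
        (λ {a} {b} {c} {p} {q} p∈ q∈ → decidable-stable (p Finₚ.≟ q) λ ne → sparse (a , b , c , p , q , p∈ , q∈ , ne))

  forces : ∀ j → Forces (3 ℕ.+ j) 5 (suc (G (2 ℕ.+ j)))
  forces j S unique gp many = FromPoints.hole-or-pseudoTriangle S unique gp j many

-- The doubling step in terms of signs

module Doublings where

  import Data.Bool.Properties as Bool
  open Orientations
  open Chords
  open ConvexPosition
  open import Data.Nat as ℕ using (ℕ; suc; _+_; _≤_; z≤n; s≤s)
  import Data.Nat.Properties as ℕₚ

  module _ {A : Set} (C : CCSystem A) where
    open Planar C

    SparseTriangles : Set
    SparseTriangles = ∀ {a b c p q} → In a b c p → In a b c q → p ≡ q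

    HullTriangles : {B : Set} → (B → A) → Set
    HullTriangles ι = ∀ {a b c} → a ≢ b → b ≢ c → a ≢ c →
      ∃[ p ] (In (ι a) (ι b) (ι c) p ⊎ In (ι b) (ι a) (ι c) p)

    -- Stated for free lists in any order, so that the old points and the children of a list can be
    -- bounded separately.
    FreeBound : ℕ → Set
    FreeBound K = ∀ {Q} → Unique Q → Free Q → length Q ≤ K

  parentOf : {A B : Set} → (B → A) → A ⊎ B × Bool → A
  parentOf ι (inj₁ a) = a
  parentOf ι (inj₂ (b , _)) = ι b

  -- Every point ι b is given two children, pushed to both sides along a supporting line and outwards.
  module Doubling {A B : Set} (C : CCSystem A) (ι : B → A) (ι-injective : ∀ {b c} → ι b ≡ ι c → b ≡ c)
    (_≟_ : ∀ (a b : A) → Dec (a ≡ b)) (D : CCSystem (A ⊎ B × Bool)) where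

    module P = Planar C
    open Planar D

    A′ = A ⊎ B × Bool

    old : A → A′
    old = inj₁

    before after : B → A′
    before b = inj₂ (b , false)
    after b = inj₂ (b , true)

    parent : A′ → A
    parent = parentOf ι

    -- All that the doubling requires of the coordinates. Call an old point with its children a
    -- cluster: different clusters are oriented as their parents, all points outside a cluster lie
    -- left of the three lines within it, and the old point lies on the inner side of the line
    -- through its children.
    module Signs
      (lift : ∀ {u v w} → parent u ≢ parent v → parent v ≢ parent w → parent u ≢ parent w →
        P.L (parent u) (parent v) (parent w) → L u v w)
      (before-old : ∀ {b z} → parent z ≢ ι b → L (before b) (old (ι b)) z)
      (old-after : ∀ {b z} → parent z ≢ ι b → L (old (ι b)) (after b) z)
      (before-after : ∀ {b z} → parent z ≢ ι b → L (before b) (after b) z)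
      (old-inside : ∀ {b} → L (before b) (after b) (old (ι b))) where

      descend : ∀ {u v w} → parent u ≢ parent v → parent v ≢ parent w → parent u ≢ parent w →
        L u v w → P.L (parent u) (parent v) (parent w)
      descend p q r h = [ (λ k → k) , (λ k → ⊥-elim (asym h (lift (≢-sym p) r q k))) ]′ (P.tot p q r)

      supporting : ∀ {b z} → z ≢ before b → z ≢ after b → L (before b) (after b) z
      supporting {b} {z} n₁ n₂ with parent z ≟ ι b
      ... | no ne = before-after ne
      supporting {b} {inj₁ a} n₁ n₂ | yes refl = old-inside
      supporting {b} {inj₂ (c , s)} n₁ n₂ | yes eq with ι-injective eq
      supporting {b} {inj₂ (c , false)} n₁ n₂ | yes eq | refl = ⊥-elim (n₁ refl)
      supporting {b} {inj₂ (c , true)} n₁ n₂ | yes eq | refl = ⊥-elim (n₂ refl)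

      _≟child_ : ∀ (z : A′) (c : B × Bool) → Dec (z ≡ inj₂ c)
      inj₁ a ≟child c = no λ ()
      inj₂ (b , s) ≟child (c , t) with ι b ≟ ι c | s Bool.≟ t
      ... | yes eq | yes refl = yes (cong (λ d → inj₂ (d , s)) (ι-injective eq))
      ... | no ne | _ = no λ { refl → ne refl }
      ... | _ | no ne = no λ { refl → ne refl }

      -- The line through two twins supports the whole set, whereas an interior point of a triangle
      -- would be strictly to its left.
      child-outside : ∀ {u v w b s} → ¬ In u v w (inj₂ (b , s))
      child-outside {b = b} {s} i = on-line s (In-left (place _) (place _) (place _) i)
        where
        place : ∀ z → OnOrLeft (before b) (after b) z
        place z with z ≟child (b , false) | z ≟child (b , true)
        ... | yes p | _ = inj₁ (inj₁ p)
        ... | _ | yes p = inj₁ (inj₂ p)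
        ... | no p | no q = inj₂ (supporting p q)
        on-line : ∀ s → ¬ L (before b) (after b) (inj₂ (b , s))
        on-line false h = ≢₁₃ h refl
        on-line true h = ≢₂₃ h refl

      parent-outside : ∀ {u v w} → parent v ≢ parent u → parent w ≢ parent u → ¬ In u v w (old (parent u))
      parent-outside {inj₁ a} _ _ (_ , _ , h) = ≢₂₃ h refl
      parent-outside {inj₂ (b , true)} {v} {w} nv nw (_ , _ , h) = asym (old-after nw) (cyc h)
      parent-outside {inj₂ (b , false)} {v} {w} nv nw (h , _ , _) = asym₂₃ (before-old nv) h

      old-cluster : ∀ {x v w a} → x ≡ parent v → parent v ≡ parent w → a ≢ x → ¬ In (old x) v w (old a)
      old-cluster {x} {inj₁ y} refl _ _ i = ≢₁₂ (int i) refl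
      old-cluster {x} {inj₂ _} {inj₁ z} refl refl _ i = ≢₁₃ (int i) refl
      old-cluster {x} {inj₂ (b , s)} {inj₂ (c , t)} refl eq ne i with ι-injective eq
      old-cluster {x} {inj₂ (b , true)} {inj₂ (b , true)} refl eq ne i | refl = ≢₂₃ (int i) refl
      old-cluster {x} {inj₂ (b , false)} {inj₂ (b , false)} refl eq ne i | refl = ≢₂₃ (int i) refl
      old-cluster {x} {inj₂ (b , true)} {inj₂ (b , false)} refl eq ne (_ , h , _) | refl = asym (before-after ne) h
      old-cluster {x} {inj₂ (b , false)} {inj₂ (b , true)} refl eq ne (h , _ , _) | refl = asym (before-old ne) h

      cluster-outside : ∀ {u v w a} → parent u ≡ parent v → parent v ≡ parent w → a ≢ parent u → ¬ In u v w (old a)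
      cluster-outside {inj₁ x} e f ne i = old-cluster e f ne i
      cluster-outside {inj₂ c} {inj₁ y} {w} e f ne i =
        old-cluster {y} {w} {inj₂ c} f (sym (trans e f)) (λ k → ne (trans k (sym e))) (In-cyc i)
      cluster-outside {inj₂ c} {inj₂ d} {inj₁ z} e f ne i =
        old-cluster {z} {inj₂ c} {inj₂ d} (sym (trans e f)) e (λ k → ne (trans k (sym (trans e f)))) (In-cyc (In-cyc i))
      cluster-outside {inj₂ (b , s)} {inj₂ (c , t)} {inj₂ (d , r)} e f ne i with ι-injective e | ι-injective f
      ... | refl | refl = pigeon s t r i
        where
        pigeon : ∀ {p} s t r → ¬ In (inj₂ (b , s)) (inj₂ (b , t)) (inj₂ (b , r)) p
        pigeon true true _ i = ≢₁₂ (int i) refl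
        pigeon false false _ i = ≢₁₂ (int i) refl
        pigeon true false true i = ≢₁₃ (int i) refl
        pigeon false true false i = ≢₁₃ (int i) refl
        pigeon true false false i = ≢₂₃ (int i) refl
        pigeon false true true i = ≢₂₃ (int i) refl

      In-descend : ∀ {u v w a} → parent u ≢ parent v → parent v ≢ parent w → parent u ≢ parent w →
        In u v w (old a) → P.In (parent u) (parent v) (parent w) a
      In-descend {u} {v} {w} {a} uv vw uw i@(h , k , l) =
        descend uv va ua h , descend vw wa va k , descend (≢-sym uw) ua wa l
        where
        ua : parent u ≢ a
        ua refl = parent-outside {u} (≢-sym uv) (≢-sym uw) i
        va : parent v ≢ a
        va refl = parent-outside {v} (≢-sym vw) uv (In-cyc i)
        wa : parent w ≢ a
        wa refl = parent-outside {w} uw vw (In-cyc (In-cyc i))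

      -- Seen from the cluster of `w`, a point `a` of another cluster has `u` and `v` on the same
      -- side, for both are oriented like their common parent. It therefore cannot lie between them.
      pair-only : ∀ {u v w a} → parent u ≡ parent v → parent v ≢ parent w → In u v w (old a) → a ≡ parent u
      pair-only {u} {v} {w} {a} uv vw i@(_ , k , l) with a ≟ parent u
      ... | yes eq = eq
      ... | no ne = ⊥-elim (P.asym (descend vw wa (λ eq → ne (trans (sym eq) (sym uv))) k)
          (subst (λ t → P.L (parent w) t a) uv (descend (λ eq → vw (trans (sym uv) (sym eq))) (≢-sym ne) wa l)))
        where
        wa : parent w ≢ a
        wa refl = parent-outside {w} (λ eq → vw (trans (sym uv) eq)) vw (In-cyc (In-cyc i))

      -- Over three clusters, a triangle contains only points from the triangle of the parents; if a
      -- cluster repeats, it contains at most the old point of that cluster.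
      sparse′ : SparseTriangles C → SparseTriangles D
      sparse′ sp {p = inj₂ _} i _ = ⊥-elim (child-outside i)
      sparse′ sp {p = inj₁ _} {inj₂ _} _ j = ⊥-elim (child-outside j)
      sparse′ sp {u} {v} {w} {inj₁ p} {inj₁ q} i j with parent u ≟ parent v | parent v ≟ parent w | parent u ≟ parent w
      ... | no uv | no vw | no uw = cong old (sp (In-descend uv vw uw i) (In-descend uv vw uw j))
      ... | yes uv | no vw | _ = cong old (trans (pair-only uv vw i) (sym (pair-only uv vw j)))
      ... | no uv | yes vw | _ = cong old (trans (pair-only vw wu (In-cyc i)) (sym (pair-only vw wu (In-cyc j))))
        where
        wu : parent w ≢ parent u
        wu eq = uv (trans (sym eq) (sym vw))
      ... | no uv | no _ | yes uw = cong old (trans (pair-only (sym uw) uv (In-cyc (In-cyc i)))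
                                               (sym (pair-only (sym uw) uv (In-cyc (In-cyc j)))))
      ... | yes uv | yes vw | _ = cong old (trans (mine p i) (sym (mine q j)))
        where
        mine : ∀ a → In u v w (old a) → a ≡ parent u
        mine a k with a ≟ parent u
        ... | yes eq = eq
        ... | no ne = ⊥-elim (cluster-outside uv vw ne k)

      Split : A′ → A′ → A′ → Set
      Split u v w = ∃[ p ] (In u v w p ⊎ In v u w p)

      Split-cyc : ∀ {u v w} → Split v w u → Split u v w
      Split-cyc (p , inj₁ i) = p , inj₁ (In-cyc (In-cyc i))
      Split-cyc (p , inj₂ i) = p , inj₂ (In-cyc i)

      twins : ∀ {b s t c r} → (b , s) ≢ (b , t) → b ≢ c → Split (inj₂ (b , s)) (inj₂ (b , t)) (inj₂ (c , r))
      twins {s = true} {true} ne _ = ⊥-elim (ne refl)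
      twins {s = false} {false} ne _ = ⊥-elim (ne refl)
      twins {b} {false} {true} _ ne = old (ι b) , inj₁ (old-inside , cyc (old-after away) , cyc² (before-old away))
        where away = λ eq → ne (sym (ι-injective eq))
      twins {b} {true} {false} _ ne = old (ι b) , inj₂ (old-inside , cyc (old-after away) , cyc² (before-old away))
        where away = λ eq → ne (sym (ι-injective eq))

      -- Three different parents pass on the point in their triangle; twins enclose their parent
      -- together with any child from elsewhere.
      hullTriangles′ : HullTriangles C ι → HullTriangles D inj₂
      hullTriangles′ ht {b , s} {c , t} {d , r} n₁ n₂ n₃ with ι b ≟ ι c | ι c ≟ ι d | ι b ≟ ι d
      ... | no bc | no cd | no bd with ht (bc ∘ cong ι) (cd ∘ cong ι) (bd ∘ cong ι)
      ...   | p , inj₁ i = old p , inj₁ (In-lift bc cd bd i)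
        where
        In-lift : ∀ {u v w p} → parent u ≢ parent v → parent v ≢ parent w → parent u ≢ parent w →
          P.In (parent u) (parent v) (parent w) p → In u v w (old p)
        In-lift uv vw uw (h , k , l) = lift uv (P.≢₂₃ h) (P.≢₁₃ h) h , lift vw (P.≢₂₃ k) (P.≢₁₃ k) k ,
          lift (≢-sym uw) (P.≢₂₃ l) (P.≢₁₃ l) l
      ...   | p , inj₂ (h , k , l) = old p , inj₂ (lift (≢-sym bc) (P.≢₂₃ h) (P.≢₁₃ h) h ,
              lift bd (P.≢₂₃ k) (P.≢₁₃ k) k , lift (≢-sym cd) (P.≢₂₃ l) (P.≢₁₃ l) l)
      hullTriangles′ ht {b , s} {c , t} {d , r} n₁ n₂ n₃ | yes bc | no cd | _ with ι-injective bc
      ... | refl = twins (n₁) (cd ∘ cong ι)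
      hullTriangles′ ht {b , s} {c , t} {d , r} n₁ n₂ n₃ | no bc | yes cd | _ with ι-injective cd
      ... | refl = Split-cyc (twins n₂ (bc ∘ sym ∘ cong ι))
      hullTriangles′ ht {b , s} {c , t} {d , r} n₁ n₂ n₃ | no bc | no cd | yes bd with ι-injective bd
      ... | refl = Split-cyc (Split-cyc (twins (≢-sym n₃) (bc ∘ cong ι)))
      hullTriangles′ ht {b , s} {c , t} {d , r} n₁ n₂ n₃ | yes bc | yes cd | _ with ι-injective bc | ι-injective cd
      ... | refl | refl = ⊥-elim (pigeon s t r n₁ n₂ n₃)
        where
        pigeon : ∀ s t r → (b , s) ≢ (b , t) → (b , t) ≢ (b , r) → (b , s) ≢ (b , r) → ⊥
        pigeon true true _ h _ _ = h refl
        pigeon false false _ h _ _ = h refl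
        pigeon true false true _ _ h = h refl
        pigeon false true false _ _ h = h refl
        pigeon true false false _ h _ = h refl
        pigeon false true true _ h _ = h refl

      olds : List A′ → List A
      olds [] = []
      olds (inj₁ a ∷ Q) = a ∷ olds Q
      olds (inj₂ _ ∷ Q) = olds Q

      children : List A′ → List (B × Bool)
      children [] = []
      children (inj₁ _ ∷ Q) = children Q
      children (inj₂ c ∷ Q) = c ∷ children Q

      length-split : ∀ Q → length Q ≡ length (children Q) + length (olds Q)
      length-split [] = refl
      length-split (inj₁ a ∷ Q) = trans (cong suc (length-split Q)) (sym (ℕₚ.+-suc (length (children Q)) (length (olds Q))))
      length-split (inj₂ _ ∷ Q) = cong suc (length-split Q)

      ∈-olds : ∀ {a} Q → a ∈ olds Q → old a ∈ Q
      ∈-olds (inj₁ _ ∷ Q) (here refl) = here refl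
      ∈-olds (inj₁ _ ∷ Q) (there m) = there (∈-olds Q m)
      ∈-olds (inj₂ _ ∷ Q) m = there (∈-olds Q m)

      ∈-children : ∀ {c} Q → c ∈ children Q → inj₂ c ∈ Q
      ∈-children (inj₁ _ ∷ Q) m = there (∈-children Q m)
      ∈-children (inj₂ _ ∷ Q) (here refl) = here refl
      ∈-children (inj₂ _ ∷ Q) (there m) = there (∈-children Q m)

      olds-unique : ∀ Q → Unique Q → Unique (olds Q)
      olds-unique [] _ = []
      olds-unique (inj₁ a ∷ Q) (h ∷ u) = All.tabulate (λ m eq → All.lookup h (∈-olds Q m) (cong inj₁ eq)) ∷ olds-unique Q u
      olds-unique (inj₂ _ ∷ Q) (_ ∷ u) = olds-unique Q u

      children-unique : ∀ Q → Unique Q → Unique (children Q)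
      children-unique [] _ = []
      children-unique (inj₁ _ ∷ Q) (_ ∷ u) = children-unique Q u
      children-unique (inj₂ c ∷ Q) (h ∷ u) = All.tabulate (λ m eq → All.lookup h (∈-children Q m) (cong inj₂ eq)) ∷ children-unique Q u

      freeBound′ : ∀ {K} → HullTriangles C ι → FreeBound C K → FreeBound D (2 + K)
      freeBound′ ht fb {Q} u free = subst (_≤ _) (sym (length-split Q))
        (ℕₚ.+-mono-≤ (few (children Q) (children-unique Q u) (∈-children Q))
          (fb (olds-unique Q u) λ {a} {b} {c} {p} a∈ b∈ c∈ (h , k , l) →
            free (∈-olds Q a∈) (∈-olds Q b∈) (∈-olds Q c∈) (same h , same k , same l)))
        where
        same : ∀ {a b c} → P.L a b c → L (old a) (old b) (old c)
        same h = lift (P.≢₁₂ h) (P.≢₂₃ h) (P.≢₁₃ h) h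
        few : ∀ cs → Unique cs → (∀ {c} → c ∈ cs → inj₂ c ∈ Q) → length cs ≤ 2
        few [] _ _ = z≤n
        few (_ ∷ []) _ _ = s≤s z≤n
        few (_ ∷ _ ∷ []) _ _ = s≤s (s≤s z≤n)
        few (c ∷ d ∷ e ∷ _) ((cd ∷ ce ∷ _) ∷ (de ∷ _) ∷ _) sub with hullTriangles′ ht cd de ce
        ... | p , inj₁ i = ⊥-elim (free (sub (here refl)) (sub (there (here refl))) (sub (there (there (here refl)))) i)
        ... | p , inj₂ i = ⊥-elim (free (sub (there (here refl))) (sub (here refl)) (sub (there (there (here refl)))) i)

-- Sign conditions for small parameters

module Germs where

  open import Defs
  open Orientations
  open import Data.Rational using (ℚ; 0ℚ; 1ℚ; _+_; _*_; _-_; -_; _<_; _≤_; ∣_∣; 1/_; _⊓_; positive; nonNegative; NonZero)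
  open import Data.Rational.Properties
  open import Data.Rational.Solver using (module +-*-Solver)

  open +-*-Solver using (solve; _:=_; _:+_; _:*_; _:-_; :-_; con)

  Eventually : (ℚ → Set) → Set
  Eventually P = ∃[ δ ] (0ℚ < δ × (∀ ε → 0ℚ < ε → ε ≤ δ → P ε))

  ev-map : ∀ {P Q} → (∀ ε → 0ℚ < ε → P ε → Q ε) → Eventually P → Eventually Q
  ev-map f (δ , pos , h) = δ , pos , λ ε e l → f ε e (h ε e l)

  ev-true : ∀ {P : ℚ → Set} → (∀ ε → P ε) → Eventually P
  ev-true h = 1ℚ , positive⁻¹ 1ℚ , λ ε _ _ → h ε

  ev-× : ∀ {P Q} → Eventually P → Eventually Q → Eventually (λ ε → P ε × Q ε)
  ev-× (δ , pos , h) (δ′ , pos′ , h′) = δ ⊓ δ′ , least , λ ε e l →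
    h ε e (≤-trans l (p⊓q≤p δ δ′)) , h′ ε e (≤-trans l (p⊓q≤q δ δ′))
    where
    least : 0ℚ < δ ⊓ δ′
    least with ≤-total δ δ′
    ... | inj₁ le = subst (0ℚ <_) (sym (p≤q⇒p⊓q≡p le)) pos
    ... | inj₂ le = subst (0ℚ <_) (sym (p≥q⇒p⊓q≡q le)) pos′

  ev-all : {A : Set} {P : A → ℚ → Set} → ∀ xs → (∀ x → Eventually (P x)) → Eventually (λ ε → ∀ {x} → x ∈ xs → P x ε)
  ev-all [] h = ev-true λ _ ()
  ev-all (x ∷ xs) h = ev-map (λ ε _ → λ { (p , ps) (here refl) → p ; (p , ps) (there m) → ps m }) (ev-× (h x) (ev-all xs h))

  -- `f ε` = `c` + O(ε) with an explicit constant on 0 < ε ≤ 1. Unlike mere continuity, this linear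
  -- estimate passes through sums and products by computing a new constant.
  record Germ (f : ℚ → ℚ) (c : ℚ) : Set where
    field
      bound : ℚ
      0≤bound : 0ℚ ≤ bound
      close : ∀ ε → 0ℚ < ε → ε ≤ 1ℚ → ∣ f ε - c ∣ ≤ ε * bound
  open Germ

  *-mono-≤-nonNeg : ∀ {a b c d} → 0ℚ ≤ a → a ≤ b → 0ℚ ≤ c → c ≤ d → a * c ≤ b * d
  *-mono-≤-nonNeg {a} {b} {c} {d} 0≤a ab 0≤c cd =
    ≤-trans (*-monoʳ-≤-nonNeg c {{nonNegative 0≤c}} ab) (*-monoˡ-≤-nonNeg b {{nonNegative (≤-trans 0≤a ab)}} cd)

  germ-const : ∀ c → Germ (λ _ → c) c
  germ-const c = record { bound = 0ℚ ; 0≤bound = ≤-refl ; close = λ ε _ _ →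
    ≤-reflexive (trans (cong ∣_∣ (+-inverseʳ c)) (sym (*-zeroʳ ε))) }

  germ-id : Germ (λ ε → ε) 0ℚ
  germ-id = record { bound = 1ℚ ; 0≤bound = <⇒≤ (positive⁻¹ 1ℚ) ; close = λ ε e _ →
    ≤-reflexive (trans (cong ∣_∣ (+-identityʳ ε)) (trans (0≤p⇒∣p∣≡p (<⇒≤ e)) (sym (*-identityʳ ε)))) }

  germ-+ : ∀ {f g c d} → Germ f c → Germ g d → Germ (λ ε → f ε + g ε) (c + d)
  germ-+ {f} {g} {c} {d} F G = record { bound = bound F + bound G ; 0≤bound = +-nonNeg (0≤bound F) (0≤bound G)
    ; close = λ ε e l → begin
        ∣ (f ε + g ε) - (c + d) ∣
          ≡⟨ cong ∣_∣ (solve 4 (λ x y c d → (x :+ y) :- (c :+ d) := (x :- c) :+ (y :- d)) refl (f ε) (g ε) c d) ⟩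
        ∣ (f ε - c) + (g ε - d) ∣ ≤⟨ ∣p+q∣≤∣p∣+∣q∣ (f ε - c) (g ε - d) ⟩
        ∣ f ε - c ∣ + ∣ g ε - d ∣ ≤⟨ +-mono-≤ (close F ε e l) (close G ε e l) ⟩
        ε * bound F + ε * bound G ≡⟨ *-distribˡ-+ ε (bound F) (bound G) ⟨
        ε * (bound F + bound G) ∎ }
    where open ≤-Reasoning

  germ-neg : ∀ {f c} → Germ f c → Germ (λ ε → - f ε) (- c)
  germ-neg {f} {c} F = record { bound = bound F ; 0≤bound = 0≤bound F ; close = λ ε e l →
    subst (_≤ ε * bound F) (sym (trans (cong ∣_∣ (sym (neg-distrib-+ (f ε) (- c)))) (∣-p∣≡∣p∣ (f ε - c)))) (close F ε e l) }

  germ-* : ∀ {f g c d} → Germ f c → Germ g d → Germ (λ ε → f ε * g ε) (c * d)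
  germ-* {f} {g} {c} {d} F G = record
    { bound = bound F * (∣ d ∣ + bound G) + ∣ c ∣ * bound G
    ; 0≤bound = +-nonNeg (*-nonNeg (0≤bound F) (+-nonNeg (0≤∣p∣ d) (0≤bound G))) (*-nonNeg (0≤∣p∣ c) (0≤bound G))
    ; close = λ ε e l → begin
        ∣ f ε * g ε - c * d ∣
          ≡⟨ cong ∣_∣ (solve 4 (λ x y c d → x :* y :- c :* d := (x :- c) :* y :+ c :* (y :- d)) refl (f ε) (g ε) c d) ⟩
        ∣ (f ε - c) * g ε + c * (g ε - d) ∣ ≤⟨ ∣p+q∣≤∣p∣+∣q∣ ((f ε - c) * g ε) (c * (g ε - d)) ⟩
        ∣ (f ε - c) * g ε ∣ + ∣ c * (g ε - d) ∣ ≡⟨ cong₂ _+_ (∣p*q∣≡∣p∣*∣q∣ (f ε - c) (g ε)) (∣p*q∣≡∣p∣*∣q∣ c (g ε - d)) ⟩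
        ∣ f ε - c ∣ * ∣ g ε ∣ + ∣ c ∣ * ∣ g ε - d ∣
          ≤⟨ +-mono-≤ (*-mono-≤-nonNeg (0≤∣p∣ _) (close F ε e l) (0≤∣p∣ _) (size ε e l))
                      (*-monoˡ-≤-nonNeg (∣ c ∣) {{nonNegative (0≤∣p∣ c)}} (close G ε e l)) ⟩
        ε * bound F * (∣ d ∣ + bound G) + ∣ c ∣ * (ε * bound G)
          ≡⟨ solve 5 (λ e b d g c → e :* b :* (d :+ g) :+ c :* (e :* g) := e :* (b :* (d :+ g) :+ c :* g)) refl ε (bound F) (∣ d ∣) (bound G) (∣ c ∣) ⟩
        ε * (bound F * (∣ d ∣ + bound G) + ∣ c ∣ * bound G) ∎ }
    where
    open ≤-Reasoning
    size : ∀ ε → 0ℚ < ε → ε ≤ 1ℚ → ∣ g ε ∣ ≤ ∣ d ∣ + bound G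
    size ε e l = begin
      ∣ g ε ∣ ≡⟨ cong ∣_∣ (solve 2 (λ x d → x := d :+ (x :- d)) refl (g ε) d) ⟩
      ∣ d + (g ε - d) ∣ ≤⟨ ∣p+q∣≤∣p∣+∣q∣ d (g ε - d) ⟩
      ∣ d ∣ + ∣ g ε - d ∣ ≤⟨ +-monoʳ-≤ (∣ d ∣) (close G ε e l) ⟩
      ∣ d ∣ + ε * bound G ≤⟨ +-monoʳ-≤ (∣ d ∣) (*-monoʳ-≤-nonNeg (bound G) {{nonNegative (0≤bound G)}} l) ⟩
      ∣ d ∣ + 1ℚ * bound G ≡⟨ cong (∣ d ∣ +_) (*-identityˡ (bound G)) ⟩
      ∣ d ∣ + bound G ∎

  ∣p∣-lower : ∀ p → - ∣ p ∣ ≤ p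
  ∣p∣-lower p with ≤-total 0ℚ p
  ... | inj₁ h = ≤-trans (neg-antimono-≤ (0≤∣p∣ p)) h
  ... | inj₂ h = ≤-reflexive (trans (cong -_ (trans (sym (∣-p∣≡∣p∣ p)) (0≤p⇒∣p∣≡p (neg-antimono-≤ h)))) (neg-involutive p))
    where
    neg-involutive : ∀ q → - - q ≡ q
    neg-involutive = solve 1 (λ q → :- (:- q) := q) refl

  germ-positive : ∀ {f c} → Germ f c → 0ℚ < c → Eventually (λ ε → 0ℚ < f ε)
  germ-positive {f} {c} F 0<c = δ ⊓ 1ℚ , least , λ ε e l → begin-strict
      0ℚ ≡⟨ +-inverseʳ (ε * b) ⟨
      ε * b - ε * b <⟨ +-monoˡ-< (- (ε * b)) (small ε e (≤-trans l (p⊓q≤p δ 1ℚ))) ⟩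
      c - ε * b ≤⟨ +-monoʳ-≤ c (≤-trans (neg-antimono-≤ (close F ε e (≤-trans l (p⊓q≤q δ 1ℚ)))) (∣p∣-lower (f ε - c))) ⟩
      c + (f ε - c) ≡⟨ solve 2 (λ c x → c :+ (x :- c) := x) refl c (f ε) ⟩
      f ε ∎
    where
    open ≤-Reasoning
    b = bound F
    s = b + c
    0<s : 0ℚ < s
    0<s = +-mono-≤-< (0≤bound F) 0<c
    instance
      s-pos = positive 0<s
      s≢0 : NonZero s
      s≢0 = pos⇒nonZero s
    -- For 0 < ε ≤ `c` / (`b` + `c`) one has ε `b` < ε (`b` + `c`) ≤ `c`; the summand `c` keeps the
    -- denominator positive when `b` is zero.
    δ = c * 1/ s
    0<δ : 0ℚ < δ
    0<δ = *-pos 0<c (positive⁻¹ (1/ s) {{1/pos⇒pos s}})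
    least : 0ℚ < δ ⊓ 1ℚ
    least with ≤-total δ 1ℚ
    ... | inj₁ le = subst (0ℚ <_) (sym (p≤q⇒p⊓q≡p le)) 0<δ
    ... | inj₂ le = subst (0ℚ <_) (sym (p≥q⇒p⊓q≡q le)) (positive⁻¹ 1ℚ)
    small : ∀ ε → 0ℚ < ε → ε ≤ δ → ε * b < c
    small ε e l = begin-strict
      ε * b ≡⟨ +-identityʳ (ε * b) ⟨
      ε * b + 0ℚ <⟨ +-monoʳ-< (ε * b) (*-pos e 0<c) ⟩
      ε * b + ε * c ≡⟨ *-distribˡ-+ ε b c ⟨
      ε * s ≤⟨ *-monoʳ-≤-nonNeg s {{nonNegative (<⇒≤ 0<s)}} l ⟩
      c * 1/ s * s ≡⟨ *-assoc c (1/ s) s ⟩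
      c * (1/ s * s) ≡⟨ cong (c *_) (*-inverseˡ s) ⟩
      c * 1ℚ ≡⟨ *-identityʳ c ⟩
      c ∎

  germ-- : ∀ {f g c d} → Germ f c → Germ g d → Germ (λ ε → f ε - g ε) (c - d)
  germ-- F G = germ-+ F (germ-neg G)

  PointGerm : (ℚ → Point) → Point → Set
  PointGerm f p = Germ (λ ε → x (f ε)) (x p) × Germ (λ ε → y (f ε)) (y p)

  germ-orient : ∀ {f g h p q r} → PointGerm f p → PointGerm g q → PointGerm h r →
    Germ (λ ε → orient (f ε) (g ε) (h ε)) (orient p q r)
  germ-orient (fx , fy) (gx , gy) (hx , hy) =
    germ-- (germ-* (germ-- gx fx) (germ-- hy fy)) (germ-* (germ-- gy fy) (germ-- hx fx))

-- Doubling a configuration in the plane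

module Configurations where

  open import Defs
  open Orientations
  open Chords
  open ConvexPosition
  open Doublings
  open Germs
  open import Data.Nat as ℕ using (ℕ; suc; ⌊_/2⌋)
  import Data.Nat.Properties as ℕₚ
  open import Data.Rational using (ℚ; 0ℚ; _+_; _*_; _-_; -_; _<_; _≤_)
  open import Data.Rational.Properties hiding (_≟_)
  open import Data.Rational.Solver using (module +-*-Solver)
  open import Data.Sum.Properties using (inj₁-injective; inj₂-injective; ≡-dec)
  import Data.Product.Properties as ×ₚ
  import Data.Bool.Properties as Bool
  open import Data.List.Properties using (length-++; length-map)

  open +-*-Solver using (solve; _:=_; _:+_; _:*_; _:-_; :-_; con; Polynomial)

  -- positive iff z lies to the left of the line through a with direction u
  turn : Point → Point → Point → ℚ
  turn u a z = x u * (y z - y a) - y u * (x z - x a)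

  norm² : Point → ℚ
  norm² u = x u * x u + y u * y u

  -- The complex number `u` times 1 + iε or 1 - iε: a slight rotation without square roots.
  tilt : ℚ → Point → Bool → Point
  tilt ε u true = x u - ε * y u , y u + ε * x u
  tilt ε u false = x u + ε * y u , y u - ε * x u

  -- The points b + ε u and b - ε u, both moved outwards by ε² times the right normal of `u`. Thus
  -- each child is `b` plus or minus a multiple of a tilted direction, which gives the orientations
  -- below closed forms, while `b` stays strictly inside the line of the twins.
  child : ℚ → Point → Point → Bool → Point
  child ε b u true = x b + ε * x (tilt ε u false) , y b + ε * y (tilt ε u false)
  child ε b u false = x b - ε * x (tilt ε u true) , y b - ε * y (tilt ε u true)

  private
    turnP : ∀ {n} → (ux uy ax ay zx zy : Polynomial n) → Polynomial n
    turnP ux uy ax ay zx zy = ux :* (zy :- ay) :- uy :* (zx :- ax)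

  abstract
    orient-before-old : ∀ ε b u z → orient (child ε b u false) b z ≡ ε * turn (tilt ε u true) b z
    orient-before-old ε (bx , by) (ux , uy) (zx , zy) =
      solve 7 (λ e bx by ux uy zx zy →
        orientP (bx :- e :* (ux :- e :* uy)) (by :- e :* (uy :+ e :* ux)) bx by zx zy :=
        e :* turnP (ux :- e :* uy) (uy :+ e :* ux) bx by zx zy) refl ε bx by ux uy zx zy

    orient-old-after : ∀ ε b u z → orient b (child ε b u true) z ≡ ε * turn (tilt ε u false) b z
    orient-old-after ε (bx , by) (ux , uy) (zx , zy) =
      solve 7 (λ e bx by ux uy zx zy →
        orientP bx by (bx :+ e :* (ux :+ e :* uy)) (by :+ e :* (uy :- e :* ux)) zx zy :=
        e :* turnP (ux :+ e :* uy) (uy :- e :* ux) bx by zx zy) refl ε bx by ux uy zx zy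

    orient-before-after : ∀ ε b u z → orient (child ε b u false) (child ε b u true) z ≡
      (ε + ε) * (turn u b z + ε * ε * norm² u)
    orient-before-after ε (bx , by) (ux , uy) (zx , zy) =
      solve 7 (λ e bx by ux uy zx zy →
        orientP (bx :- e :* (ux :- e :* uy)) (by :- e :* (uy :+ e :* ux))
          (bx :+ e :* (ux :+ e :* uy)) (by :+ e :* (uy :- e :* ux)) zx zy :=
        (e :+ e) :* (turnP ux uy bx by zx zy :+ e :* e :* (ux :* ux :+ uy :* uy))) refl ε bx by ux uy zx zy

    -- The tilted direction is the supporting direction at the child. Moving the line from `b` out
    -- to the child gains 2ε² times `norm² u`; this makes the support strict even for the parent and
    -- the twin, both of which lie on the line through `b`.
    turn-child : ∀ ε b u s z → turn (tilt ε u s) (child ε b u s) z ≡ turn (tilt ε u s) b z + (ε * ε + ε * ε) * norm² u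
    turn-child ε (bx , by) (ux , uy) true (zx , zy) =
      solve 7 (λ e bx by ux uy zx zy →
        turnP (ux :- e :* uy) (uy :+ e :* ux) (bx :+ e :* (ux :+ e :* uy)) (by :+ e :* (uy :- e :* ux)) zx zy :=
        turnP (ux :- e :* uy) (uy :+ e :* ux) bx by zx zy :+ (e :* e :+ e :* e) :* (ux :* ux :+ uy :* uy)) refl ε bx by ux uy zx zy
    turn-child ε (bx , by) (ux , uy) false (zx , zy) =
      solve 7 (λ e bx by ux uy zx zy →
        turnP (ux :+ e :* uy) (uy :- e :* ux) (bx :- e :* (ux :- e :* uy)) (by :- e :* (uy :+ e :* ux)) zx zy :=
        turnP (ux :+ e :* uy) (uy :- e :* ux) bx by zx zy :+ (e :* e :+ e :* e) :* (ux :* ux :+ uy :* uy)) refl ε bx by ux uy zx zy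

    turn-twin : ∀ ε b u s → turn (tilt ε u s) b (child ε b u (not s)) ≡ 0ℚ
    turn-twin ε (bx , by) (ux , uy) true =
      solve 5 (λ e bx by ux uy →
        turnP (ux :- e :* uy) (uy :+ e :* ux) bx by (bx :- e :* (ux :- e :* uy)) (by :- e :* (uy :+ e :* ux)) := con 0ℚ)
        refl ε bx by ux uy
    turn-twin ε (bx , by) (ux , uy) false =
      solve 5 (λ e bx by ux uy →
        turnP (ux :+ e :* uy) (uy :- e :* ux) bx by (bx :+ e :* (ux :+ e :* uy)) (by :+ e :* (uy :- e :* ux)) := con 0ℚ)
        refl ε bx by ux uy

    turn-self : ∀ u a → turn u a a ≡ 0ℚ
    turn-self (ux , uy) (ax , ay) = solve 4 (λ ux uy ax ay → turnP ux uy ax ay ax ay := con 0ℚ) refl ux uy ax ay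

    norm²-tilt : ∀ ε u s → norm² (tilt ε u s) ≡ norm² u + ε * ε * norm² u
    norm²-tilt ε (ux , uy) true = solve 3 (λ e ux uy →
      (ux :- e :* uy) :* (ux :- e :* uy) :+ (uy :+ e :* ux) :* (uy :+ e :* ux) :=
      (ux :* ux :+ uy :* uy) :+ e :* e :* (ux :* ux :+ uy :* uy)) refl ε ux uy
    norm²-tilt ε (ux , uy) false = solve 3 (λ e ux uy →
      (ux :+ e :* uy) :* (ux :+ e :* uy) :+ (uy :- e :* ux) :* (uy :- e :* ux) :=
      (ux :* ux :+ uy :* uy) :+ e :* e :* (ux :* ux :+ uy :* uy)) refl ε ux uy

  germ-subst : ∀ {f c d} → c ≡ d → Germ f c → Germ f d
  germ-subst {f} = subst (Germ f)

  germ-tilt : ∀ u s → PointGerm (λ ε → tilt ε u s) u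
  germ-tilt u true =
    germ-subst (solve 2 (λ a b → a :- con 0ℚ :* b := a) refl (x u) (y u)) (germ-- (germ-const (x u)) (germ-* germ-id (germ-const (y u)))) ,
    germ-subst (solve 2 (λ a b → a :+ con 0ℚ :* b := a) refl (y u) (x u)) (germ-+ (germ-const (y u)) (germ-* germ-id (germ-const (x u))))
  germ-tilt u false =
    germ-subst (solve 2 (λ a b → a :+ con 0ℚ :* b := a) refl (x u) (y u)) (germ-+ (germ-const (x u)) (germ-* germ-id (germ-const (y u)))) ,
    germ-subst (solve 2 (λ a b → a :- con 0ℚ :* b := a) refl (y u) (x u)) (germ-- (germ-const (y u)) (germ-* germ-id (germ-const (x u))))

  germ-child : ∀ b u s → PointGerm (λ ε → child ε b u s) b
  germ-child b u true =
    germ-subst (solve 2 (λ a b → a :+ con 0ℚ :* b := a) refl (x b) (x u)) (germ-+ (germ-const (x b)) (germ-* germ-id (proj₁ (germ-tilt u false)))) ,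
    germ-subst (solve 2 (λ a b → a :+ con 0ℚ :* b := a) refl (y b) (y u)) (germ-+ (germ-const (y b)) (germ-* germ-id (proj₂ (germ-tilt u false))))
  germ-child b u false =
    germ-subst (solve 2 (λ a b → a :- con 0ℚ :* b := a) refl (x b) (x u)) (germ-- (germ-const (x b)) (germ-* germ-id (proj₁ (germ-tilt u true)))) ,
    germ-subst (solve 2 (λ a b → a :- con 0ℚ :* b := a) refl (y b) (y u)) (germ-- (germ-const (y b)) (germ-* germ-id (proj₂ (germ-tilt u true))))

  germ-turn : ∀ {f g h p q r} → PointGerm f p → PointGerm g q → PointGerm h r →
    Germ (λ ε → turn (f ε) (g ε) (h ε)) (turn p q r)
  germ-turn (fx , fy) (gx , gy) (hx , hy) = germ-- (germ-* fx (germ-- hy gy)) (germ-* fy (germ-- hx gx))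

  germ-point : ∀ p → PointGerm (λ _ → p) p
  germ-point p = germ-const (x p) , germ-const (y p)

  record Configuration (K : ℕ) : Set₁ where
    field
      A B : Set
      _≟_ : ∀ (a b : A) → Dec (a ≡ b)
      elements : List A
      complete : ∀ a → a ∈ elements
      distinct : Unique elements
      size : length elements ≡ G K
      hull : List B
      hull-complete : ∀ b → b ∈ hull
      hull-distinct : Unique hull
      -- Twice the hull size is the number of children of the next step, and the right side is the
      -- increase of `G` from `K` to `2 + K`.
      hull-size : length hull ℕ.* 2 ≡ 2 ℕ.^ ⌊ K /2⌋ ℕ.+ 2 ℕ.^ ⌊ suc K /2⌋
      ι : B → A
      ι-injective : ∀ {b c} → ι b ≡ ι c → b ≡ c
      pos : A → Point
      pos-injective : ∀ {a b} → pos a ≡ pos b → a ≡ b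
      general : ∀ {a b c} → a ≢ b → b ≢ c → a ≢ c → orient (pos a) (pos b) (pos c) ≢ 0ℚ
      dir : B → Point
      dir≢0 : ∀ b → 0ℚ < norm² (dir b)
      support : ∀ {b z} → z ≢ ι b → 0ℚ < turn (dir b) (pos (ι b)) (pos z)
      sparse : SparseTriangles (orientation pos general)
      hullTriangles : HullTriangles (orientation pos general) ι
      freeBound : FreeBound (orientation pos general) K

  *-pos₂ : ∀ {ε} → 0ℚ < ε → 0ℚ < ε * ε
  *-pos₂ h = *-pos h h

  NonZeroSign : Point → Point → Point → Set
  NonZeroSign p q r = 0ℚ < orient p q r ⊎ 0ℚ < orient q p r

  nonZeroSign-cyc : ∀ {p q r} → NonZeroSign q r p → NonZeroSign p q r
  nonZeroSign-cyc {p} {q} {r} (inj₁ h) = inj₁ (subst (0ℚ <_) (sym (orient-cyc p q r)) h)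
  nonZeroSign-cyc {p} {q} {r} (inj₂ h) = inj₂ (subst (0ℚ <_) (orient-cyc r q p) h)

  nonZeroSign⇒≢0 : ∀ {p q r} → NonZeroSign p q r → orient p q r ≢ 0ℚ
  nonZeroSign⇒≢0 (inj₁ h) e = <-irrefl (sym e) h
  nonZeroSign⇒≢0 {p} {q} {r} (inj₂ h) e = <-irrefl e (left-anti {q} {p} {r} h)

  module Double {K} (c : Configuration K) where
    open Configuration c

    A′ = A ⊎ B × Bool

    parent : A′ → A
    parent = parentOf ι

    twins : List B → List (B × Bool)
    twins [] = []
    twins (b ∷ bs) = (b , false) ∷ (b , true) ∷ twins bs

    length-twins : ∀ bs → length (twins bs) ≡ length bs ℕ.* 2
    length-twins [] = refl
    length-twins (_ ∷ bs) = cong (λ n → suc (suc n)) (length-twins bs)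

    ∈-twins : ∀ {b s bs} → b ∈ bs → (b , s) ∈ twins bs
    ∈-twins {s = false} (here refl) = here refl
    ∈-twins {s = true} (here refl) = there (here refl)
    ∈-twins (there m) = there (there (∈-twins m))

    twins-∈ : ∀ {b s} bs → (b , s) ∈ twins bs → b ∈ bs
    twins-∈ (_ ∷ bs) (here refl) = here refl
    twins-∈ (_ ∷ bs) (there (here refl)) = here refl
    twins-∈ (_ ∷ bs) (there (there m)) = there (twins-∈ bs m)

    twins-unique : ∀ {bs} → Unique bs → Unique (twins bs)
    twins-unique [] = []
    twins-unique {b ∷ bs} (h ∷ u) =
      ((λ ()) ∷ All.tabulate λ { m refl → All.lookup h (twins-∈ bs m) refl }) ∷
      All.tabulate (λ { m refl → All.lookup h (twins-∈ bs m) refl }) ∷ twins-unique u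

    elements′ : List A′
    elements′ = map inj₁ elements ++ map inj₂ (twins hull)

    complete′ : ∀ a → a ∈ elements′
    complete′ (inj₁ a) = ∈-++⁺ˡ (∈-map⁺ inj₁ (complete a))
    complete′ (inj₂ (b , s)) = ∈-++⁺ʳ (map inj₁ elements) (∈-map⁺ inj₂ (∈-twins (hull-complete b)))

    distinct′ : Unique elements′
    distinct′ = AllPairs.++⁺ (Unique.map⁺ inj₁-injective distinct) (Unique.map⁺ inj₂-injective (twins-unique hull-distinct))
      (All.tabulate λ m → All.tabulate λ k e → case ∈-map⁻ inj₁ m , ∈-map⁻ inj₂ k of λ
        { ((_ , _ , refl) , (_ , _ , refl)) → case e of λ () })

    size′ : length elements′ ≡ G (2 ℕ.+ K)
    size′ = trans (length-++ (map inj₁ elements)) (trans (cong₂ ℕ._+_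
      (trans (length-map inj₁ elements) size)
      (trans (length-map inj₂ (twins hull)) (trans (length-twins hull) hull-size)))
      (sym (ℕₚ.+-assoc (G K) _ _)))

    hull-size′ : length (twins hull) ℕ.* 2 ≡ 2 ℕ.^ ⌊ 2 ℕ.+ K /2⌋ ℕ.+ 2 ℕ.^ ⌊ 3 ℕ.+ K /2⌋
    hull-size′ = trans (cong (ℕ._* 2) (trans (length-twins hull) hull-size))
      (trans (ℕₚ.*-distribʳ-+ 2 (2 ℕ.^ ⌊ K /2⌋) _) (cong₂ ℕ._+_ (ℕₚ.*-comm (2 ℕ.^ ⌊ K /2⌋) 2) (ℕₚ.*-comm (2 ℕ.^ ⌊ suc K /2⌋) 2)))

    place : ℚ → A′ → Point
    place ε (inj₁ a) = pos a
    place ε (inj₂ (b , s)) = child ε (pos (ι b)) (dir b) s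

    germ-place : ∀ u → PointGerm (λ ε → place ε u) (pos (parent u))
    germ-place (inj₁ a) = germ-point (pos a)
    germ-place (inj₂ (b , s)) = germ-child (pos (ι b)) (dir b) s

    Apart : A′ → A′ → A′ → Set
    Apart u v w = parent u ≢ parent v × parent v ≢ parent w × parent u ≢ parent w ×
      0ℚ < orient (pos (parent u)) (pos (parent v)) (pos (parent w))

    apart? : ∀ u v w → Dec (Apart u v w)
    apart? u v w = ¬? (parent u ≟ parent v) ×-dec ¬? (parent v ≟ parent w) ×-dec ¬? (parent u ≟ parent w) ×-dec
      (0ℚ <? orient (pos (parent u)) (pos (parent v)) (pos (parent w)))

    Lifted : A′ → A′ → A′ → ℚ → Set
    Lifted u v w ε = Apart u v w → 0ℚ < orient (place ε u) (place ε v) (place ε w)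

    lifted : ∀ u v w → Eventually (Lifted u v w)
    lifted u v w with apart? u v w
    ... | no ¬a = ev-true λ ε a → ⊥-elim (¬a a)
    ... | yes (_ , _ , _ , h) = ev-map (λ ε _ k _ → k)
          (germ-positive (germ-orient (germ-place u) (germ-place v) (germ-place w)) h)

    Supported : B → A′ → ℚ → Set
    Supported b z ε = parent z ≢ ι b → 0ℚ < turn (dir b) (pos (ι b)) (place ε z) ×
      (0ℚ < turn (tilt ε (dir b) true) (pos (ι b)) (place ε z) × 0ℚ < turn (tilt ε (dir b) false) (pos (ι b)) (place ε z))

    supported : ∀ b z → Eventually (Supported b z)
    supported b z with parent z ≟ ι b
    ... | yes e = ev-true λ ε ne → ⊥-elim (ne e)
    ... | no ne = ev-map (λ ε _ k _ → k) (ev-× (near (germ-point (dir b))) (ev-× (near (germ-tilt (dir b) true)) (near (germ-tilt (dir b) false))))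
      where
      near : ∀ {f} → PointGerm f (dir b) → Eventually (λ ε → 0ℚ < turn (f ε) (pos (ι b)) (place ε z))
      near F = germ-positive (germ-turn F (germ-point (pos (ι b))) (germ-place z)) (support ne)

    -- Finitely many strict inequalities that hold in the limit ε = 0, where every child is at its
    -- parent; hence one small ε satisfies all of them. The orientations within a cluster degenerate
    -- in the limit and are obtained from exact formulas instead.
    Good : ℚ → Set
    Good ε = (∀ {u} → u ∈ elements′ → ∀ {v} → v ∈ elements′ → ∀ {w} → w ∈ elements′ → Lifted u v w ε) ×
      (∀ {b} → b ∈ hull → ∀ {z} → z ∈ elements′ → Supported b z ε)

    good : Eventually Good
    good = ev-× (ev-all elements′ λ u → ev-all elements′ λ v → ev-all elements′ λ w → lifted u v w)
                (ev-all hull λ b → ev-all elements′ λ z → supported b z)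

    module At (ε : ℚ) (0<ε : 0ℚ < ε) (g : Good ε) where

      pos′ : A′ → Point
      pos′ = place ε

      dir′ : B × Bool → Point
      dir′ (b , s) = tilt ε (dir b) s

      L′ : A′ → A′ → A′ → Set
      L′ u v w = 0ℚ < orient (pos′ u) (pos′ v) (pos′ w)

      lift : ∀ {u v w} → parent u ≢ parent v → parent v ≢ parent w → parent u ≢ parent w →
        0ℚ < orient (pos (parent u)) (pos (parent v)) (pos (parent w)) → L′ u v w
      lift {u} {v} {w} p q r h = proj₁ g (complete′ u) (complete′ v) (complete′ w) (p , q , r , h)

      base : ∀ {b z} → parent z ≢ ι b → 0ℚ < turn (dir b) (pos (ι b)) (pos′ z)
      base {b} {z} ne = proj₁ (proj₂ g (hull-complete b) (complete′ z) ne)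

      tilted : ∀ {b z} s → parent z ≢ ι b → 0ℚ < turn (tilt ε (dir b) s) (pos (ι b)) (pos′ z)
      tilted {b} {z} true ne = proj₁ (proj₂ (proj₂ g (hull-complete b) (complete′ z) ne))
      tilted {b} {z} false ne = proj₂ (proj₂ (proj₂ g (hull-complete b) (complete′ z) ne))

      old : A → A′
      old = inj₁
      before after : B → A′
      before b = inj₂ (b , false)
      after b = inj₂ (b , true)

      before-old : ∀ {b z} → parent z ≢ ι b → L′ (before b) (old (ι b)) z
      before-old {b} {z} ne = subst (0ℚ <_) (sym (orient-before-old ε (pos (ι b)) (dir b) (pos′ z)))
        (*-pos 0<ε (tilted {b} {z} true ne))

      old-after : ∀ {b z} → parent z ≢ ι b → L′ (old (ι b)) (after b) z
      old-after {b} {z} ne = subst (0ℚ <_) (sym (orient-old-after ε (pos (ι b)) (dir b) (pos′ z)))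
        (*-pos 0<ε (tilted {b} {z} false ne))

      before-after : ∀ {b z} → parent z ≢ ι b → L′ (before b) (after b) z
      before-after {b} {z} ne = subst (0ℚ <_) (sym (orient-before-after ε (pos (ι b)) (dir b) (pos′ z)))
        (*-pos (+-pos 0<ε 0<ε) (+-pos (base {b} {z} ne) (*-pos (*-pos₂ 0<ε) (dir≢0 b))))

      old-inside : ∀ {b} → L′ (before b) (after b) (old (ι b))
      old-inside {b} = subst (0ℚ <_) (sym (orient-before-after ε (pos (ι b)) (dir b) (pos (ι b))))
        (*-pos (+-pos 0<ε 0<ε) (+-mono-≤-< (≤-reflexive (sym (turn-self (dir b) (pos (ι b))))) (*-pos (*-pos₂ 0<ε) (dir≢0 b))))

      support′ : ∀ {c z} → z ≢ inj₂ c → 0ℚ < turn (dir′ c) (pos′ (inj₂ c)) (pos′ z)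
      support′ {b , s} {z} z≢ = subst (0ℚ <_) (sym (turn-child ε (pos (ι b)) (dir b) s (pos′ z)))
        (+-mono-≤-< (weak z z≢) (*-pos (+-pos (*-pos₂ 0<ε) (*-pos₂ 0<ε)) (dir≢0 b)))
        where
        twin : ∀ s t → (b , t) ≢ (b , s) → t ≡ not s
        twin true true ne = ⊥-elim (ne refl)
        twin true false ne = refl
        twin false true ne = refl
        twin false false ne = ⊥-elim (ne refl)
        weak : ∀ z → z ≢ inj₂ (b , s) → 0ℚ ≤ turn (tilt ε (dir b) s) (pos (ι b)) (pos′ z)
        weak z z≢ with parent z ≟ ι b
        ... | no ne = <⇒≤ (tilted {b} {z} s ne)
        weak (inj₁ _) z≢ | yes refl = ≤-reflexive (sym (turn-self (tilt ε (dir b) s) (pos (ι b))))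
        weak (inj₂ (c , t)) z≢ | yes e with ι-injective e
        ... | refl with twin s t (z≢ ∘ cong inj₂)
        ...   | refl = ≤-reflexive (sym (turn-twin ε (pos (ι b)) (dir b) s))

      pos-injective′ : ∀ {u v} → pos′ u ≡ pos′ v → u ≡ v
      pos-injective′ {inj₁ a} {inj₁ b} e = cong inj₁ (pos-injective e)
      pos-injective′ {inj₂ c} {v} e = decide v e
        where
        -- The supporting functional of a child vanishes at the child and is positive at every other
        -- point.
        clash : ∀ z → z ≢ inj₂ c → pos′ (inj₂ c) ≢ pos′ z
        clash z ne e = <-irrefl (trans (sym (turn-self (dir′ c) (pos′ (inj₂ c)))) (cong (turn (dir′ c) (pos′ (inj₂ c))) e)) (support′ {z = z} ne)
        decide : ∀ v → pos′ (inj₂ c) ≡ pos′ v → inj₂ c ≡ v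
        decide (inj₁ a) e = ⊥-elim (clash (inj₁ a) (λ ()) e)
        decide (inj₂ (d , t)) e with ι d ≟ ι (proj₁ c) | t Bool.≟ proj₂ c
        ... | yes p | yes refl = cong (λ b → inj₂ (b , t)) (sym (ι-injective p))
        ... | no ne | _ = ⊥-elim (clash (inj₂ (d , t)) (λ { refl → ne refl }) e)
        ... | _ | no ne = ⊥-elim (clash (inj₂ (d , t)) (λ { refl → ne refl }) e)
      pos-injective′ {inj₁ a} {inj₂ c} e = sym (pos-injective′ {inj₂ c} {inj₁ a} (sym e))

      Sign : A′ → A′ → A′ → Set
      Sign u v w = NonZeroSign (pos′ u) (pos′ v) (pos′ w)

      rotate-sign : ∀ u v w → Sign v w u → Sign u v w
      rotate-sign u v w = nonZeroSign-cyc {pos′ u} {pos′ v} {pos′ w}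

      spread : ∀ {u v w} → parent u ≢ parent v → parent v ≢ parent w → parent u ≢ parent w → Sign u v w
      spread {u} {v} {w} p q r = [ (λ h → inj₁ (lift {u} {v} {w} p q r h)) , (λ h → inj₂ (lift {v} {u} {w} (≢-sym p) r q h)) ]′
        (CCSystem.tot (orientation pos general) p q r)

      siblings : ∀ u v w → u ≢ v → parent u ≡ parent v → parent w ≢ parent u → Sign u v w
      siblings (inj₁ a) (inj₁ b) w ne refl _ = ⊥-elim (ne refl)
      siblings (inj₁ a) (inj₂ (b , false)) w ne refl far = inj₂ (before-old {b} {w} far)
      siblings (inj₁ a) (inj₂ (b , true)) w ne refl far = inj₁ (old-after {b} {w} far)
      siblings (inj₂ (b , false)) (inj₁ a) w ne refl far = inj₁ (before-old {b} {w} far)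
      siblings (inj₂ (b , true)) (inj₁ a) w ne refl far = inj₂ (old-after {b} {w} far)
      siblings (inj₂ (b , s)) (inj₂ (c , t)) w ne e far with ι-injective e
      siblings (inj₂ (b , true)) (inj₂ (b , true)) w ne e far | refl = ⊥-elim (ne refl)
      siblings (inj₂ (b , false)) (inj₂ (b , false)) w ne e far | refl = ⊥-elim (ne refl)
      siblings (inj₂ (b , false)) (inj₂ (b , true)) w ne e far | refl = inj₁ (before-after {b} {w} far)
      siblings (inj₂ (b , true)) (inj₂ (b , false)) w ne e far | refl = inj₂ (before-after {b} {w} far)

      old-cluster : ∀ a v w → old a ≢ v → v ≢ w → old a ≢ w → a ≡ parent v → parent v ≡ parent w → Sign (old a) v w
      old-cluster a (inj₁ _) w n₁ _ _ refl _ = ⊥-elim (n₁ refl)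
      old-cluster a (inj₂ _) (inj₁ _) _ _ n₃ refl refl = ⊥-elim (n₃ refl)
      old-cluster a (inj₂ (b , s)) (inj₂ (c , t)) _ n₂ _ refl e with ι-injective e
      old-cluster a (inj₂ (b , true)) (inj₂ (b , true)) _ n₂ _ refl e | refl = ⊥-elim (n₂ refl)
      old-cluster a (inj₂ (b , false)) (inj₂ (b , false)) _ n₂ _ refl e | refl = ⊥-elim (n₂ refl)
      old-cluster a (inj₂ (b , false)) (inj₂ (b , true)) _ n₂ _ refl e | refl =
        rotate-sign (old (ι b)) (before b) (after b) (inj₁ (old-inside {b}))
      old-cluster a (inj₂ (b , true)) (inj₂ (b , false)) _ n₂ _ refl e | refl =
        rotate-sign (old (ι b)) (after b) (before b) (inj₂ (old-inside {b}))

      cluster : ∀ u v w → u ≢ v → v ≢ w → u ≢ w → parent u ≡ parent v → parent v ≡ parent w → Sign u v w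
      cluster (inj₁ a) v w n₁ n₂ n₃ e f = old-cluster a v w n₁ n₂ n₃ e f
      cluster u@(inj₂ _) (inj₁ a) w n₁ n₂ n₃ e f =
        rotate-sign u (old a) w (old-cluster a w u n₂ (≢-sym n₃) (≢-sym n₁) f (sym (trans e f)))
      cluster u@(inj₂ _) v@(inj₂ _) (inj₁ a) n₁ n₂ n₃ e f =
        rotate-sign u v (old a) (rotate-sign v (old a) u (old-cluster a u v (≢-sym n₃) n₁ (≢-sym n₂) (sym (trans e f)) e))
      cluster (inj₂ (b , s)) (inj₂ (c , t)) (inj₂ (d , r)) n₁ n₂ n₃ e f with ι-injective e | ι-injective f
      ... | refl | refl = ⊥-elim (pigeon s t r n₁ n₂ n₃)
        where
        child′ : Bool → A′
        child′ s = inj₂ (b , s)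
        pigeon : ∀ s t r → child′ s ≢ child′ t → child′ t ≢ child′ r → child′ s ≢ child′ r → ⊥
        pigeon true true _ h _ _ = h refl
        pigeon false false _ h _ _ = h refl
        pigeon true false true _ _ h = h refl
        pigeon false true false _ _ h = h refl
        pigeon true false false _ h _ = h refl
        pigeon false true true _ h _ = h refl

      sign-of : ∀ u v w → u ≢ v → v ≢ w → u ≢ w → Sign u v w
      sign-of u v w n₁ n₂ n₃ with parent u ≟ parent v | parent v ≟ parent w | parent u ≟ parent w
      ... | no p | no q | no r = spread {u} {v} {w} p q r
      ... | yes p | yes q | _ = cluster u v w n₁ n₂ n₃ p q
      ... | yes p | no q | _ = siblings u v w n₁ p (λ e → q (sym (trans e p)))
      ... | no p | yes q | _ = rotate-sign u v w (siblings v w u n₂ q p)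
      ... | no p | no q | yes r = rotate-sign u v w (rotate-sign v w u (siblings w u v (≢-sym n₃) (sym r) q))

      general′ : ∀ {u v w} → u ≢ v → v ≢ w → u ≢ w → orient (pos′ u) (pos′ v) (pos′ w) ≢ 0ℚ
      general′ {u} {v} {w} n₁ n₂ n₃ = nonZeroSign⇒≢0 {pos′ u} {pos′ v} {pos′ w} (sign-of u v w n₁ n₂ n₃)

      module Lower = Doubling.Signs (orientation pos general) ι ι-injective _≟_
        (orientation pos′ λ {u} {v} {w} → general′ {u} {v} {w})
        (λ {u} {v} {w} → lift {u} {v} {w}) (λ {b} {z} → before-old {b} {z}) (λ {b} {z} → old-after {b} {z})
        (λ {b} {z} → before-after {b} {z}) (λ {b} → old-inside {b})

      configuration : Configuration (2 ℕ.+ K)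
      configuration = record
        { A = A′ ; B = B × Bool ; _≟_ = ≡-dec _≟_ (×ₚ.≡-dec _≟B_ Bool._≟_)
        ; elements = elements′ ; complete = complete′ ; distinct = distinct′ ; size = size′
        ; hull = twins hull ; hull-complete = λ { (b , s) → ∈-twins (hull-complete b) }
        ; hull-distinct = twins-unique hull-distinct ; hull-size = hull-size′
        ; ι = inj₂ ; ι-injective = inj₂-injective
        ; pos = pos′ ; pos-injective = pos-injective′
        ; general = λ {u} {v} {w} → general′ {u} {v} {w}
        ; dir = dir′
        ; dir≢0 = λ { (b , s) → subst (0ℚ <_) (sym (norm²-tilt ε (dir b) s)) (+-pos (dir≢0 b) (*-pos (*-pos₂ 0<ε) (dir≢0 b))) }
        ; support = λ {c} {z} → support′ {c} {z}
        ; sparse = λ {u} {v} {w} {p} {q} → Lower.sparse′ sparse₀ {u} {v} {w} {p} {q}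
        ; hullTriangles = λ {b} {d} {e} → Lower.hullTriangles′ hullTriangles₀ {b} {d} {e}
        ; freeBound = λ {Q} → Lower.freeBound′ hullTriangles₀ (λ {R} → freeBound {R}) {Q} }
        where
        sparse₀ : SparseTriangles (orientation pos general)
        sparse₀ {u} {v} {w} {p} {q} = sparse {u} {v} {w} {p} {q}
        hullTriangles₀ : HullTriangles (orientation pos general) ι
        hullTriangles₀ {b} {d} {e} = hullTriangles {b} {d} {e}
        _≟B_ : ∀ (b c : B) → Dec (b ≡ c)
        b ≟B c with ι b ≟ ι c
        ... | yes e = yes (ι-injective e)
        ... | no ne = no (ne ∘ cong ι)

    doubled : Configuration (2 ℕ.+ K)
    doubled = let δ , 0<δ , h = good in At.configuration δ 0<δ (h δ 0<δ ≤-refl)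

-- Simple pentagons with three convex corners

module FivePoints where

  open Orientations
  open ConvexPosition
  open Chords using (b2n)
  open import Data.Nat using (ℕ; _+_)

  module SimplePentagons {A : Set} (C : CCSystem A) where
    open Planar C

    Crossing : A → A → A → A → Set
    Crossing a b c d = ((L a b c × L b a d) ⊎ (L b a c × L a b d)) × ((L c d a × L d c b) ⊎ (L d c a × L c d b))

    record Pentagon (v₀ v₁ v₂ v₃ v₄ : A) : Set where
      field
        unique  : Unique (v₀ ∷ v₁ ∷ v₂ ∷ v₃ ∷ v₄ ∷ [])
        apart₀₂ : ¬ Crossing v₀ v₁ v₂ v₃
        apart₁₃ : ¬ Crossing v₁ v₂ v₃ v₄
        apart₂₄ : ¬ Crossing v₂ v₃ v₄ v₀
        apart₃₀ : ¬ Crossing v₃ v₄ v₀ v₁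
        apart₄₁ : ¬ Crossing v₄ v₀ v₁ v₂

    rotatePentagon : ∀ {v₀ v₁ v₂ v₃ v₄} → Pentagon v₀ v₁ v₂ v₃ v₄ → Pentagon v₁ v₂ v₃ v₄ v₀
    rotatePentagon P = record
      { unique = turned unique ; apart₀₂ = apart₁₃ ; apart₁₃ = apart₂₄ ; apart₂₄ = apart₃₀ ; apart₃₀ = apart₄₁ ; apart₄₁ = apart₀₂ }
      where
      open Pentagon P
      turned : ∀ {v₀ v₁ v₂ v₃ v₄ : A} → Unique (v₀ ∷ v₁ ∷ v₂ ∷ v₃ ∷ v₄ ∷ []) → Unique (v₁ ∷ v₂ ∷ v₃ ∷ v₄ ∷ v₀ ∷ [])
      turned ((a ∷ b ∷ c ∷ d ∷ []) ∷ (e ∷ f ∷ g ∷ []) ∷ (h ∷ i ∷ []) ∷ (j ∷ []) ∷ _) =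
        (e ∷ f ∷ g ∷ ≢-sym a ∷ []) ∷ (h ∷ i ∷ ≢-sym b ∷ []) ∷ (j ∷ ≢-sym c ∷ []) ∷ (≢-sym d ∷ []) ∷ [] ∷ []

    Crowded : Set
    Crowded = ∃[ a ] ∃[ b ] ∃[ c ] ∃[ p ] ∃[ q ] (In a b c p × In a b c q × p ≢ q)

    module _ {v₀ v₁ v₂ v₃ v₄} (P : Pentagon v₀ v₁ v₂ v₃ v₄) where
      open Pentagon P

      private
        n : ∀ {v₀ v₁ v₂ v₃ v₄ : A} → Unique (v₀ ∷ v₁ ∷ v₂ ∷ v₃ ∷ v₄ ∷ []) →
          v₀ ≢ v₁ × v₁ ≢ v₃ × v₀ ≢ v₃ × v₀ ≢ v₂ × v₂ ≢ v₃ × v₂ ≢ v₄ × v₀ ≢ v₄ × v₁ ≢ v₄ × v₃ ≢ v₄ × v₁ ≢ v₂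
        n ((a ∷ b ∷ c ∷ d ∷ []) ∷ (e ∷ f ∷ g ∷ []) ∷ (h ∷ i ∷ []) ∷ (j ∷ []) ∷ _) = a , f , c , b , h , i , d , g , j , e
        01≢ = proj₁ (n unique)
        13≢ = proj₁ (proj₂ (n unique))
        03≢ = proj₁ (proj₂ (proj₂ (n unique)))
        02≢ = proj₁ (proj₂ (proj₂ (proj₂ (n unique))))
        23≢ = proj₁ (proj₂ (proj₂ (proj₂ (proj₂ (n unique)))))
        24≢ = proj₁ (proj₂ (proj₂ (proj₂ (proj₂ (proj₂ (n unique))))))
        04≢ = proj₁ (proj₂ (proj₂ (proj₂ (proj₂ (proj₂ (proj₂ (n unique)))))))
        14≢ = proj₁ (proj₂ (proj₂ (proj₂ (proj₂ (proj₂ (proj₂ (proj₂ (n unique))))))))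
        34≢ = proj₁ (proj₂ (proj₂ (proj₂ (proj₂ (proj₂ (proj₂ (proj₂ (proj₂ (n unique)))))))))
        12≢ = proj₂ (proj₂ (proj₂ (proj₂ (proj₂ (proj₂ (proj₂ (proj₂ (proj₂ (n unique)))))))))

      private
        sees-40 : L v₃ v₄ v₀ → L v₄ v₀ v₁ → L v₁ v₀ v₃ → L v₃ v₄ v₁
        sees-40 h340 h401 h103 = flip 34≢ (≢-sym 14≢) (≢-sym 13≢) λ h431 →
          apart₃₀ (inj₁ (h340 , h431) , inj₂ (h103 , cyc h401))

      -- The reflex corners are the neighbours `v₁` and `v₂`, and both lie in the triangle
      -- `v₃ v₄ v₀` of the convex corners: any other position makes two edges cross or contradicts
      -- the order about a vertex.
      adjacent-reflex : L v₁ v₀ v₂ → L v₂ v₁ v₃ → L v₂ v₃ v₄ → L v₃ v₄ v₀ → L v₄ v₀ v₁ → Crowded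
      adjacent-reflex h102 h213 h234 h340 h401 = [ ⊥-elim ∘ caseA , caseB ]′ (tot 01≢ 13≢ 03≢)
        where
        h402 : L v₃ v₂ v₀ → L v₄ v₀ v₂
        h402 h320 = flip (≢-sym 04≢) 02≢ (≢-sym 24≢) λ h042 → apart₂₄ (inj₁ (h234 , h320) , inj₂ (h042 , cyc h340))
        caseA : ¬ L v₀ v₁ v₃
        caseA h013 = asym₂₃ h013 (tr′ (cyc h340) (h402 h320) h401 (cyc² h320) (cyc h102))
          where
          h320 : L v₃ v₂ v₀
          h320 = flip (≢-sym 23≢) (≢-sym 02≢) (≢-sym 03≢) λ h230 → apart₀₂ (inj₂ (h102 , h013) , inj₁ (h230 , cyc² h213))
        caseB : L v₁ v₀ v₃ → Crowded
        caseB h103 = _ , _ , _ , _ , _ , (h341 , h401 , cyc h103) , (cyc h234 , h402 h320 , cyc² h320) , 12≢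
          where
          h341 = sees-40 h340 h401 h103
          h320 : L v₃ v₂ v₀
          h320 = tr (cyc h234) h341 h340 (cyc² h213) (cyc² h103)

      -- Here the reflex corners are `v₁` and `v₃`, and the triangle `v₀ v₂ v₄` contains both. The
      -- two positions of `v₃` relative to the line `v₀ v₁` call for different pairs of edges that
      -- must not cross.
      separated-reflex : L v₁ v₀ v₂ → L v₁ v₂ v₃ → L v₃ v₂ v₄ → L v₃ v₄ v₀ → L v₄ v₀ v₁ → Crowded
      separated-reflex h102 h123 h324 h340 h401 = [ caseA , caseB ]′ (tot 01≢ 13≢ 03≢)
        where
        both : L v₂ v₄ v₁ → L v₂ v₃ v₀ → Crowded
        both h241 h230 = _ , _ , _ , _ , _ , (cyc h102 , h241 , h401) , (cyc² h230 , cyc h324 , cyc h340) , 13≢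
        caseA : L v₀ v₁ v₃ → Crowded
        caseA h013 = both (tr′ (cyc h402) (cyc² h230) (cyc h102) (cyc h324) (cyc h123)) h230
          where
          h230 : L v₂ v₃ v₀
          h230 = flip 23≢ (≢-sym 03≢) (≢-sym 02≢) λ h320 → apart₀₂ (inj₂ (h102 , h013) , inj₂ (h320 , cyc h123))
          h402 : L v₄ v₀ v₂
          h402 = flip (≢-sym 04≢) 02≢ (≢-sym 24≢) λ h042 → apart₂₄ (inj₂ (h324 , h230) , inj₂ (h042 , cyc h340))
        caseB : L v₁ v₀ v₃ → Crowded
        caseB h103 = both (cyc h124) h230
          where
          h341 = sees-40 h340 h401 h103
          h230 : L v₂ v₃ v₀
          h230 = flip 23≢ (≢-sym 03≢) (≢-sym 02≢) λ h320 →
            asym₂₃ h324 (tr′ (cyc² h340) (cyc h103) (cyc² h320) h341 (cyc² h123))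
          h124 : L v₁ v₂ v₄
          h124 = flip 12≢ 24≢ 14≢ λ h214 → apart₁₃ (inj₁ (h123 , h214) , inj₁ (h341 , cyc² h324))

    corner : A → A → A → ℕ
    corner a b c = b2n (does (L? a b c))

    -- Exactly two corners are reflex, either neighbours or not. Each of the ten patterns is a
    -- rotation of one of the two cases above; all others have the wrong number of left turns.
    crowded : ∀ {v₀ v₁ v₂ v₃ v₄} → Pentagon v₀ v₁ v₂ v₃ v₄ →
      corner v₀ v₁ v₂ + (corner v₁ v₂ v₃ + (corner v₂ v₃ v₄ + (corner v₃ v₄ v₀ + (corner v₄ v₀ v₁ + 0)))) ≡ 3 → Crowded
    crowded {v₀} {v₁} {v₂} {v₃} {v₄} P₀ = go (L? _ _ _) (L? _ _ _) (L? _ _ _) (L? _ _ _) (L? _ _ _)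
      where
      P₁ = rotatePentagon P₀
      P₂ = rotatePentagon P₁
      P₃ = rotatePentagon P₂
      P₄ = rotatePentagon P₃
      r : ∀ {v₀ v₁ v₂ v₃ v₄} → Pentagon v₀ v₁ v₂ v₃ v₄ → ¬ L v₀ v₁ v₂ → L v₁ v₀ v₂
      r record { unique = (a ∷ b ∷ _) ∷ (c ∷ _) ∷ _ } h = flip (≢-sym a) b c h
      turns : {P : Set} → Dec P → ℕ
      turns d = b2n (does d)
      go : (a : Dec (L v₀ v₁ v₂)) (b : Dec (L v₁ v₂ v₃)) (c : Dec (L v₂ v₃ v₄)) (d : Dec (L v₃ v₄ v₀))
        (e : Dec (L v₄ v₀ v₁)) → turns a + (turns b + (turns c + (turns d + (turns e + 0)))) ≡ 3 → Crowded
      go (yes _) (yes _) (yes _) (yes _) _ ()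
      go (yes _) (yes _) (yes _) (no _) (yes _) ()
      go (yes a) (yes b) (yes c) (no d) (no e) _ = adjacent-reflex P₃ (r P₃ d) (r P₄ e) a b c
      go (yes _) (yes _) (no _) (yes _) (yes _) ()
      go (yes a) (yes b) (no c) (yes d) (no e) _ = separated-reflex P₂ (r P₂ c) d (r P₄ e) a b
      go (yes a) (yes b) (no c) (no d) (yes e) _ = adjacent-reflex P₂ (r P₂ c) (r P₃ d) e a b
      go (yes _) (yes _) (no _) (no _) (no _) ()
      go (yes _) (no _) (yes _) (yes _) (yes _) ()
      go (yes a) (no b) (yes c) (yes d) (no e) _ = separated-reflex P₄ (r P₄ e) a (r P₁ b) c d
      go (yes a) (no b) (yes c) (no d) (yes e) _ = separated-reflex P₁ (r P₁ b) c (r P₃ d) e a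
      go (yes _) (no _) (yes _) (no _) (no _) ()
      go (yes a) (no b) (no c) (yes d) (yes e) _ = adjacent-reflex P₁ (r P₁ b) (r P₂ c) d e a
      go (yes _) (no _) (no _) (yes _) (no _) ()
      go (yes _) (no _) (no _) (no _) (yes _) ()
      go (yes _) (no _) (no _) (no _) (no _) ()
      go (no _) (yes _) (yes _) (yes _) (yes _) ()
      go (no a) (yes b) (yes c) (yes d) (no e) _ = adjacent-reflex P₄ (r P₄ e) (r P₀ a) b c d
      go (no a) (yes b) (yes c) (no d) (yes e) _ = separated-reflex P₃ (r P₃ d) e (r P₀ a) b c
      go (no _) (yes _) (yes _) (no _) (no _) ()
      go (no a) (yes b) (no c) (yes d) (yes e) _ = separated-reflex P₀ (r P₀ a) b (r P₂ c) d e
      go (no _) (yes _) (no _) (yes _) (no _) ()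
      go (no _) (yes _) (no _) (no _) (yes _) ()
      go (no _) (yes _) (no _) (no _) (no _) ()
      go (no a) (no b) (yes c) (yes d) (yes e) _ = adjacent-reflex P₀ (r P₀ a) (r P₁ b) c d e
      go (no _) (no _) (yes _) (yes _) (no _) ()
      go (no _) (no _) (yes _) (no _) (yes _) ()
      go (no _) (no _) (yes _) (no _) (no _) ()
      go (no _) (no _) (no _) (yes _) (yes _) ()
      go (no _) (no _) (no _) (yes _) (no _) ()
      go (no _) (no _) (no _) (no _) (yes _) ()
      go (no _) (no _) (no _) (no _) (no _) ()

-- Seeds, the lower bound and the closed form

module LowerBound where

  open import Defs
  open Orientations
  open Chords
  open ConvexPosition
  open WindingNumbers using (pos*neg; neg*pos)
  open UpperBound
  open Doublings
  open Configurations
  open FivePoints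
  import Data.Bool.Properties as Bool
  open import Data.Fin as Fin using (Fin; zero; suc)
  import Data.Fin.Properties as Finₚ
  open import Data.Nat as ℕ using (ℕ; zero; suc; s≤s; ⌊_/2⌋; _^_; _∸_; _%_; _/_)
  import Data.Nat.Properties as ℕₚ
  import Data.Nat.DivMod as DivMod
  open import Data.Integer using (+_; -[1+_])
  open import Data.Rational using (0ℚ; 1ℚ; _*_; -_; _<_) renaming (_/_ to _÷_)
  open import Data.Rational.Properties using (_<?_)
  open import Data.List.Properties using (length-map)

  segment : Configuration 2
  segment = record
    { A = Bool ; B = Bool ; _≟_ = Bool._≟_
    ; elements = false ∷ true ∷ [] ; complete = complete ; distinct = ((λ ()) ∷ []) ∷ [] ∷ [] ; size = refl
    ; hull = false ∷ true ∷ [] ; hull-complete = complete ; hull-distinct = ((λ ()) ∷ []) ∷ [] ∷ [] ; hull-size = refl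
    ; ι = λ b → b ; ι-injective = λ e → e
    ; pos = pos ; pos-injective = λ { {false} {false} _ → refl ; {true} {true} _ → refl }
    ; general = λ {a} {b} {c} x y z → ⊥-elim (no-three a b c x y z)
    ; dir = dir
    ; dir≢0 = λ { false → from-yes (0ℚ <? norm² (dir false)) ; true → from-yes (0ℚ <? norm² (dir true)) }
    ; support = λ { {false} {false} ne → ⊥-elim (ne refl) ; {true} {true} ne → ⊥-elim (ne refl)
                  ; {false} {true} _ → from-yes (0ℚ <? turn (dir false) (pos false) (pos true))
                  ; {true} {false} _ → from-yes (0ℚ <? turn (dir true) (pos true) (pos false)) }
    ; sparse = λ {a} {b} {c} {p} i → let ab , bc , ac , _ = P.In-distinct {a} {b} {c} {p} i in ⊥-elim (no-three a b c ab bc ac)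
    ; hullTriangles = λ {a} {b} {c} x y z → ⊥-elim (no-three a b c x y z)
    ; freeBound = λ u _ → length-⊆ {ys = false ∷ true ∷ []} u (λ _ → complete _) }
    where
    complete : ∀ b → b ∈ false ∷ true ∷ []
    complete false = here refl
    complete true = there (here refl)
    pos dir : Bool → Point
    pos false = 0ℚ , 0ℚ
    pos true = 1ℚ , 0ℚ
    -- Supporting lines across the segment, because the line of the segment itself would not be
    -- strict at the other end.
    dir false = 0ℚ , - 1ℚ
    dir true = 0ℚ , 1ℚ
    no-three : ∀ a b c → a ≢ b → b ≢ c → a ≢ c → ⊥
    no-three false false _ h _ _ = h refl
    no-three true true _ h _ _ = h refl
    no-three false true true _ h _ = h refl
    no-three true false false _ h _ = h refl
    no-three false true false _ _ h = h refl
    no-three true false true _ _ h = h refl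
    module P = Planar (orientation pos λ {a} {b} {c} x y z → ⊥-elim (no-three a b c x y z))

  module Triangle where
    pos : Fin 4 → Point
    pos zero = 0ℚ , 0ℚ
    pos (suc zero) = -[1+ 1 ] ÷ 1 , -[1+ 0 ] ÷ 1
    pos (suc (suc zero)) = + 2 ÷ 1 , -[1+ 0 ] ÷ 1
    pos (suc (suc (suc zero))) = 0ℚ , + 2 ÷ 1

    dir : Fin 3 → Point
    dir zero = 1ℚ , - 1ℚ
    dir (suc zero) = 1ℚ , 1ℚ
    dir (suc (suc zero)) = - 1ℚ , 0ℚ

    general : ∀ {a b c} → a ≢ b → b ≢ c → a ≢ c → orient (pos a) (pos b) (pos c) ≢ 0ℚ
    general {a} {b} {c} = from-yes (Finₚ.all? λ a → Finₚ.all? λ b → Finₚ.all? λ c →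
      ¬? (a Fin.≟ b) →-dec (¬? (b Fin.≟ c) →-dec (¬? (a Fin.≟ c) →-dec ¬? (orient (pos a) (pos b) (pos c) ℚₚ.≟ 0ℚ)))) a b c
      where import Data.Rational.Properties as ℚₚ

    support : ∀ {b z} → z ≢ suc b → 0ℚ < turn (dir b) (pos (suc b)) (pos z)
    support {b} {z} = from-yes (Finₚ.all? λ b → Finₚ.all? λ z →
      ¬? (z Fin.≟ suc b) →-dec (0ℚ <? turn (dir b) (pos (suc b)) (pos z))) b z

    open Planar (orientation pos λ {a} {b} {c} → general {a} {b} {c})

    In₀? : ∀ a b c p → Dec (In a b c p)
    In₀? a b c p = L? a b p ×-dec L? b c p ×-dec L? c a p

    fourth : ∀ {a b c p q : Fin 4} → a ≢ b → b ≢ c → a ≢ c → p ≢ a → p ≢ b → p ≢ c → q ≢ a → q ≢ b → q ≢ c → p ≡ q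
    fourth {a} {b} {c} {p} {q} ab bc ac pa pb pc qa qb qc with p Fin.≟ q
    ... | yes e = e
    ... | no pq = ⊥-elim (ℕₚ.<-irrefl refl (length-⊆ {xs = p ∷ q ∷ a ∷ b ∷ c ∷ []} {ys = allFin 4}
      ((pq ∷ pa ∷ pb ∷ pc ∷ []) ∷ (qa ∷ qb ∷ qc ∷ []) ∷ (ab ∷ ac ∷ []) ∷ (bc ∷ []) ∷ [] ∷ []) (λ {z} _ → ∈-allFin z)))

    center : ∀ {a b c : Fin 3} → a ≢ b → b ≢ c → a ≢ c →
      In (suc a) (suc b) (suc c) zero ⊎ In (suc b) (suc a) (suc c) zero
    center {a} {b} {c} = from-yes (Finₚ.all? λ a → Finₚ.all? λ b → Finₚ.all? λ c →
      ¬? (a Fin.≟ b) →-dec (¬? (b Fin.≟ c) →-dec (¬? (a Fin.≟ c) →-dec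
        (In₀? (suc a) (suc b) (suc c) zero ⊎-dec In₀? (suc b) (suc a) (suc c) zero)))) a b c

    free-small : FreeBound (orientation pos λ {a} {b} {c} → general {a} {b} {c}) 3
    free-small {Q} u free with length Q ℕ.≤? 3
    ... | yes le = le
    ... | no gt = ⊥-elim ([ free {1F} {2F} {3F} {0F} (every _) (every _) (every _) , free {2F} {1F} {3F} {0F} (every _) (every _) (every _) ]′
        (center {zero} {suc zero} {suc (suc zero)} (λ ()) (λ ()) (λ ())))
      where
      open import Data.Fin.Patterns using (0F; 1F; 2F; 3F)
      open import Data.List.Membership.DecPropositional (Fin._≟_ {4}) using (_∈?_)
      every : ∀ x → x ∈ Q
      every x with x ∈? Q
      ... | yes x∈ = x∈
      ... | no x∉ = ⊥-elim (gt (ℕₚ.≤-pred (length-⊆ {xs = x ∷ Q} {ys = allFin 4} (All.¬Any⇒All¬ Q x∉ ∷ u) (λ {z} _ → ∈-allFin z))))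

    configuration : Configuration 3
    configuration = record
      { A = Fin 4 ; B = Fin 3 ; _≟_ = Fin._≟_
      ; elements = allFin 4 ; complete = ∈-allFin ; distinct = Unique.allFin⁺ 4 ; size = refl
      ; hull = allFin 3 ; hull-complete = ∈-allFin ; hull-distinct = Unique.allFin⁺ 3 ; hull-size = refl
      ; ι = suc ; ι-injective = Finₚ.suc-injective
      ; pos = pos
      ; pos-injective = λ {a} {b} → from-yes (Finₚ.all? λ a → Finₚ.all? λ b → (pos a ≟P pos b) →-dec (a Fin.≟ b)) a b
      ; general = λ {a} {b} {c} → general {a} {b} {c}
      ; dir = dir
      ; dir≢0 = from-yes (Finₚ.all? λ b → 0ℚ <? norm² (dir b))
      ; support = λ {b} {z} → support {b} {z}
      ; sparse = λ {a} {b} {c} {p} {q} i j →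
          let ab , bc , ac , pa , pb , pc = In-distinct {a} {b} {c} {p} i
              _ , _ , _ , qa , qb , qc = In-distinct {a} {b} {c} {q} j
          in fourth ab bc ac pa pb pc qa qb qc
      ; hullTriangles = λ {a} {b} {c} x y z → zero , center {a} {b} {c} x y z
      ; freeBound = λ {Q} → free-small {Q} }
      where
      import Data.Product.Properties as ×ₚ
      import Data.Rational.Properties as ℚₚ
      _≟P_ = ×ₚ.≡-dec ℚₚ._≟_ ℚₚ._≟_

  -- The index grows by two with each doubling, so the segment and the triangle with its center
  -- serve the two parities.
  configuration : ∀ j → Configuration (2 ℕ.+ j)
  configuration zero = segment
  configuration (suc zero) = Triangle.configuration
  configuration (suc (suc j)) = Double.doubled (configuration j)

  module Avoiding {K} (c : Configuration K) where
    open Configuration c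
    open Planar (orientation pos λ {a} {b} {c} → general {a} {b} {c})
    open SimplePentagons (orientation pos λ {a} {b} {c} → general {a} {b} {c})

    S : List Point
    S = map pos elements

    S-general : GeneralPosition S
    S-general a∈ b∈ c∈ a≢b b≢c a≢c with ∈-map⁻ pos a∈ | ∈-map⁻ pos b∈ | ∈-map⁻ pos c∈
    ... | a , _ , refl | b , _ , refl | c , _ , refl =
      general {a} {b} {c} (a≢b ∘ cong pos) (b≢c ∘ cong pos) (a≢c ∘ cong pos)

    S-unique : Unique S
    S-unique = Unique.map⁺ pos-injective distinct

    preimage : ∀ {P} → All (_∈ S) P → ∃[ Q ] map pos Q ≡ P
    preimage [] = [] , refl
    preimage (p∈ ∷ ps) with ∈-map⁻ pos p∈ | preimage ps
    ... | a , _ , refl | Q , refl = a ∷ Q , refl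

    unmap : ∀ {Q} → Unique (map pos Q) → Unique Q
    unmap {[]} _ = []
    unmap {a ∷ Q} (h ∷ u) = All.map (λ ne e → ne (cong pos e)) (All.map⁻ h) ∷ unmap u

    -- The vertices of a hole form a free list: a point inside a triangle of them would be left of
    -- every edge, hence inside the polygon.
    no-hole : ¬ HasHole (suc K) S
    no-hole (P , len , (u , P⊆S) , convexCCW , empty) with preimage P⊆S
    ... | Q , refl = ℕₚ.<⇒≱ (ℕₚ.≤-reflexive (trans (sym len) (length-map pos Q))) (freeBound {Q} (unmap u) (λ {a} {b} {c} {p} → free {a} {b} {c} {p}))
      where
      free : Free Q
      free {a} {b} {c} {p} a∈ b∈ c∈ i = empty (∈-map⁺ pos (complete p)) inside
        where
        inside : InConvexInterior (map pos Q) (pos p)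
        inside {s} {t} e∈ with ∈-map⁻ (Product.map pos pos) (subst ((s , t) ∈_) (edges-map pos Q) e∈)
        ... | (u , w) , _ , refl = In-left {u} {w} {a} {b} {c} {p} (place a∈) (place b∈) (place c∈) i
          where
          place : ∀ {z} → z ∈ Q → OnOrLeft u w z
          place {z} z∈ with z ≟ u | z ≟ w
          ... | yes p | _ = inj₁ (inj₁ p)
          ... | _ | yes p = inj₁ (inj₂ p)
          ... | no p | no q = inj₂ (convexCCW e∈ (∈-map⁺ pos z∈) (p ∘ pos-injective) (q ∘ pos-injective))

    toCross : ∀ {a b c d} → Crossing a b c d → Cross (pos a) (pos b) (pos c) (pos d)
    toCross {a} {b} {c} {d} (h , k) = opposite (pos a) (pos b) (pos c) (pos d) h , opposite (pos c) (pos d) (pos a) (pos b) k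
      where
      opposite : ∀ a b c d → (0ℚ < orient a b c × 0ℚ < orient b a d) ⊎ (0ℚ < orient b a c × 0ℚ < orient a b d) →
        (orient a b c * orient a b d) < 0ℚ
      opposite a b c d (inj₁ (h , k)) = pos*neg h (left-anti {b} {a} {d} k)
      opposite a b c d (inj₂ (h , k)) = neg*pos (left-anti {b} {a} {c} h) k

    no-pseudoTriangle : ¬ HasEmptyPseudoTriangle 5 S
    no-pseudoTriangle (P , (u , P⊆S) , (len , simple , _ , corners≡3) , _) with preimage P⊆S
    no-pseudoTriangle (_ , (u , _) , (len , simple , _ , corners≡3) , _) | v₀ ∷ v₁ ∷ v₂ ∷ v₃ ∷ v₄ ∷ [] , refl =
      let a , b , c , p , q , p∈ , q∈ , p≢q = crowded {v₀} {v₁} {v₂} {v₃} {v₄} pentagon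
            (trans (sym (count-filter (λ t → 0ℚ <? orient (proj₁ t) (proj₁ (proj₂ t)) (proj₂ (proj₂ t))) (corners P))) corners≡3)
      in p≢q (sparse {a} {b} {c} {p} {q} p∈ q∈)
      where
      P = map pos (v₀ ∷ v₁ ∷ v₂ ∷ v₃ ∷ v₄ ∷ [])
      apart : ∀ {a b c d} → (pos a , pos b) ∈ edges P → (pos c , pos d) ∈ edges P →
        a ≢ c → a ≢ d → b ≢ c → b ≢ d → ¬ Crossing a b c d
      apart {a} {b} {c} {d} e f ac ad bc bd k = simple e f (ac ∘ pos-injective) (ad ∘ pos-injective) (bc ∘ pos-injective) (bd ∘ pos-injective)
        (toCross {a} {b} {c} {d} k)
      pentagon : Pentagon v₀ v₁ v₂ v₃ v₄
      pentagon with unmap u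
      ... | u′@((a ∷ b ∷ c ∷ d ∷ []) ∷ (e ∷ f ∷ g ∷ []) ∷ (h ∷ i ∷ []) ∷ (j ∷ []) ∷ _) = record
        { unique = u′
        ; apart₀₂ = apart {v₀} {v₁} {v₂} {v₃} (here refl) (there (there (here refl))) b c e f
        ; apart₁₃ = apart {v₁} {v₂} {v₃} {v₄} (there (here refl)) (there (there (there (here refl)))) f g h i
        ; apart₂₄ = apart {v₂} {v₃} {v₄} {v₀} (there (there (here refl))) (there (there (there (there (here refl))))) i (≢-sym b) j (≢-sym c)
        ; apart₃₀ = apart {v₃} {v₄} {v₀} {v₁} (there (there (there (here refl)))) (here refl) (≢-sym c) (≢-sym f) (≢-sym d) (≢-sym g)
        ; apart₄₁ = apart {v₄} {v₀} {v₁} {v₂} (there (there (there (there (here refl))))) (there (here refl)) (≢-sym g) (≢-sym i) a b }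
    no-pseudoTriangle (_ , _ , (() , _) , _) | [] , refl
    no-pseudoTriangle (_ , _ , (() , _) , _) | _ ∷ [] , refl
    no-pseudoTriangle (_ , _ , (() , _) , _) | _ ∷ _ ∷ [] , refl
    no-pseudoTriangle (_ , _ , (() , _) , _) | _ ∷ _ ∷ _ ∷ [] , refl
    no-pseudoTriangle (_ , _ , (() , _) , _) | _ ∷ _ ∷ _ ∷ _ ∷ [] , refl
    no-pseudoTriangle (_ , _ , (() , _) , _) | _ ∷ _ ∷ _ ∷ _ ∷ _ ∷ _ ∷ _ , refl

    necessary : ∀ {N} → Forces (suc K) 5 N → suc (G K) ℕ.≤ N
    necessary {N} f with suc (G K) ℕ.≤? N
    ... | yes le = le
    -- A smaller `N` is at most `G K`, so the configuration itself is large enough for `Forces` to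
    -- apply to it.
    ... | no gt = ⊥-elim ([ no-hole , no-pseudoTriangle ]′ (f S S-unique S-general
        (ℕₚ.≤-trans (ℕₚ.≤-pred (ℕₚ.≰⇒> gt)) (ℕₚ.≤-reflexive (sym (trans (length-map pos elements) size))))))

  half-even : ∀ m → ⌊ m ℕ.* 2 /2⌋ ≡ m
  half-even zero = refl
  half-even (suc m) = cong suc (half-even m)

  half-odd : ∀ m → ⌊ suc (m ℕ.* 2) /2⌋ ≡ m
  half-odd zero = refl
  half-odd (suc m) = cong suc (half-odd m)

  -- Closed forms of `G`, with the 2 added on the left to keep truncated subtraction out of the
  -- induction.
  G-even : ∀ m → 2 ℕ.+ G (m ℕ.* 2) ≡ 2 ^ suc m
  G-even zero = refl
  G-even (suc m) rewrite half-even m | half-odd m = begin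
    2 ℕ.+ (G (m ℕ.* 2) ℕ.+ 2 ^ m ℕ.+ 2 ^ m) ≡⟨ cong (2 ℕ.+_) (ℕₚ.+-assoc (G (m ℕ.* 2)) _ _) ⟩
    2 ℕ.+ G (m ℕ.* 2) ℕ.+ (2 ^ m ℕ.+ 2 ^ m) ≡⟨ cong₂ ℕ._+_ (G-even m) (cong (2 ^ m ℕ.+_) (sym (ℕₚ.+-identityʳ (2 ^ m)))) ⟩
    2 ^ suc m ℕ.+ 2 ^ suc m ≡⟨ cong (2 ^ suc m ℕ.+_) (sym (ℕₚ.+-identityʳ (2 ^ suc m))) ⟩
    2 ^ suc (suc m) ∎
    where open ≡-Reasoning

  G-odd : ∀ m → 2 ℕ.+ G (suc (m ℕ.* 2)) ≡ 3 ℕ.* 2 ^ m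
  G-odd m rewrite half-even m = begin
    2 ℕ.+ G (m ℕ.* 2) ℕ.+ 2 ^ m ≡⟨ cong (ℕ._+ 2 ^ m) (G-even m) ⟩
    2 ^ suc m ℕ.+ 2 ^ m ≡⟨ ℕₚ.+-comm (2 ^ suc m) (2 ^ m) ⟩
    3 ℕ.* 2 ^ m ∎
    where open ≡-Reasoning

  M-even : ∀ k → k % 2 ≡ 0 → M k ≡ 3 ℕ.* 2 ^ (k / 2 ∸ 1) ∸ 1
  M-even k eq with k % 2 | eq
  ... | .0 | refl = refl

  M-odd : ∀ k → k % 2 ≡ 1 → M k ≡ 2 ^ (k / 2 ℕ.+ 1) ∸ 1
  M-odd k eq with k % 2 | eq
  ... | .1 | refl = refl

  M≡G : ∀ j → M (3 ℕ.+ j) ≡ suc (G (2 ℕ.+ j))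
  M≡G j = go _ _ refl refl (DivMod.m≡m%n+[m/n]*n k 2) (DivMod.m%n<n k 2)
    where
    k = 3 ℕ.+ j
    go : ∀ r q → k % 2 ≡ r → k / 2 ≡ q → k ≡ r ℕ.+ q ℕ.* 2 → r ℕ.< 2 → M k ≡ suc (G (2 ℕ.+ j))
    -- `G` is evaluated at `k` - 1, so the parity changes: for even `k`, the odd closed form applies
    -- with `q` = `k / 2 ∸ 1`.
    go 0 (suc q) r≡ q≡ eq _ = trans (M-even k r≡) (trans (cong (λ h → 3 ℕ.* 2 ^ (h ∸ 1) ∸ 1) q≡)
        (trans (cong (_∸ 1) (sym (G-odd q))) (cong (λ n → suc (G n)) (sym (ℕₚ.suc-injective eq)))))
    go 1 q r≡ q≡ eq _ = trans (M-odd k r≡) (trans (cong (λ h → 2 ^ (h ℕ.+ 1) ∸ 1) q≡)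
        (trans (cong (λ h → 2 ^ h ∸ 1) (ℕₚ.+-comm q 1))
        (trans (cong (_∸ 1) (sym (G-even q))) (cong (λ n → suc (G n)) (sym (ℕₚ.suc-injective eq))))))
    go 0 zero _ _ () _
    go (suc (suc _)) _ _ _ _ (s≤s (s≤s ()))

  exact : ∀ j → IsE (3 ℕ.+ j) 5 (M (3 ℕ.+ j))
  exact j = subst (IsE (3 ℕ.+ j) 5) (sym (M≡G j)) (forces j , λ N → Avoiding.necessary (configuration j))

open LowerBound using (exact)
open import Defs
open import Data.Nat using (ℕ; _≤_; suc; s≤s)

theorem3 : ∀ (k : ℕ) → 3 ≤ k → IsE k 5 (M k)
theorem3 (suc (suc (suc j))) _ = exact j
theorem3 1 (s≤s ())
theorem3 2 (s≤s (s≤s ()))
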